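{- Let $G$ be a graph and let $k\geq 3$ be an integer. A complex number $\lambda$ is an eigenvalue of the power hypergraph $G^{(k)}$ if and only if: (a) when $k=3$: some signed induced subgraph of $G$ has an eigenvalue $\beta$ with $\beta^2=\lambda^k$; (b) when $k\geq 4$: some signed subgraph of $G$ has an eigenvalue $\beta$ with $\beta^2=\lambda^k$.
   Context: Tensor eigenvalues: for a $k$-order $n$-dimensional complex tensor $T=(t_{i_1\cdots i_k})$ and $\mathbf{x}\in\mathbb{C}^n$, $T\mathbf{x}^{k-1}\in\mathbb{C}^n$ has $i$-th entry $\sum_{i_2,\dots,i_k=1}^n t_{i i_2\cdots i_k}x_{i_2}\cdots x_{i_k}$, and $\mathbf{x}^{[k-1]}=(x_1^{k-1},\dots,x_n^{k-1})^\top$. A number $\lambda\in\mathbb{C}$ is an eigenvalue of $T$ with eigenvector $\mathbf{x}$ if $\mathbf{x}\neq 0$ and $T\mathbf{x}^{k-1}=\lambda\mathbf{x}^{[k-1]}$. The adjacency tensor of a $k$-uniform hypergraph $H$ on $n$ vertices is the $k$-order $n$-dimensional tensor with $a_{i_1\cdots i_k}=\frac{1}{(k-1)!}$ if $\{i_1,\dots,i_k\}$ is an edge of $H$ and $0$ otherwise; eigenvalues of $H$ are the eigenvalues of its adjacency tensor. The $k$-power hypergraph $G^{(k)}$ of a graph $G$ is the $k$-uniform hypergraph obtained by adding $k-2$ new vertices to each edge of $G$ (distinct edges receive disjoint sets of new vertices); for $e\in E(G)$, $N_e$ denotes the set of new vertices added to $e$, so $e\cup N_e$ is a hyperedge. A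 signed graph $G_\pi$ is a graph $G=(V,E)$ with a sign function $\pi:E\to\{+1,-1\}$; its adjacency matrix is the symmetric matrix with $(i,j)$ entry $\pi(i,j)$ if $i\sim j$ and $0$ otherwise, and its eigenvalues are those of this matrix. A signed (induced) subgraph of $G$ is a signed graph $\widehat G_\pi$ where $\widehat G$ is an (induced) subgraph of $G$ and $\pi$ is any sign function on $E(\widehat G)$. -}

module Defs where

open import Algebra.Bundles using (RawRing)
open import Data.Fin.Base using (Fin; zero; suc; splitAt; _<_; _↑ˡ_; _↑ʳ_; combine)
open import Data.Fin.Properties as Fin using (_<?_; any?)
open import Data.Fin.Subset using (Subset; ⁅_⁆; _∪_; ⋃; ∣_∣; _∈_; _∉_)
open import Data.Fin.Subset.Properties using (∣⊥∣≡0; ∪-identityˡ; x∈p∪q⁻; x∈⁅y⁆⇒x≡y; ∉⊥)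
open import Data.Integer.Base using (+_)
open import Data.List.Base as List using (List; []; _∷_; length; lookup; filter; cartesianProduct; allFin)
open import Data.List.Membership.Propositional using () renaming (_∈_ to _∈ₗ_)
open import Data.List.Membership.Propositional.Properties using (∈-lookup; ∈-filter⁻)
open import Data.List.Properties using (length-tabulate)
open import Data.List.Relation.Unary.All as All using ([]; _∷_)
open import Data.List.Relation.Unary.All.Properties using (tabulate⁺)
open import Data.List.Relation.Unary.Any using (here; there)
open import Data.List.Relation.Unary.AllPairs using ([]; _∷_)
open import Data.List.Relation.Unary.Unique.Propositional using (Unique)
open import Data.List.Relation.Unary.Unique.Propositional.Properties as Unique using ()
open import Data.Bool.Base using (true; false; if_then_else_)
open import Data.Bool.Properties as Bool using ()
open import Data.Nat.Base as ℕ using (ℕ; zero; suc; pred; _∸_; _!; s≤s)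
open import Data.Nat.Properties as ℕ using (_!≢0)
open import Data.Product.Base using (_×_; _,_; proj₁; proj₂; ∃; ∃-syntax; Σ-syntax)
open import Data.Rational.Base as ℚ using (ℚ; 0ℚ; 1ℚ; ½; Positive)
open import Data.Rational.Properties as ℚ using ()
open import Data.Rational.Solver using (module +-*-Solver)
open import Data.Sign.Base as Sign using (Sign)
open import Data.Sum.Base using (inj₁; inj₂)
open import Data.Vec.Base as Vec using (Vec; []; _∷_)
open import Data.Vec.Functional using (Vector)
open import Data.Vec.Properties as Vec using ()
open import Function.Base using (_∘_)
open import Function.Definitions using (Injective)
open import Level using (0ℓ)
open import Relation.Binary.Core using (Rel)
open import Relation.Binary.Definitions using (Decidable; Symmetric; Irreflexive)
open import Relation.Binary.PropositionalEquality
  using (_≡_; _≢_; refl; sym; trans; cong; subst)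
open import Relation.Nullary using (¬_; does; contradiction)
open import Relation.Nullary.Decidable using (_×-dec_)
open import Relation.Unary as Unary using (Pred)

open +-*-Solver using (solve; _:+_; _:*_; _:-_; :-_; _:=_)

IsCauchy : (ℕ → ℚ) → Set
IsCauchy x = ∀ ε → 0ℚ ℚ.< ε →
  ∃[ N ] (∀ m n → N ℕ.≤ m → N ℕ.≤ n → ℚ.∣ x m ℚ.- x n ∣ ℚ.< ε)

-- Real numbers are Cauchy sequences of rationals, to be compared by _≈ℝ_.
record ℝ : Set where
  constructor mkℝ
  field
    seq    : ℕ → ℚ
    cauchy : IsCauchy seq

open ℝ public

infix 4 _≈ℝ_

_≈ℝ_ : Rel ℝ 0ℓ
x ≈ℝ y = ∀ ε → 0ℚ ℚ.< ε →
  ∃[ N ] (∀ n → N ℕ.≤ n → ℚ.∣ seq x n ℚ.- seq y n ∣ ℚ.< ε)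

half>0 : ∀ {ε} → 0ℚ ℚ.< ε → 0ℚ ℚ.< ½ ℚ.* ε
half>0 {ε} 0<ε = ℚ.positive⁻¹ (½ ℚ.* ε)
  {{ℚ.pos*pos⇒pos ½ ε {{ℚ.positive 0<ε}}}}

half+half : ∀ ε → ½ ℚ.* ε ℚ.+ ½ ℚ.* ε ≡ ε
half+half ε = trans (sym (ℚ.*-distribʳ-+ ε ½ ½)) (ℚ.*-identityˡ ε)

const-cauchy : ∀ q → IsCauchy (λ _ → q)
const-cauchy q ε 0<ε = 0 , λ _ _ _ _ →
  subst (λ r → ℚ.∣ r ∣ ℚ.< ε) (sym (ℚ.+-inverseʳ q)) 0<ε

+-cauchy : ∀ {x y} → IsCauchy x → IsCauchy y → IsCauchy (λ n → x n ℚ.+ y n)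
+-cauchy {x} {y} cx cy ε 0<ε
  with M , hx ← cx (½ ℚ.* ε) (half>0 0<ε)
  with N , hy ← cy (½ ℚ.* ε) (half>0 0<ε) = M ℕ.+ N , λ m n p q → begin-strict
    ℚ.∣ (x m ℚ.+ y m) ℚ.- (x n ℚ.+ y n) ∣
      ≡⟨ cong ℚ.∣_∣ (solve 4 (λ a b c d → (a :+ b) :- (c :+ d) := (a :- c) :+ (b :- d))
           refl (x m) (y m) (x n) (y n)) ⟩
    ℚ.∣ (x m ℚ.- x n) ℚ.+ (y m ℚ.- y n) ∣
      ≤⟨ ℚ.∣p+q∣≤∣p∣+∣q∣ (x m ℚ.- x n) (y m ℚ.- y n) ⟩
    ℚ.∣ x m ℚ.- x n ∣ ℚ.+ ℚ.∣ y m ℚ.- y n ∣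
      <⟨ ℚ.+-mono-< (hx m n (ℕ.m+n≤o⇒m≤o M p) (ℕ.m+n≤o⇒m≤o M q))
                    (hy m n (ℕ.m+n≤o⇒n≤o M p) (ℕ.m+n≤o⇒n≤o M q)) ⟩
    ½ ℚ.* ε ℚ.+ ½ ℚ.* ε
      ≡⟨ half+half ε ⟩
    ε ∎
  where open ℚ.≤-Reasoning

neg-cauchy : ∀ {x} → IsCauchy x → IsCauchy (λ n → ℚ.- x n)
neg-cauchy {x} cx ε 0<ε with N , hx ← cx ε 0<ε = N , λ m n p q →
  subst (ℚ._< ε)
    (trans (sym (ℚ.∣-p∣≡∣p∣ (x m ℚ.- x n)))
           (cong ℚ.∣_∣ (solve 2 (λ a b → :- (a :- b) := (:- a) :- (:- b)) refl (x m) (x n))))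
    (hx m n p q)

eventually-bounded : ∀ {x} → IsCauchy x →
  ∃[ B ] Positive B × ∃[ N ] (∀ n → N ℕ.≤ n → ℚ.∣ x n ∣ ℚ.≤ B)
eventually-bounded {x} cx with N , hx ← cx 1ℚ (ℚ.positive⁻¹ 1ℚ) =
  1ℚ ℚ.+ ℚ.∣ x N ∣ ,
  ℚ.pos+nonNeg⇒pos 1ℚ ℚ.∣ x N ∣ {{ℚ.∣-∣-nonNeg (x N)}} ,
  N , λ n N≤n → begin
    ℚ.∣ x n ∣
      ≡⟨ cong ℚ.∣_∣ (solve 2 (λ a b → a := (a :- b) :+ b) refl (x n) (x N)) ⟩
    ℚ.∣ (x n ℚ.- x N) ℚ.+ x N ∣
      ≤⟨ ℚ.∣p+q∣≤∣p∣+∣q∣ (x n ℚ.- x N) (x N) ⟩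
    ℚ.∣ x n ℚ.- x N ∣ ℚ.+ ℚ.∣ x N ∣
      ≤⟨ ℚ.+-monoˡ-≤ ℚ.∣ x N ∣ (ℚ.<⇒≤ (hx n N N≤n ℕ.≤-refl)) ⟩
    1ℚ ℚ.+ ℚ.∣ x N ∣ ∎
  where open ℚ.≤-Reasoning

reciprocal : ∀ B → Positive B → ℚ
reciprocal B B>0 = (ℚ.1/ B) {{ℚ.pos⇒nonZero B {{B>0}}}}

bounded-*-small : ∀ p q B (B>0 : Positive B) ε →
  ℚ.∣ p ∣ ℚ.≤ B → ℚ.∣ q ∣ ℚ.< reciprocal B B>0 ℚ.* ε → ℚ.∣ p ℚ.* q ∣ ℚ.< ε
bounded-*-small p q B B>0 ε p≤B q<δ = begin-strict
  ℚ.∣ p ℚ.* q ∣          ≡⟨ ℚ.∣p*q∣≡∣p∣*∣q∣ p q ⟩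
  ℚ.∣ p ∣ ℚ.* ℚ.∣ q ∣    ≤⟨ ℚ.*-monoʳ-≤-nonNeg ℚ.∣ q ∣ {{ℚ.∣-∣-nonNeg q}} p≤B ⟩
  B ℚ.* ℚ.∣ q ∣          <⟨ ℚ.*-monoʳ-<-pos B {{B>0}} q<δ ⟩
  B ℚ.* (r ℚ.* ε)        ≡⟨ ℚ.*-assoc B r ε ⟨
  (B ℚ.* r) ℚ.* ε        ≡⟨ cong (ℚ._* ε) (ℚ.*-inverseʳ B {{ℚ.pos⇒nonZero B {{B>0}}}}) ⟩
  1ℚ ℚ.* ε               ≡⟨ ℚ.*-identityˡ ε ⟩
  ε ∎
  where
  open ℚ.≤-Reasoning
  r = reciprocal B B>0

scaled-cauchy : ∀ {x} → IsCauchy x → ∀ B (B>0 : Positive B) ε → 0ℚ ℚ.< ε →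
  ∃[ N ] (∀ m n → N ℕ.≤ m → N ℕ.≤ n →
    ℚ.∣ x m ℚ.- x n ∣ ℚ.< reciprocal B B>0 ℚ.* ε)
scaled-cauchy cx B B>0 ε 0<ε = cx (reciprocal B B>0 ℚ.* ε) (ℚ.positive⁻¹ (reciprocal B B>0 ℚ.* ε)
  {{ℚ.pos*pos⇒pos (reciprocal B B>0) {{ℚ.1/pos⇒pos B {{B>0}}}} ε {{ℚ.positive 0<ε}}}})

*-difference : ∀ a b c d → a ℚ.* b ℚ.- c ℚ.* d ≡ a ℚ.* (b ℚ.- d) ℚ.+ d ℚ.* (a ℚ.- c)
*-difference = solve 4 (λ a b c d → a :* b :- c :* d := a :* (b :- d) :+ d :* (a :- c)) refl

*-close : ∀ a b c d B (B>0 : Positive B) C (C>0 : Positive C) ε →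
  ℚ.∣ a ∣ ℚ.≤ B → ℚ.∣ d ∣ ℚ.≤ C →
  ℚ.∣ b ℚ.- d ∣ ℚ.< reciprocal B B>0 ℚ.* (½ ℚ.* ε) →
  ℚ.∣ a ℚ.- c ∣ ℚ.< reciprocal C C>0 ℚ.* (½ ℚ.* ε) →
  ℚ.∣ a ℚ.* b ℚ.- c ℚ.* d ∣ ℚ.< ε
*-close a b c d B B>0 C C>0 ε a≤B d≤C b-d< a-c< = begin-strict
  ℚ.∣ a ℚ.* b ℚ.- c ℚ.* d ∣
    ≡⟨ cong ℚ.∣_∣ (*-difference a b c d) ⟩
  ℚ.∣ a ℚ.* (b ℚ.- d) ℚ.+ d ℚ.* (a ℚ.- c) ∣
    ≤⟨ ℚ.∣p+q∣≤∣p∣+∣q∣ (a ℚ.* (b ℚ.- d)) (d ℚ.* (a ℚ.- c)) ⟩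
  ℚ.∣ a ℚ.* (b ℚ.- d) ∣ ℚ.+ ℚ.∣ d ℚ.* (a ℚ.- c) ∣
    <⟨ ℚ.+-mono-< (bounded-*-small a (b ℚ.- d) B B>0 (½ ℚ.* ε) a≤B b-d<)
                  (bounded-*-small d (a ℚ.- c) C C>0 (½ ℚ.* ε) d≤C a-c<) ⟩
  ½ ℚ.* ε ℚ.+ ½ ℚ.* ε
    ≡⟨ half+half ε ⟩
  ε ∎
  where open ℚ.≤-Reasoning

*-cauchy : ∀ {x y} → IsCauchy x → IsCauchy y → IsCauchy (λ n → x n ℚ.* y n)
*-cauchy {x} {y} cx cy ε 0<ε =
  let B , B>0 , M₁ , bx = eventually-bounded {x} cx
      C , C>0 , M₂ , by = eventually-bounded {y} cy
      N₁ , hx = scaled-cauchy {x} cx C C>0 (½ ℚ.* ε) (half>0 0<ε)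
      N₂ , hy = scaled-cauchy {y} cy B B>0 (½ ℚ.* ε) (half>0 0<ε)
      M₁≤ : ∀ {m} → (M₁ ℕ.+ M₂) ℕ.+ (N₁ ℕ.+ N₂) ℕ.≤ m → M₁ ℕ.≤ m
      M₁≤ p = ℕ.m+n≤o⇒m≤o M₁ (ℕ.m+n≤o⇒m≤o (M₁ ℕ.+ M₂) p)
      M₂≤ : ∀ {m} → (M₁ ℕ.+ M₂) ℕ.+ (N₁ ℕ.+ N₂) ℕ.≤ m → M₂ ℕ.≤ m
      M₂≤ p = ℕ.m+n≤o⇒n≤o M₁ (ℕ.m+n≤o⇒m≤o (M₁ ℕ.+ M₂) p)
      N₁≤ : ∀ {m} → (M₁ ℕ.+ M₂) ℕ.+ (N₁ ℕ.+ N₂) ℕ.≤ m → N₁ ℕ.≤ m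
      N₁≤ p = ℕ.m+n≤o⇒m≤o N₁ (ℕ.m+n≤o⇒n≤o (M₁ ℕ.+ M₂) p)
      N₂≤ : ∀ {m} → (M₁ ℕ.+ M₂) ℕ.+ (N₁ ℕ.+ N₂) ℕ.≤ m → N₂ ℕ.≤ m
      N₂≤ p = ℕ.m+n≤o⇒n≤o N₁ (ℕ.m+n≤o⇒n≤o (M₁ ℕ.+ M₂) p)
  in (M₁ ℕ.+ M₂) ℕ.+ (N₁ ℕ.+ N₂) , λ m n p q →
    *-close (x m) (y m) (x n) (y n) B B>0 C C>0 ε
      (bx m (M₁≤ p)) (by n (M₂≤ q)) (hy m n (N₂≤ p) (N₂≤ q)) (hx m n (N₁≤ p) (N₁≤ q))

fromℚ : ℚ → ℝ
fromℚ q = mkℝ (λ _ → q) (const-cauchy q)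

infixl 6 _+ℝ_ _-ℝ_
infixl 7 _*ℝ_
infix  8 -ℝ_

_+ℝ_ : ℝ → ℝ → ℝ
x +ℝ y = mkℝ (λ n → seq x n ℚ.+ seq y n) (+-cauchy {seq x} {seq y} (cauchy x) (cauchy y))

_*ℝ_ : ℝ → ℝ → ℝ
x *ℝ y = mkℝ (λ n → seq x n ℚ.* seq y n) (*-cauchy {seq x} {seq y} (cauchy x) (cauchy y))

-ℝ_ : ℝ → ℝ
-ℝ x = mkℝ (λ n → ℚ.- seq x n) (neg-cauchy {seq x} (cauchy x))

_-ℝ_ : ℝ → ℝ → ℝ
x -ℝ y = x +ℝ (-ℝ y)

record ℂ : Set where
  constructor _+i_
  field
    re im : ℝ

open ℂ public

ℂ-rawRing : RawRing 0ℓ 0ℓ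
ℂ-rawRing = record
  { Carrier = ℂ
  ; _≈_     = λ z w → re z ≈ℝ re w × im z ≈ℝ im w
  ; _+_     = λ z w → (re z +ℝ re w) +i (im z +ℝ im w)
  ; _*_     = λ z w → (re z *ℝ re w -ℝ im z *ℝ im w) +i (re z *ℝ im w +ℝ im z *ℝ re w)
  ; -_      = λ z → (-ℝ re z) +i (-ℝ im z)
  ; 0#      = fromℚ 0ℚ +i fromℚ 0ℚ
  ; 1#      = fromℚ 1ℚ +i fromℚ 0ℚ
  }

open RawRing ℂ-rawRing public
  using (_≈_; _≉_; _+_; _*_; -_; 0#; 1#; rawSemiring)

open import Algebra.Definitions.RawSemiring rawSemiring public
  using (sum; _^_)

ℚ→ℂ : ℚ → ℂ
ℚ→ℂ q = fromℚ q +i fromℚ 0ℚ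

NonZeroVector : ∀ {n} → Vector ℂ n → Set
NonZeroVector x = ¬ (∀ i → x i ≈ 0#)

Matrix : ℕ → Set
Matrix n = Fin n → Fin n → ℂ

IsMatrixEigenvalue : ∀ {n} → Matrix n → ℂ → Set
IsMatrixEigenvalue {n} A μ = Σ[ x ∈ Vector ℂ n ]
  NonZeroVector x × (∀ i → sum (λ j → A i j * x j) ≈ μ * x i)

-- The first index is kept apart from the remaining k - 1, so that the
-- order k ≥ 1 need not be syntactically a successor.
Tensor : ℕ → ℕ → Set
Tensor k n = Fin n → Vec (Fin n) (pred k) → ℂ

-- The sum of f over all (i₁ , … , iₘ) with 1 ≤ iⱼ ≤ n.
multiSum : ∀ {n} m → (Vec (Fin n) m → ℂ) → ℂ
multiSum zero    f = f []
multiSum (suc m) f = sum (λ i → multiSum m (λ is → f (i ∷ is)))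

monomial : ∀ {m n} → Vector ℂ n → Vec (Fin n) m → ℂ
monomial x []       = 1#
monomial x (i ∷ is) = x i * monomial x is

-- T x^{k-1}
apply : ∀ {k n} → Tensor k n → Vector ℂ n → Vector ℂ n
apply {k} T x i = multiSum (pred k) (λ is → T i is * monomial x is)

IsTensorEigenvalue : ∀ {k n} → Tensor k n → ℂ → Set
IsTensorEigenvalue {k} {n} T μ = Σ[ x ∈ Vector ℂ n ]
  NonZeroVector x × (∀ i → apply {k} T x i ≈ μ * x i ^ pred k)

record UniformHypergraph (k n : ℕ) : Set₁ where
  field
    Edge    : Pred (Subset n) 0ℓ
    edge?   : Unary.Decidable Edge
    uniform : ∀ {s} → Edge s → ∣ s ∣ ≡ k

setOf : ∀ {n} → List (Fin n) → Subset n
setOf = ⋃ ∘ List.map ⁅_⁆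

adjacencyTensor : ∀ {k n} → UniformHypergraph k n → Tensor k n
adjacencyTensor {k} H i is =
  if does (edge? (setOf (i ∷ Vec.toList is)))
  then ℚ→ℂ ((+ 1 ℚ./ (pred k !)) {{pred k !≢0}})
  else 0#
  where open UniformHypergraph H

IsHypergraphEigenvalue : ∀ {k n} → UniformHypergraph k n → ℂ → Set
IsHypergraphEigenvalue {k} H = IsTensorEigenvalue {k} (adjacencyTensor H)

record Graph (n : ℕ) : Set₁ where
  field
    Adj     : Rel (Fin n) 0ℓ
    adj?    : Decidable Adj
    symm    : Symmetric Adj
    irrefl  : Irreflexive _≡_ Adj

-- F is, up to the naming ι of its vertices, a subgraph of G.
record IsSubgraph {m n} (F : Graph m) (G : Graph n) : Set where
  field
    ι           : Fin m → Fin n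
    ι-injective : Injective _≡_ _≡_ ι
    preserves   : ∀ {u v} → Graph.Adj F u v → Graph.Adj G (ι u) (ι v)

record IsInducedSubgraph {m n} (F : Graph m) (G : Graph n) : Set where
  field
    isSubgraph : IsSubgraph F G

  open IsSubgraph isSubgraph public

  field
    reflects : ∀ {u v} → Graph.Adj G (ι u) (ι v) → Graph.Adj F u v

-- Only the values of sign on adjacent pairs are meaningful.
record SignedGraph (n : ℕ) : Set₁ where
  field
    graph : Graph n

  open Graph graph public

  field
    sign     : Fin n → Fin n → Sign
    sign-sym : ∀ {u v} → Adj u v → sign u v ≡ sign v u

signValue : Sign → ℂ
signValue Sign.+ = 1#
signValue Sign.- = - 1#

adjacencyMatrix : ∀ {n} → SignedGraph n → Matrix n
adjacencyMatrix Γ i j = if does (adj? i j) then signValue (sign i j) else 0#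
  where open SignedGraph Γ

IsSignedGraphEigenvalue : ∀ {n} → SignedGraph n → ℂ → Set
IsSignedGraphEigenvalue Γ = IsMatrixEigenvalue (adjacencyMatrix Γ)

∣⁅x⁆∪p∣ : ∀ {n} (x : Fin n) (p : Subset n) → x ∉ p → ∣ ⁅ x ⁆ ∪ p ∣ ≡ suc ∣ p ∣
∣⁅x⁆∪p∣ zero    (true  ∷ p) x∉p = contradiction Vec.here x∉p
∣⁅x⁆∪p∣ zero    (false ∷ p) x∉p = cong (suc ∘ ∣_∣) (∪-identityˡ p)
∣⁅x⁆∪p∣ (suc x) (true  ∷ p) x∉p = cong suc (∣⁅x⁆∪p∣ x p (x∉p ∘ Vec.there))
∣⁅x⁆∪p∣ (suc x) (false ∷ p) x∉p = ∣⁅x⁆∪p∣ x p (x∉p ∘ Vec.there)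

∈-setOf⁻ : ∀ {n} {x : Fin n} xs → x ∈ setOf xs → x ∈ₗ xs
∈-setOf⁻ []       x∈ = contradiction x∈ ∉⊥
∈-setOf⁻ (y ∷ ys) x∈ with x∈p∪q⁻ ⁅ y ⁆ (setOf ys) x∈
... | inj₁ x∈⁅y⁆ = here (x∈⁅y⁆⇒x≡y y x∈⁅y⁆)
... | inj₂ x∈ys  = there (∈-setOf⁻ ys x∈ys)

∣setOf∣ : ∀ {n} {xs : List (Fin n)} → Unique xs → ∣ setOf xs ∣ ≡ length xs
∣setOf∣ {n} []             = ∣⊥∣≡0 n
∣setOf∣ {xs = x ∷ xs} (x∉xs ∷ uxs) =
  trans (∣⁅x⁆∪p∣ x (setOf xs) (λ x∈ → All.lookup x∉xs (∈-setOf⁻ xs x∈) refl))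
        (cong suc (∣setOf∣ uxs))

module _ {n : ℕ} (G : Graph n) where
  open Graph G

  IsOrderedEdge : Pred (Fin n × Fin n) 0ℓ
  IsOrderedEdge (u , v) = u < v × Adj u v

  isOrderedEdge? : Unary.Decidable IsOrderedEdge
  isOrderedEdge? (u , v) = (u <? v) ×-dec adj? u v

  -- Each edge {u , v} is listed exactly once, as (u , v) with u < v.
  edges : List (Fin n × Fin n)
  edges = filter isOrderedEdge? (cartesianProduct (allFin n) (allFin n))

  ∣E∣ : ℕ
  ∣E∣ = length edges

  end₁ end₂ : Fin ∣E∣ → Fin n
  end₁ e = proj₁ (lookup edges e)
  end₂ e = proj₂ (lookup edges e)

  -- G^(k) has the n vertices of G followed by k - 2 new ones per edge.
  powerOrder : ℕ → ℕ
  powerOrder k = n ℕ.+ ∣E∣ ℕ.* (k ∸ 2)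

  oldVertex : ∀ k → Fin n → Fin (powerOrder k)
  oldVertex k v = v ↑ˡ (∣E∣ ℕ.* (k ∸ 2))

  newVertex : ∀ k → Fin ∣E∣ → Fin (k ∸ 2) → Fin (powerOrder k)
  newVertex k e j = n ↑ʳ combine e j

  -- e ∪ N_e
  hyperedge : ∀ k → Fin ∣E∣ → List (Fin (powerOrder k))
  hyperedge k e =
    oldVertex k (end₁ e) ∷ oldVertex k (end₂ e) ∷ List.tabulate (newVertex k e)

  ends-distinct : ∀ e → end₁ e ≢ end₂ e
  ends-distinct e = Fin.<⇒≢
    (proj₁ (proj₂ (∈-filter⁻ isOrderedEdge? {xs = cartesianProduct (allFin n) (allFin n)}
                    (∈-lookup {xs = edges} e))))

  old≢new : ∀ k v e j → oldVertex k v ≢ newVertex k e j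
  old≢new k v e j eq with () ←
    trans (sym (Fin.splitAt-↑ˡ n v _)) (trans (cong (splitAt n) eq) (Fin.splitAt-↑ʳ n _ (combine e j)))

  hyperedge-unique : ∀ k e → Unique (hyperedge k e)
  hyperedge-unique k e =
    ((λ eq → ends-distinct e (Fin.↑ˡ-injective _ _ _ eq)) ∷ tabulate⁺ (old≢new k _ e)) ∷
    tabulate⁺ (old≢new k _ e) ∷
    Unique.tabulate⁺ (λ eq → Fin.combine-injectiveʳ e _ e _ (Fin.↑ʳ-injective n _ _ eq))

  powerHypergraph : ∀ k → 2 ℕ.≤ k → UniformHypergraph k (powerOrder k)
  powerHypergraph k 2≤k = record
    { Edge    = λ s → ∃[ e ] s ≡ setOf (hyperedge k e)
    ; edge?   = λ s → any? (λ e → Vec.≡-dec Bool._≟_ s (setOf (hyperedge k e)))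
    ; uniform = λ { (e , refl) →
        trans (∣setOf∣ (hyperedge-unique k e))
              (trans (cong (2 ℕ.+_) (length-tabulate (newVertex k e))) (ℕ.m+[n∸m]≡n 2≤k)) }
    }

-- Multiplying the eigenvalue equation at a vertex i of G^(k) by x_i gives
-- Σ_{e ∋ i} Q_e = μ x_i^k, where Q_e is the product of x over e ∪ N_e. If μ ≠ 0,
-- then all added vertices of an edge e = uv have x_w^k = Q_e / μ, and if moreover
-- Q_e ≠ 0 this yields μ^(k-2) Q_e² = (x_u x_v)^k. With β² = μ^k and y_v² = x_v^k we
-- get β Q_e = ± μ y_u y_v, and these signs turn the equations at the old vertices
-- into β y = A y on the signed subgraph of the vertices with x_v ≠ 0 and the edges
-- with Q_e ≠ 0. For k = 3 the equation μ x_w² = x_u x_v makes it induced.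
--
-- Conversely, a signed graph is real symmetric, so y may be taken real and x_v^k = y_v²
-- is solved by real roots. With μ s² = x_u x_v, the values s on N_e give
-- β Q_e = ± μ y_u y_v for some sign, and a wrong sign is corrected by k-th roots of -1.
-- Only square roots are needed for those, as -1 is its own k-th root for k odd.

module Submission where

open import Defs using (Graph; SignedGraph; IsSubgraph; UniformHypergraph; powerHypergraph; setOf; ∈-setOf⁻; ∣⁅x⁆∪p∣;
  isOrderedEdge?; edges; ∣E∣; end₁; end₂; powerOrder; oldVertex; newVertex; hyperedge; hyperedge-unique;
  ends-distinct; old≢new)
open import Algebra.Bundles using (CommutativeRing)
import Algebra.Properties.CommutativeMonoid.Sum as Product
import Algebra.Properties.CommutativeSemiring.Exp as Exp
import Algebra.Properties.Ring as RingProperties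
import Algebra.Properties.Semiring.Mult as Mult
import Algebra.Properties.Semiring.Sum as Sum
import Algebra.Solver.Ring.NaturalCoefficients.Default as Solver
open import Axiom.ExcludedMiddle using (ExcludedMiddle)
open import Data.Bool.Base using (true; false; if_then_else_)
open import Data.Bool.Properties as Bool using ()
open import Data.Empty using () renaming (⊥ to Empty)
open import Data.Fin.Base as Fin using (Fin; zero; suc; _<_; splitAt; remQuot; combine; _↑ʳ_; join)
open import Data.Fin.Properties as Fin using ()
open import Data.Fin.Subset using (Subset; ⊥; ⁅_⁆; _∪_; _-_; ∣_∣; _∈_; _∉_)
open import Data.Fin.Subset.Properties using (_∈?_; x∈⁅x⁆; x∈p∪q⁺; ∪-identityˡ; p─⊥≡p; ∣⊥∣≡0; p─q⊆p; x∈p∧x≢y⇒x∈p-y)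
open import Data.Integer.Base as ℤ using (+_; -[1+_])
import Data.Integer.Properties as ℤ
import Data.Integer.Solver as ℤ-Solver
open import Data.List.Base as List using (List; []; _∷_; lookup; filter; cartesianProduct; allFin; length; foldr; tabulate)
open import Data.List.Membership.Propositional using () renaming (_∈_ to _∈ₗ_)
open import Data.List.Membership.Propositional.Properties
  using (∈-lookup; ∈-filter⁻; ∈-filter⁺; ∈-cartesianProduct⁺; ∈-allFin; ∈-tabulate⁺; ∈-tabulate⁻)
open import Data.List.Relation.Unary.All as All using ([]; _∷_)
open import Data.List.Relation.Unary.AllPairs using ([]; _∷_)
open import Data.List.Relation.Unary.Any as Any using (here; there)
open import Data.List.Relation.Unary.Any.Properties using (lookup-index)
open import Data.List.Relation.Unary.Unique.Propositional using (Unique)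
open import Data.List.Relation.Unary.Unique.Propositional.Properties as Unique using ()
import Data.Nat.Coprimality as Coprime
open import Data.Nat.Base as ℕ using (ℕ; zero; suc; pred; _∸_; _!; _≤_; s≤s; z≤n)
open import Data.Nat.Induction using (<-rec)
import Data.Nat.Properties as ℕ
open import Data.Nat.Properties using (<⇒≤; _!≢0)
open import Data.Product.Base using (_×_; _,_; proj₁; proj₂; uncurry; ∃-syntax; Σ-syntax)
open import Data.Rational.Base as ℚ using (ℚ; 0ℚ; 1ℚ; ½; Positive; mkℚ)
import Data.Rational.Properties as ℚ
import Data.Rational.Solver as ℚ-Solver
import Data.Rational.Unnormalised.Base as ℚᵘ
import Data.Rational.Unnormalised.Properties as ℚᵘ
open import Data.Sign.Base as Sign using (Sign)
open import Data.Sum.Base using (_⊎_; inj₁; inj₂; [_,_]; swap)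
open import Data.Vec.Base as Vec using (Vec; []; _∷_; here; there)
open import Data.Vec.Properties as Vec using ()
open import Function.Base using (_∘_; id)
open import Function.Bundles using (_⇔_; mk⇔)
open import Function.Definitions using (Injective)
open import Level using (0ℓ)
open import Relation.Binary.Definitions using (tri<; tri≈; tri>)
open import Relation.Binary.PropositionalEquality as ≡ using (_≡_; _≢_)
import Relation.Binary.Reasoning.Setoid as SetoidReasoning
open import Relation.Nullary using (¬_; Dec; yes; no; does; contradiction)
open import Relation.Nullary.Decidable using (decidable-stable)
open import Relation.Unary using (Pred; Decidable)

-- Subsets

-- The equation at `i` follows from its multiple by `x_i` only where `x_i ≠ 0`, and the difference
-- between (a) and (b) arises at the zeros. In the converse direction an edge `uv` of `G` outside
-- the signed subgraph must not contribute at `u` and `v`, so its added vertices get the value zero.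
-- The equation at such an added vertex then asks for a second zero on the hyperedge. For `k ≥ 4`
-- another added vertex provides it. For `k = 3` it must be `u` or `v`, and this is what an induced
-- subgraph guarantees.
--
-- All divisions by `μ` and `β` assume `μ ≠ 0`. The case `μ = 0` is separate: if `G` has a vertex,
-- then `0` is an eigenvalue both of its power hypergraph and of a one-vertex subgraph, and if `G`
-- has none, neither side has a nonzero vector.
--
-- Over the complex numbers only square roots are constructed; roots of order `k` are extracted from
-- non-negative reals, hence the passage to a real eigenvector.
--
-- Equality of Cauchy reals is not decidable. Excluded middle decides which coordinates and edge
-- products vanish and which sign an edge receives.

_≟ˢ_ : ∀ {n} (p q : Subset n) → Dec (p ≡ q)
_≟ˢ_ = Vec.≡-dec Bool._≟_

∣p∣≡0⇒p≡⊥ : ∀ {n} (p : Subset n) → ∣ p ∣ ≡ 0 → p ≡ ⊥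
∣p∣≡0⇒p≡⊥ []          _  = ≡.refl
∣p∣≡0⇒p≡⊥ (false ∷ p) eq = ≡.cong (false ∷_) (∣p∣≡0⇒p≡⊥ p eq)

∣p-x∣ : ∀ {n} {x : Fin n} {p} → x ∈ p → suc ∣ p - x ∣ ≡ ∣ p ∣
∣p-x∣ {p = _ ∷ p}     here      = ≡.cong (suc ∘ ∣_∣) (p─⊥≡p p)
∣p-x∣ {p = true ∷ p}  (there h) = ≡.cong suc (∣p-x∣ h)
∣p-x∣ {p = false ∷ p} (there h) = ∣p-x∣ h

x∉p-x : ∀ {n} {x : Fin n} (p : Subset n) → x ∉ p - x
x∉p-x {x = suc x} (_ ∷ p) (there x∈) = x∉p-x p x∈

⁅x⁆∪[p-x] : ∀ {n} {x : Fin n} {p} → x ∈ p → ⁅ x ⁆ ∪ (p - x) ≡ p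
⁅x⁆∪[p-x] {p = _ ∷ p}     here      = ≡.cong (true ∷_) (≡.trans (∪-identityˡ _) (p─⊥≡p p))
⁅x⁆∪[p-x] {p = true ∷ p}  (there h) = ≡.cong (true ∷_) (⁅x⁆∪[p-x] h)
⁅x⁆∪[p-x] {p = false ∷ p} (there h) = ≡.cong (false ∷_) (⁅x⁆∪[p-x] h)

⁅x⁆∪p-x : ∀ {n} {x : Fin n} {p} → x ∉ p → (⁅ x ⁆ ∪ p) - x ≡ p
⁅x⁆∪p-x {x = zero}  {true ∷ p}  x∉p = contradiction here x∉p
⁅x⁆∪p-x {x = zero}  {false ∷ p} x∉p = ≡.cong (false ∷_) (≡.trans (p─⊥≡p _) (∪-identityˡ p))
⁅x⁆∪p-x {x = suc x} {true ∷ p}  x∉p = ≡.cong (true ∷_) (⁅x⁆∪p-x (x∉p ∘ there))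
⁅x⁆∪p-x {x = suc x} {false ∷ p} x∉p = ≡.cong (false ∷_) (⁅x⁆∪p-x (x∉p ∘ there))

x∈p⇒⁅x⁆∪p≡p : ∀ {n} {x : Fin n} {p} → x ∈ p → ⁅ x ⁆ ∪ p ≡ p
x∈p⇒⁅x⁆∪p≡p {p = _ ∷ p}     here      = ≡.cong (true ∷_) (∪-identityˡ p)
x∈p⇒⁅x⁆∪p≡p {p = true ∷ p}  (there h) = ≡.cong (true ∷_) (x∈p⇒⁅x⁆∪p≡p h)
x∈p⇒⁅x⁆∪p≡p {p = false ∷ p} (there h) = ≡.cong (false ∷_) (x∈p⇒⁅x⁆∪p≡p h)

∣setOf∣≤length : ∀ {n} (xs : List (Fin n)) → ∣ setOf xs ∣ ℕ.≤ length xs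
∣setOf∣≤length {n} [] = ℕ.≤-reflexive (∣⊥∣≡0 n)
∣setOf∣≤length (x ∷ xs) with x ∈? setOf xs
... | yes x∈ = ℕ.≤-trans (ℕ.≤-reflexive (≡.cong ∣_∣ (x∈p⇒⁅x⁆∪p≡p x∈))) (ℕ.m≤n⇒m≤1+n (∣setOf∣≤length xs))
... | no x∉ = ℕ.≤-trans (ℕ.≤-reflexive (∣⁅x⁆∪p∣ x (setOf xs) x∉)) (ℕ.s≤s (∣setOf∣≤length xs))

∈-setOf-head : ∀ {n} (x : Fin n) xs → x ∈ setOf (x ∷ xs)
∈-setOf-head x xs = x∈p∪q⁺ (inj₁ (x∈⁅x⁆ x))

-- A repeated head would leave `setOf (x ∷ xs)` with at most `length xs` elements, too few for `p`.
-- This is how a tuple whose set is an edge is seen to have distinct entries.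
setOf-∷≡⇒ : ∀ {n} {x : Fin n} xs {p} → length xs ℕ.< ∣ p ∣ → setOf (x ∷ xs) ≡ p → setOf xs ≡ p - x
setOf-∷≡⇒ {x = x} xs len ≡.refl with x ∈? setOf xs
... | no x∉ = ≡.sym (⁅x⁆∪p-x x∉)
... | yes x∈ = contradiction (ℕ.<-≤-trans len (ℕ.≤-trans (ℕ.≤-reflexive (≡.cong ∣_∣ (x∈p⇒⁅x⁆∪p≡p x∈))) (∣setOf∣≤length xs)))
  (ℕ.<-irrefl ≡.refl)

setOf≡⇒∷ : ∀ {n} {x : Fin n} xs {p} → x ∈ p → setOf xs ≡ p - x → setOf (x ∷ xs) ≡ p
setOf≡⇒∷ {x = x} xs x∈p eq = ≡.trans (≡.cong (⁅ x ⁆ ∪_) eq) (⁅x⁆∪[p-x] x∈p)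

-- Edges and hyperedges

lookup-injective : ∀ {A : Set} {xs : List A} → Unique xs → ∀ {i j} → lookup xs i ≡ lookup xs j → i ≡ j
lookup-injective (x∉ ∷ u) {zero}  {zero}  eq = ≡.refl
lookup-injective (x∉ ∷ u) {zero}  {suc j} eq = contradiction eq (All.lookup x∉ (∈-lookup j))
lookup-injective (x∉ ∷ u) {suc i} {zero}  eq = contradiction (≡.sym eq) (All.lookup x∉ (∈-lookup i))
lookup-injective (x∉ ∷ u) {suc i} {suc j} eq = ≡.cong suc (lookup-injective u eq)

∈-setOf⁺ : ∀ {n} {x : Fin n} {xs} → x ∈ₗ xs → x ∈ setOf xs
∈-setOf⁺ {xs = x ∷ xs} (here ≡.refl) = ∈-setOf-head x xs
∈-setOf⁺ (there x∈) = x∈p∪q⁺ (inj₂ (∈-setOf⁺ x∈))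

-- The vertices of a signed graph form some `Fin m`, so the support of an eigenvector has to be
-- numbered before it can carry one.
record Enumeration {n} (P : Pred (Fin n) 0ℓ) : Set where
  field
    size      : ℕ
    index     : Fin size → Fin n
    injective : Injective _≡_ _≡_ index
    sound     : ∀ i → P (index i)
    complete  : ∀ {v} → P v → ∃[ i ] index i ≡ v

enumerate : ∀ {n} {P : Pred (Fin n) 0ℓ} → Decidable P → Enumeration P
enumerate {n} {P} P? = record
  { size      = length xs
  ; index     = lookup xs
  ; injective = lookup-injective (Unique.filter⁺ P? (Unique.allFin⁺ n))
  ; sound     = λ i → proj₂ (∈-filter⁻ P? {xs = allFin n} (∈-lookup i))
  ; complete  = λ {v} Pv → let v∈ = ∈-filter⁺ P? (∈-allFin v) Pv in
      Any.index v∈ , ≡.sym (lookup-index v∈)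
  }
  where xs = filter P? (allFin n)

module _ {n} (G : Graph n) where
  open Graph G

  edges-unique : Unique (edges G)
  edges-unique = Unique.filter⁺ (isOrderedEdge? G)
    (Unique.cartesianProduct⁺ (Unique.allFin⁺ n) (Unique.allFin⁺ n))

  end₁<end₂ : ∀ e → end₁ G e < end₂ G e × Adj (end₁ G e) (end₂ G e)
  end₁<end₂ e = proj₂ (∈-filter⁻ (isOrderedEdge? G) {xs = cartesianProduct (allFin n) (allFin n)}
    (∈-lookup {xs = edges G} e))

  -- Edges are listed with their smaller end first. This relation forgets that order, so that an
  -- edge can be read from either end.
  Joins : Fin (∣E∣ G) → Fin n → Fin n → Set
  Joins e u v = (end₁ G e ≡ u × end₂ G e ≡ v) ⊎ (end₁ G e ≡ v × end₂ G e ≡ u)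

  joins-sym : ∀ {e u v} → Joins e u v → Joins e v u
  joins-sym = swap

  joins-ends : ∀ e → Joins e (end₁ G e) (end₂ G e)
  joins-ends e = inj₁ (≡.refl , ≡.refl)

  joins⇒Adj : ∀ {e u v} → Joins e u v → Adj u v
  joins⇒Adj {e} (inj₁ (≡.refl , ≡.refl)) = proj₂ (end₁<end₂ e)
  joins⇒Adj {e} (inj₂ (≡.refl , ≡.refl)) = symm (proj₂ (end₁<end₂ e))

  ordered⇒edge : ∀ {u v} → u < v → Adj u v → ∃[ e ] (end₁ G e ≡ u × end₂ G e ≡ v)
  ordered⇒edge {u} {v} u<v uv =
    let uv∈ = ∈-filter⁺ (isOrderedEdge? G) (∈-cartesianProduct⁺ (∈-allFin u) (∈-allFin v)) (u<v , uv) in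
    Any.index uv∈ , ≡.cong proj₁ (≡.sym (lookup-index uv∈)) , ≡.cong proj₂ (≡.sym (lookup-index uv∈))

  Adj⇒joins : ∀ {u v} → Adj u v → ∃[ e ] Joins e u v
  Adj⇒joins {u} {v} uv with Fin.<-cmp u v
  ... | tri< u<v _ _ = let e , eq = ordered⇒edge u<v uv in e , inj₁ eq
  ... | tri≈ _ u≡v _ = contradiction uv (irrefl u≡v)
  ... | tri> _ _ v<u = let e , eq = ordered⇒edge v<u (symm uv) in e , inj₂ eq

  ends-injective : ∀ {e e′} → end₁ G e ≡ end₁ G e′ → end₂ G e ≡ end₂ G e′ → e ≡ e′
  ends-injective p q = lookup-injective edges-unique (≡.cong₂ _,_ p q)

  joins-injective : ∀ {e e′ u v} → Joins e u v → Joins e′ u v → e ≡ e′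
  joins-injective (inj₁ (p , q)) (inj₁ (p′ , q′)) = ends-injective (≡.trans p (≡.sym p′)) (≡.trans q (≡.sym q′))
  joins-injective (inj₂ (p , q)) (inj₂ (p′ , q′)) = ends-injective (≡.trans p (≡.sym p′)) (≡.trans q (≡.sym q′))
  -- Opposite orientations would make each end smaller than the other.
  joins-injective {e} {e′} (inj₁ (≡.refl , ≡.refl)) (inj₂ (p′ , q′)) = contradiction (proj₁ (end₁<end₂ e))
    (Fin.<-asym (≡.subst (λ v → v < end₁ G e) p′ (≡.subst (end₁ G e′ <_) q′ (proj₁ (end₁<end₂ e′)))))
  joins-injective {e} {e′} (inj₂ (≡.refl , ≡.refl)) (inj₁ (p′ , q′)) = contradiction (proj₁ (end₁<end₂ e))
    (Fin.<-asym (≡.subst (λ v → v < end₁ G e) p′ (≡.subst (end₁ G e′ <_) q′ (proj₁ (end₁<end₂ e′)))))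

  joins-functional : ∀ {e u v v′} → Joins e u v → Joins e u v′ → v ≡ v′
  joins-functional (inj₁ (_ , q)) (inj₁ (_ , q′)) = ≡.trans (≡.sym q) q′
  joins-functional (inj₂ (p , _)) (inj₂ (p′ , _)) = ≡.trans (≡.sym p) p′
  joins-functional {e} (inj₁ (p , _)) (inj₂ (_ , q)) = contradiction (≡.trans p (≡.sym q)) (ends-distinct G e)
  joins-functional {e} (inj₂ (_ , q)) (inj₁ (p , _)) = contradiction (≡.trans p (≡.sym q)) (ends-distinct G e)

  joins-either : ∀ {e u v u′ v′} → Joins e u v → Joins e u′ v′ → u′ ≡ u ⊎ u′ ≡ v
  joins-either (inj₁ (p , _)) (inj₁ (p′ , _)) = inj₁ (≡.trans (≡.sym p′) p)
  joins-either (inj₁ (_ , q)) (inj₂ (_ , q′)) = inj₂ (≡.trans (≡.sym q′) q)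
  joins-either (inj₂ (p , _)) (inj₁ (p′ , _)) = inj₂ (≡.trans (≡.sym p′) p)
  joins-either (inj₂ (_ , q)) (inj₂ (_ , q′)) = inj₁ (≡.trans (≡.sym q′) q)

  module _ (k : ℕ) where

    hyperedgeSet : Fin (∣E∣ G) → Subset (powerOrder G k)
    hyperedgeSet e = setOf (hyperedge G k e)

    end₁∈ : ∀ e → oldVertex G k (end₁ G e) ∈ hyperedgeSet e
    end₁∈ e = ∈-setOf⁺ {xs = hyperedge G k e} (here ≡.refl)

    end₂∈ : ∀ e → oldVertex G k (end₂ G e) ∈ hyperedgeSet e
    end₂∈ e = ∈-setOf⁺ {xs = hyperedge G k e} (there (here ≡.refl))

    new∈ : ∀ e j → newVertex G k e j ∈ hyperedgeSet e
    new∈ e j = ∈-setOf⁺ {xs = hyperedge G k e} (there (there (∈-tabulate⁺ j)))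

    joins⇒∈ : ∀ {e u v} → Joins e u v → oldVertex G k u ∈ hyperedgeSet e
    joins⇒∈ {e} (inj₁ (≡.refl , _)) = end₁∈ e
    joins⇒∈ {e} (inj₂ (_ , ≡.refl)) = end₂∈ e

    newVertex-injective : ∀ {e e′ j j′} → newVertex G k e j ≡ newVertex G k e′ j′ → e ≡ e′ × j ≡ j′
    newVertex-injective {e} {e′} {j} {j′} eq = Fin.combine-injective e j e′ j′ (Fin.↑ʳ-injective n _ _ eq)

    old∈⁻ : ∀ {e v} → oldVertex G k v ∈ hyperedgeSet e → ∃[ u ] Joins e v u
    old∈⁻ {e} {v} v∈ with ∈-setOf⁻ (hyperedge G k e) v∈
    ... | here eq         = end₂ G e , inj₁ (≡.sym (Fin.↑ˡ-injective _ _ _ eq) , ≡.refl)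
    ... | there (here eq) = end₁ G e , inj₂ (≡.refl , ≡.sym (Fin.↑ˡ-injective _ _ _ eq))
    ... | there (there v∈new) = let j , eq = ∈-tabulate⁻ v∈new in contradiction eq (old≢new G k v e j)

    new∈⁻ : ∀ {e e′ j} → newVertex G k e j ∈ hyperedgeSet e′ → e ≡ e′
    new∈⁻ {e} {e′} {j} w∈ with ∈-setOf⁻ (hyperedge G k e′) w∈
    ... | here eq         = contradiction (≡.sym eq) (old≢new G k _ e j)
    ... | there (here eq) = contradiction (≡.sym eq) (old≢new G k _ e j)
    ... | there (there w∈new) = proj₁ (newVertex-injective (proj₂ (∈-tabulate⁻ w∈new)))

    -- A single added vertex identifies its edge; `j` provides one, which amounts to `k > 2`.
    hyperedgeSet-injective : Fin (k ∸ 2) → ∀ {e e′} → hyperedgeSet e ≡ hyperedgeSet e′ → e ≡ e′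
    hyperedgeSet-injective j {e} eq = new∈⁻ {j = j} (≡.subst (newVertex G k e j ∈_) eq (new∈ e j))

    data VertexView : Fin (powerOrder G k) → Set where
      isOld : ∀ v → VertexView (oldVertex G k v)
      isNew : ∀ e j → VertexView (newVertex G k e j)

    vertexView : ∀ i → VertexView i
    vertexView i = view (splitAt n i) (Fin.join-splitAt n (∣E∣ G ℕ.* (k ∸ 2)) i)
      where
      view : ∀ s → join n (∣E∣ G ℕ.* (k ∸ 2)) s ≡ i → VertexView i
      view (inj₁ v) ≡.refl = isOld v
      view (inj₂ w) ≡.refl = ≡.subst (λ w → VertexView (n ↑ʳ w)) (Fin.combine-remQuot {∣E∣ G} (k ∸ 2) w)
        (uncurry isNew (remQuot {∣E∣ G} (k ∸ 2) w))

    module _ {A : Set} (f : Fin n → A) (g : Fin (∣E∣ G) → Fin (k ∸ 2) → A) where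

      extend : Fin (powerOrder G k) → A
      extend i = cases (splitAt n i)
        where
        cases : Fin n ⊎ Fin (∣E∣ G ℕ.* (k ∸ 2)) → A
        cases (inj₁ v) = f v
        cases (inj₂ w) = uncurry g (remQuot {∣E∣ G} (k ∸ 2) w)

      extend-old : ∀ v → extend (oldVertex G k v) ≡ f v
      extend-old v rewrite Fin.splitAt-↑ˡ n v (∣E∣ G ℕ.* (k ∸ 2)) = ≡.refl

      extend-new : ∀ e j → extend (newVertex G k e j) ≡ g e j
      extend-new e j rewrite Fin.splitAt-↑ʳ n (∣E∣ G ℕ.* (k ∸ 2)) (combine e j) =
        ≡.cong (uncurry g) (Fin.remQuot-combine e j)

-- Algebra over a field

-- Inverses exist for whatever is not equal to zero, without apartness. The Cauchy reals satisfy
-- this by excluded middle.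
record Field : Set₁ where
  field
    commutativeRing : CommutativeRing 0ℓ 0ℓ

  open CommutativeRing commutativeRing public

  field
    inverse : ∀ x → ¬ x ≈ 0# → Σ[ y ∈ Carrier ] x * y ≈ 1#
    1≉0     : ¬ 1# ≈ 0#

module OverField (em : ExcludedMiddle 0ℓ) (F : Field) where
  open Field F hiding (_-_; zero)
  open Exp commutativeSemiring using (_^_; ^-congˡ; ^-distrib-*; ^-assocʳ; ^-homo-*)
  open Sum semiring public
    using (sum; sum-cong-≋; ∑-comm; *-distribˡ-sum; sum-replicate-zero; ∑-distrib-+)
  open RingProperties ring public using (-‿distribˡ-*; -‿distribʳ-*; -‿involutive; -1*x≈-x; x∙y⁻¹≈ε⇒x≈y; -0#≈0#)
  module S = Solver commutativeSemiring
  open S using (solve; _:+_; _:*_; _:=_)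
  open SetoidReasoning setoid
  open Mult semiring using (×-congʳ; ×-assocˡ; ×-comm-*; ×-assoc-*) renaming (_×_ to _·_)
  open Product *-commutativeMonoid using ()
    renaming (sum to product; sum-cong-≋ to product-cong; ∑-distrib-+ to product-*; sum-replicate to product-replicate)

  *-cancelˡ : ∀ {x y z} → ¬ x ≈ 0# → x * y ≈ x * z → y ≈ z
  *-cancelˡ {x} {y} {z} x≉0 eq with w , xw≈1 ← inverse x x≉0 = begin
    y             ≈⟨ *-identityˡ y ⟨
    1# * y        ≈⟨ *-congʳ xw≈1 ⟨
    (x * w) * y   ≈⟨ solve 3 (λ x w y → (x :* w) :* y := w :* (x :* y)) refl x w y ⟩
    w * (x * y)   ≈⟨ *-congˡ eq ⟩
    w * (x * z)   ≈⟨ solve 3 (λ x w y → (x :* w) :* y := w :* (x :* y)) refl x w z ⟨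
    (x * w) * z   ≈⟨ *-congʳ xw≈1 ⟩
    1# * z        ≈⟨ *-identityˡ z ⟩
    z             ∎

  xy≈0⇒y≈0 : ∀ {x y} → ¬ x ≈ 0# → x * y ≈ 0# → y ≈ 0#
  xy≈0⇒y≈0 {x} x≉0 xy≈0 = *-cancelˡ x≉0 (trans xy≈0 (sym (zeroʳ x)))

  xy≈0⇒x≈0∨y≈0 : ∀ {x y} → x * y ≈ 0# → x ≈ 0# ⊎ y ≈ 0#
  xy≈0⇒x≈0∨y≈0 {x} xy≈0 with em {x ≈ 0#}
  ... | yes x≈0 = inj₁ x≈0
  ... | no x≉0  = inj₂ (xy≈0⇒y≈0 x≉0 xy≈0)

  x≈0⇒xy≈0 : ∀ {x} y → x ≈ 0# → x * y ≈ 0#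
  x≈0⇒xy≈0 y x≈0 = trans (*-congʳ x≈0) (zeroˡ y)

  y≈0⇒xy≈0 : ∀ x {y} → y ≈ 0# → x * y ≈ 0#
  y≈0⇒xy≈0 x y≈0 = trans (*-congˡ y≈0) (zeroʳ x)

  *-≉0 : ∀ {x y} → ¬ x ≈ 0# → ¬ y ≈ 0# → ¬ x * y ≈ 0#
  *-≉0 x≉0 y≉0 xy≈0 = y≉0 (xy≈0⇒y≈0 x≉0 xy≈0)

  xx≈0⇒x≈0 : ∀ {x} → x * x ≈ 0# → x ≈ 0#
  xx≈0⇒x≈0 xx≈0 with xy≈0⇒x≈0∨y≈0 xx≈0
  ... | inj₁ x≈0 = x≈0
  ... | inj₂ x≈0 = x≈0

  x^1+n≈0 : ∀ {x} n → x ≈ 0# → x ^ suc n ≈ 0#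
  x^1+n≈0 {x} n x≈0 = x≈0⇒xy≈0 (x ^ n) x≈0

  x^n≈0⇒x≈0 : ∀ {x} n → x ^ suc n ≈ 0# → x ≈ 0#
  x^n≈0⇒x≈0 zero eq = trans (sym (*-identityʳ _)) eq
  x^n≈0⇒x≈0 (suc n) eq with xy≈0⇒x≈0∨y≈0 eq
  ... | inj₁ x≈0 = x≈0
  ... | inj₂ eq′ = x^n≈0⇒x≈0 n eq′

  x^2≈x*x : ∀ x → x ^ 2 ≈ x * x
  x^2≈x*x x = *-congˡ (*-identityʳ x)

  xx≈yy⇒x≈±y : ∀ {x y} → x * x ≈ y * y → x ≈ y ⊎ x ≈ - y
  xx≈yy⇒x≈±y {x} {y} eq with xy≈0⇒x≈0∨y≈0 {x + - y} {x + y} (begin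
    (x + - y) * (x + y)
      ≈⟨ solve 3 (λ x y z → (x :+ z) :* (x :+ y) := (x :* x :+ z :* y) :+ x :* (y :+ z)) refl x y (- y) ⟩
    (x * x + - y * y) + x * (y + - y)
      ≈⟨ +-cong (+-cong eq (sym (-‿distribˡ-* y y))) (y≈0⇒xy≈0 x (-‿inverseʳ y)) ⟩
    (y * y + - (y * y)) + 0#
      ≈⟨ trans (+-identityʳ _) (-‿inverseʳ (y * y)) ⟩
    0# ∎)
  ... | inj₁ x+-y≈0 = inj₁ (x∙y⁻¹≈ε⇒x≈y x y x+-y≈0)
  ... | inj₂ x+y≈0 = inj₂ (x∙y⁻¹≈ε⇒x≈y x (- y) (trans (+-congˡ (-‿involutive y)) x+y≈0))

  sum≈0 : ∀ {n} {f : Fin n → Carrier} → (∀ i → f i ≈ 0#) → sum f ≈ 0#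
  sum≈0 {n} f≈0 = trans (sum-cong-≋ f≈0) (sum-replicate-zero n)

  -- (z + ∣z∣)² = z (2 ∣z∣ + z + z̄), with w = ∣z∣ and d² the second factor.
  squareRoot-formula : ∀ {z z̄ w d d⁻¹} → w * w ≈ z * z̄ → d * d ≈ (w + w) + (z + z̄) → d * d⁻¹ ≈ 1# →
    ((z + w) * d⁻¹) * ((z + w) * d⁻¹) ≈ z
  squareRoot-formula {z} {z̄} {w} {d} {e} ww dd de = begin
    ((z + w) * e) * ((z + w) * e)
      ≈⟨ solve 3 (λ z w e → ((z :+ w) :* e) :* ((z :+ w) :* e)
           := (z :* z :+ (z :* (w :+ w) :+ w :* w)) :* (e :* e)) refl z w e ⟩
    (z * z + (z * (w + w) + w * w)) * (e * e)
      ≈⟨ *-congʳ (+-congˡ (+-congˡ ww)) ⟩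
    (z * z + (z * (w + w) + z * z̄)) * (e * e)
      ≈⟨ solve 4 (λ z z̄ w e → (z :* z :+ (z :* (w :+ w) :+ z :* z̄)) :* (e :* e)
           := (z :* (e :* e)) :* ((w :+ w) :+ (z :+ z̄))) refl z z̄ w e ⟩
    (z * (e * e)) * ((w + w) + (z + z̄))
      ≈⟨ *-congˡ dd ⟨
    (z * (e * e)) * (d * d)
      ≈⟨ solve 3 (λ z e d → (z :* (e :* e)) :* (d :* d) := z :* ((d :* e) :* (d :* e))) refl z e d ⟩
    z * ((d * e) * (d * e))
      ≈⟨ *-congˡ (trans (*-cong de de) (*-identityˡ 1#)) ⟩
    z * 1#
      ≈⟨ *-identityʳ z ⟩
    z ∎

  squareRoot-neg : ∀ {𝕚 z w} → 𝕚 * 𝕚 ≈ - 1# → w * w ≈ - z → (𝕚 * w) * (𝕚 * w) ≈ z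
  squareRoot-neg {𝕚} {z} {w} 𝕚𝕚 ww = begin
    (𝕚 * w) * (𝕚 * w)   ≈⟨ solve 2 (λ a b → (a :* b) :* (a :* b) := (a :* a) :* (b :* b)) refl 𝕚 w ⟩
    (𝕚 * 𝕚) * (w * w)   ≈⟨ *-cong 𝕚𝕚 ww ⟩
    - 1# * - z          ≈⟨ -1*x≈-x (- z) ⟩
    - - z               ≈⟨ -‿involutive z ⟩
    z                   ∎

  square-root-of-0 : ∀ {z} → z ≈ 0# → 0# * 0# ≈ z
  square-root-of-0 z≈0 = trans (zeroˡ 0#) (sym z≈0)

  -- The eigenvalue of a real symmetric matrix is real because
  -- ⟨y , A y⟩ is both β⟨y , y⟩ and its own conjugate.
  module Hermitian
    (conj : Carrier → Carrier)
    (conj-cong : ∀ {x y} → x ≈ y → conj x ≈ conj y)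
    (conj-+ : ∀ x y → conj (x + y) ≈ conj x + conj y)
    (conj-* : ∀ x y → conj (x * y) ≈ conj x * conj y)
    (conj-0 : conj 0# ≈ 0#)
    (conj-involutive : ∀ x → conj (conj x) ≈ x)
    (definite : ∀ {n} (y : Fin n → Carrier) → sum (λ i → conj (y i) * y i) ≈ 0# → ∀ i → y i ≈ 0#)
    (𝕚 : Carrier) (𝕚≉0 : ¬ 𝕚 ≈ 0#) (conj-𝕚 : conj 𝕚 ≈ - 𝕚)
    (x+x≈0⇒x≈0 : ∀ {x} → x + x ≈ 0# → x ≈ 0#)
    {m} (A : Fin m → Fin m → Carrier)
    (A-sym : ∀ i j → A i j ≈ A j i) (A-real : ∀ i j → conj (A i j) ≈ A i j)
    (β : Carrier)
    where

    IsEigenvector : (Fin m → Carrier) → Set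
    IsEigenvector y = ∀ i → sum (λ j → A i j * y j) ≈ β * y i

    conj-sum : ∀ {n} (f : Fin n → Carrier) → conj (sum f) ≈ sum (conj ∘ f)
    conj-sum {zero}  f = conj-0
    conj-sum {suc n} f = trans (conj-+ _ _) (+-congˡ (conj-sum (f ∘ suc)))

    norm : (Fin m → Carrier) → Carrier
    norm y = sum (λ i → conj (y i) * y i)

    form : (Fin m → Carrier) → Carrier
    form y = sum (λ i → sum (λ j → conj (y i) * (A i j * y j)))

    form≈β*norm : ∀ {y} → IsEigenvector y → form y ≈ β * norm y
    form≈β*norm {y} eig = begin
      form y
        ≈⟨ sum-cong-≋ (λ i → *-distribˡ-sum (conj (y i)) (λ j → A i j * y j)) ⟨
      sum (λ i → conj (y i) * sum (λ j → A i j * y j))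
        ≈⟨ sum-cong-≋ (λ i → trans (*-congˡ (eig i))
             (solve 3 (λ a b c → a :* (b :* c) := b :* (a :* c)) refl (conj (y i)) β (y i))) ⟩
      sum (λ i → β * (conj (y i) * y i))
        ≈⟨ *-distribˡ-sum {m} β _ ⟨
      β * norm y ∎

    conj-form : ∀ y → conj (form y) ≈ form y
    conj-form y = begin
      conj (form y)
        ≈⟨ trans (conj-sum {m} _) (sum-cong-≋ (λ i → trans (conj-sum {m} _) (sum-cong-≋ (λ j → conj-term i j)))) ⟩
      sum (λ i → sum (λ j → conj (y j) * (A j i * y i)))
        ≈⟨ ∑-comm (λ i j → conj (y j) * (A j i * y i)) ⟩
      form y ∎
      where
      conj-term : ∀ i j → conj (conj (y i) * (A i j * y j)) ≈ conj (y j) * (A j i * y i)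
      conj-term i j = begin
        conj (conj (y i) * (A i j * y j))
          ≈⟨ trans (conj-* _ _) (*-cong (conj-involutive (y i)) (conj-* _ _)) ⟩
        y i * (conj (A i j) * conj (y j))
          ≈⟨ *-congˡ (*-congʳ (trans (A-real i j) (A-sym i j))) ⟩
        y i * (A j i * conj (y j))
          ≈⟨ solve 3 (λ a b c → a :* (b :* c) := c :* (b :* a)) refl (y i) (A j i) (conj (y j)) ⟩
        conj (y j) * (A j i * y i) ∎

    conj-norm : ∀ y → conj (norm y) ≈ norm y
    conj-norm y = trans (conj-sum {m} _) (sum-cong-≋ (λ i →
      trans (conj-* _ _) (trans (*-congʳ (conj-involutive (y i))) (*-comm _ _))))

    β-real : ∀ {y} → ¬ (∀ i → y i ≈ 0#) → IsEigenvector y → conj β ≈ β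
    β-real {y} y≉0 eig = *-cancelˡ (y≉0 ∘ definite y) (begin
      norm y * conj β         ≈⟨ *-comm _ _ ⟩
      conj β * norm y         ≈⟨ *-congˡ (conj-norm y) ⟨
      conj β * conj (norm y)  ≈⟨ conj-* _ _ ⟨
      conj (β * norm y)       ≈⟨ conj-cong (form≈β*norm eig) ⟨
      conj (form y)           ≈⟨ conj-form y ⟩
      form y                  ≈⟨ form≈β*norm eig ⟩
      β * norm y              ≈⟨ *-comm _ _ ⟩
      norm y * β              ∎)

    -- Twice the real part; the factor spares a division by two.
    realPart : (Fin m → Carrier) → Fin m → Carrier
    realPart y i = y i + conj (y i)

    realPart-real : ∀ y i → conj (realPart y i) ≈ realPart y i
    realPart-real y i = trans (conj-+ _ _) (trans (+-congˡ (conj-involutive (y i))) (+-comm _ _))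

    realPart-eigenvector : conj β ≈ β → ∀ {y} → IsEigenvector y → IsEigenvector (realPart y)
    realPart-eigenvector β-real {y} eig i = begin
      sum (λ j → A i j * (y j + conj (y j)))
        ≈⟨ sum-cong-≋ (λ j → trans (distribˡ _ _ _)
             (+-congˡ (trans (*-congʳ (sym (A-real i j))) (sym (conj-* _ _))))) ⟩
      sum (λ j → A i j * y j + conj (A i j * y j))
        ≈⟨ ∑-distrib-+ (λ j → A i j * y j) _ ⟩
      sum (λ j → A i j * y j) + sum (λ j → conj (A i j * y j))
        ≈⟨ +-cong (eig i) (trans (sym (conj-sum {m} _)) (trans (conj-cong (eig i))
             (trans (conj-* _ _) (*-congʳ β-real)))) ⟩
      β * y i + β * conj (y i)
        ≈⟨ distribˡ _ _ _ ⟨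
      β * realPart y i ∎

    𝕚-eigenvector : ∀ {y} → IsEigenvector y → IsEigenvector (λ i → 𝕚 * y i)
    𝕚-eigenvector {y} eig i = begin
      sum (λ j → A i j * (𝕚 * y j))
        ≈⟨ sum-cong-≋ (λ j → solve 3 (λ a b c → a :* (b :* c) := b :* (a :* c)) refl (A i j) 𝕚 (y j)) ⟩
      sum (λ j → 𝕚 * (A i j * y j))
        ≈⟨ *-distribˡ-sum {m} 𝕚 _ ⟨
      𝕚 * sum (λ j → A i j * y j)
        ≈⟨ *-congˡ (eig i) ⟩
      𝕚 * (β * y i)
        ≈⟨ solve 3 (λ a b c → a :* (b :* c) := b :* (a :* c)) refl 𝕚 β (y i) ⟩
      β * (𝕚 * y i) ∎

    -- Applied to `𝕚 * y`, `realPart` gives `𝕚 (y - conj y)`, twice the imaginary part up to sign.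
    -- Its vanishing together with `conj y ≈ - y` leaves `𝕚 (y + y) ≈ 0#`.
    realParts≈0 : ∀ y i → realPart y i ≈ 0# → realPart (λ j → 𝕚 * y j) i ≈ 0# → y i ≈ 0#
    realParts≈0 y i p q = x+x≈0⇒x≈0 (xy≈0⇒y≈0 𝕚≉0 (begin
      𝕚 * (y i + y i)
        ≈⟨ solve 2 (λ a b → a :* (b :+ b) := a :* b :+ a :* b) refl 𝕚 (y i) ⟩
      𝕚 * y i + 𝕚 * y i
        ≈⟨ +-congˡ (*-congˡ (x∙y⁻¹≈ε⇒x≈y (y i) (- conj (y i)) (trans (+-congˡ (-‿involutive _)) p))) ⟩
      𝕚 * y i + 𝕚 * - conj (y i)
        ≈⟨ +-congˡ (trans (sym (-‿distribʳ-* _ _)) (-‿distribˡ-* _ _)) ⟩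
      𝕚 * y i + - 𝕚 * conj (y i)
        ≈⟨ +-congˡ (trans (conj-* _ _) (*-congʳ conj-𝕚)) ⟨
      𝕚 * y i + conj (𝕚 * y i)
        ≈⟨ q ⟩
      0# ∎))

    -- Since `A` and `β` are real, taking real parts preserves the eigenvalue equation. The real
    -- parts of `y` and of `𝕚 * y` cannot both vanish, so one of them serves.
    realEigenvector : ∀ {y} → ¬ (∀ i → y i ≈ 0#) → IsEigenvector y →
      Σ[ z ∈ (Fin m → Carrier) ] ¬ (∀ i → z i ≈ 0#) × IsEigenvector z × (∀ i → conj (z i) ≈ z i)
    realEigenvector {y} y≉0 eig with em {∀ i → realPart y i ≈ 0#}
    ... | no re≉0 = realPart y , re≉0 , realPart-eigenvector (β-real y≉0 eig) eig , realPart-real y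
    ... | yes re≈0 = realPart 𝕚y , (λ im≈0 → y≉0 (λ i → realParts≈0 y i (re≈0 i) (im≈0 i))) ,
        realPart-eigenvector (β-real y≉0 eig) (𝕚-eigenvector eig) , realPart-real 𝕚y
      where 𝕚y = λ i → 𝕚 * y i

  -- The same conditional as in the adjacency matrix and tensor, so that their entries are instances
  -- of it by computation.
  when : {P : Set} → Dec P → Carrier → Carrier
  when P? x = if does P? then x else 0#

  when-yes : {P : Set} (P? : Dec P) {x : Carrier} → P → when P? x ≈ x
  when-yes (yes _) _ = refl
  when-yes (no ¬p) p = contradiction p ¬p

  when-no : {P : Set} (P? : Dec P) {x : Carrier} → ¬ P → when P? x ≈ 0#
  when-no (yes p) ¬p = contradiction p ¬p
  when-no (no _)  _  = refl

  when-cong : {P : Set} (P? : Dec P) {x y : Carrier} → (P → x ≈ y) → when P? x ≈ when P? y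
  when-cong (yes p) eq = eq p
  when-cong (no _)  eq = refl

  *-when : {P : Set} (P? : Dec P) (x y : Carrier) → x * when P? y ≈ when P? (x * y)
  *-when (yes _) x y = refl
  *-when (no _)  x y = zeroʳ x

  when-0 : {P : Set} (P? : Dec P) → when P? 0# ≈ 0#
  when-0 (yes _) = refl
  when-0 (no _)  = refl

  -- Finite sums, and products over subsets

  sum-single : ∀ {n} (f : Fin n → Carrier) i → (∀ j → j ≢ i → f j ≈ 0#) → sum f ≈ f i
  sum-single f zero    h = trans (+-congˡ (sum≈0 (λ j → h (suc j) λ ()))) (+-identityʳ _)
  sum-single f (suc i) h = trans (+-cong (h zero λ ()) (sum-single (f ∘ suc) i (λ j j≢i → h (suc j) (j≢i ∘ Fin.suc-injective))))
    (+-identityˡ _)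

  sum-when∈ : ∀ {n} (p : Subset n) c → sum (λ i → when (i ∈? p) c) ≈ ∣ p ∣ · c
  sum-when∈ [] c = refl
  sum-when∈ (true  ∷ p) c = +-congˡ (sum-when∈ p c)
  sum-when∈ (false ∷ p) c = trans (+-identityˡ _) (sum-when∈ p c)

  -- Double counting over the pairs (i , j) related by ~.
  sum-matching : ∀ {m n} (f : Fin m → Carrier) (g : Fin n → Carrier) (_~_ : Fin m → Fin n → Set) →
    (∀ i → ¬ f i ≈ 0# → ∃[ j ] i ~ j) →
    (∀ j → ¬ g j ≈ 0# → ∃[ i ] i ~ j) →
    (∀ {i j j′} → i ~ j → i ~ j′ → j ≡ j′) →
    (∀ {i i′ j} → i ~ j → i′ ~ j → i ≡ i′) →
    (∀ {i j} → i ~ j → f i ≈ g j) →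
    sum f ≈ sum g
  sum-matching f g _~_ f-total g-total unique-j unique-i f≈g = begin
    sum f                                          ≈⟨ sum-cong-≋ (λ i → row i em) ⟩
    sum (λ i → sum (λ j → when (em {i ~ j}) (f i))) ≈⟨ ∑-comm (λ i j → when (em {i ~ j}) (f i)) ⟩
    sum (λ j → sum (λ i → when (em {i ~ j}) (f i))) ≈⟨ sum-cong-≋ (λ j → column j em) ⟨
    sum g                                          ∎
    where
    row : ∀ i → Dec (f i ≈ 0#) → f i ≈ sum (λ j → when (em {i ~ j}) (f i))
    row i (yes f≈0) = trans f≈0 (sym (sum≈0 (λ j → trans (when-cong (em {i ~ j}) {y = 0#} (λ _ → f≈0)) (when-0 em))))
    row i (no f≉0) = let j , r = f-total i f≉0 in
      sym (trans (sum-single _ j (λ j′ j′≢j → when-no em (λ r′ → j′≢j (unique-j r′ r)))) (when-yes em r))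
    column : ∀ j → Dec (g j ≈ 0#) → g j ≈ sum (λ i → when (em {i ~ j}) (f i))
    column j (yes g≈0) = trans g≈0 (sym (sum≈0 (λ i → all-0 i em)))
      where
      all-0 : ∀ i (d : Dec (i ~ j)) → when d (f i) ≈ 0#
      all-0 i (yes r) = trans (f≈g r) g≈0
      all-0 i (no _)  = refl
    column j (no g≉0) = let i , r = g-total j g≉0 in
      sym (trans (sum-single _ i (λ i′ i′≢i → when-no em (λ r′ → i′≢i (unique-i r′ r)))) (trans (when-yes em r) (f≈g r)))

  prodOver : ∀ {n} → Subset n → (Fin n → Carrier) → Carrier
  prodOver []          x = 1#
  prodOver (true  ∷ p) x = x zero * prodOver p (x ∘ suc)
  prodOver (false ∷ p) x = prodOver p (x ∘ suc)

  prodOver-⊥ : ∀ n (x : Fin n → Carrier) → prodOver ⊥ x ≈ 1#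
  prodOver-⊥ zero    x = refl
  prodOver-⊥ (suc n) x = prodOver-⊥ n (x ∘ suc)

  prodOver-remove : ∀ {n} {p : Subset n} {i} x → i ∈ p → x i * prodOver (p - i) x ≈ prodOver p x
  prodOver-remove {p = _ ∷ p}     x here =
    *-congˡ (reflexive (≡.cong (λ q → prodOver q (x ∘ suc)) (p─⊥≡p p)))
  prodOver-remove {p = true ∷ p}  x (there i∈p) = trans
    (solve 3 (λ a b c → a :* (b :* c) := b :* (a :* c)) refl _ _ _)
    (*-congˡ (prodOver-remove (x ∘ suc) i∈p))
  prodOver-remove {p = false ∷ p} x (there i∈p) = prodOver-remove (x ∘ suc) i∈p

  prodOver-insert : ∀ {n} {p : Subset n} {i} x → i ∉ p → prodOver (⁅ i ⁆ ∪ p) x ≈ x i * prodOver p x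
  prodOver-insert {p = p} {i} x i∉p = trans (sym (prodOver-remove x (x∈p∪q⁺ (inj₁ (x∈⁅x⁆ i)))))
    (*-congˡ (reflexive (≡.cong (λ q → prodOver q x) (⁅x⁆∪p-x i∉p))))

  prodOver≈0 : ∀ {n} {p : Subset n} {i} {x} → i ∈ p → x i ≈ 0# → prodOver p x ≈ 0#
  prodOver≈0 {x = x} i∈p x≈0 = trans (sym (prodOver-remove x i∈p)) (x≈0⇒xy≈0 _ x≈0)

  prodOver≈0⁻ : ∀ {n} (p : Subset n) {x} → prodOver p x ≈ 0# → ∃[ i ] (i ∈ p × x i ≈ 0#)
  prodOver≈0⁻ [] 1≈0 = contradiction 1≈0 1≉0
  prodOver≈0⁻ (true ∷ p) eq with xy≈0⇒x≈0∨y≈0 eq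
  ... | inj₁ x≈0 = zero , here , x≈0
  ... | inj₂ eq′ = let i , i∈p , x≈0 = prodOver≈0⁻ p eq′ in suc i , there i∈p , x≈0
  prodOver≈0⁻ (false ∷ p) eq = let i , i∈p , x≈0 = prodOver≈0⁻ p eq in suc i , there i∈p , x≈0

  -- Sums over index tuples and the adjacency tensor

  module MultiSums
    (multiSum : ∀ {n} m → (Vec (Fin n) m → Carrier) → Carrier)
    (multiSum-zero : ∀ {n} (f : Vec (Fin n) 0 → Carrier) → multiSum 0 f ≈ f [])
    (multiSum-suc : ∀ {n} m (f : Vec (Fin n) (suc m) → Carrier) →
      multiSum (suc m) f ≈ sum (λ i → multiSum m (λ is → f (i ∷ is))))
    (monomial : ∀ {m n} → (Fin n → Carrier) → Vec (Fin n) m → Carrier)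
    (monomial-[] : ∀ {n} (x : Fin n → Carrier) → monomial x [] ≈ 1#)
    (monomial-∷ : ∀ {m n} (x : Fin n → Carrier) i (is : Vec (Fin n) m) → monomial x (i ∷ is) ≈ x i * monomial x is)
    where

    multiSum-cong : ∀ {n} m {f g : Vec (Fin n) m → Carrier} → (∀ is → f is ≈ g is) → multiSum m f ≈ multiSum m g
    multiSum-cong zero    {f} {g} f≈g = trans (multiSum-zero f) (trans (f≈g []) (sym (multiSum-zero g)))
    multiSum-cong (suc m) {f} {g} f≈g = trans (multiSum-suc m f)
      (trans (sum-cong-≋ (λ i → multiSum-cong m (λ is → f≈g (i ∷ is)))) (sym (multiSum-suc m g)))

    multiSum≈0 : ∀ {n} m {f : Vec (Fin n) m → Carrier} → (∀ is → f is ≈ 0#) → multiSum m f ≈ 0#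
    multiSum≈0 zero    {f} f≈0 = trans (multiSum-zero f) (f≈0 [])
    multiSum≈0 (suc m) {f} f≈0 = trans (multiSum-suc m f) (sum≈0 (λ i → multiSum≈0 m (λ is → f≈0 (i ∷ is))))

    *-distribˡ-multiSum : ∀ {n} m c (f : Vec (Fin n) m → Carrier) → c * multiSum m f ≈ multiSum m (λ is → c * f is)
    *-distribˡ-multiSum     zero    c f = trans (*-congˡ (multiSum-zero f)) (sym (multiSum-zero (λ is → c * f is)))
    *-distribˡ-multiSum {n} (suc m) c f = begin
      c * multiSum (suc m) f
        ≈⟨ *-congˡ (multiSum-suc m f) ⟩
      c * sum (λ i → multiSum m (λ is → f (i ∷ is)))
        ≈⟨ *-distribˡ-sum {n} c _ ⟩
      sum (λ i → c * multiSum m (λ is → f (i ∷ is)))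
        ≈⟨ sum-cong-≋ (λ i → *-distribˡ-multiSum m c (λ is → f (i ∷ is))) ⟩
      sum (λ i → multiSum m (λ is → c * f (i ∷ is)))
        ≈⟨ multiSum-suc m (λ is → c * f is) ⟨
      multiSum (suc m) (λ is → c * f is) ∎

    multiSum-sum : ∀ {n k} m (f : Vec (Fin n) m → Fin k → Carrier) →
      multiSum m (λ is → sum (f is)) ≈ sum (λ e → multiSum m (λ is → f is e))
    multiSum-sum zero f = trans (multiSum-zero (λ is → sum (f is)))
      (sum-cong-≋ (λ e → sym (multiSum-zero (λ is → f is e))))
    multiSum-sum {n} (suc m) f = begin
      multiSum (suc m) (λ is → sum (f is))
        ≈⟨ multiSum-suc m (λ is → sum (f is)) ⟩
      sum (λ i → multiSum m (λ is → sum (f (i ∷ is))))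
        ≈⟨ sum-cong-≋ (λ i → multiSum-sum m (λ is → f (i ∷ is))) ⟩
      sum (λ i → sum (λ e → multiSum m (λ is → f (i ∷ is) e)))
        ≈⟨ ∑-comm (λ i e → multiSum m (λ is → f (i ∷ is) e)) ⟩
      sum (λ e → sum (λ i → multiSum m (λ is → f (i ∷ is) e)))
        ≈⟨ sum-cong-≋ (λ e → multiSum-suc m (λ is → f is e)) ⟨
      sum (λ e → multiSum (suc m) (λ is → f is e)) ∎

    -- A tuple of length `∣ p ∣` whose set is `p` lists `p` without repetition, and `p` has `m !`
    -- orderings. In the induction there are `∣ p ∣` choices for the first entry `i`, and the
    -- remaining entries list `p - i`.
    multiSum-enumerations : ∀ {n} m (p : Subset n) → ∣ p ∣ ≡ m → ∀ x →
      multiSum m (λ is → when (setOf (Vec.toList is) ≟ˢ p) (monomial x is)) ≈ (m !) · prodOver p x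
    multiSum-enumerations {n} zero p ∣p∣≡0 x = begin
      multiSum 0 (λ is → when (setOf (Vec.toList is) ≟ˢ p) (monomial x is))
                            ≈⟨ multiSum-zero (λ is → when (setOf (Vec.toList is) ≟ˢ p) (monomial x is)) ⟩
      when (⊥ ≟ˢ p) (monomial x [])
                            ≈⟨ when-yes (⊥ ≟ˢ p) (≡.sym (∣p∣≡0⇒p≡⊥ p ∣p∣≡0)) ⟩
      monomial x []         ≈⟨ monomial-[] x ⟩
      1#                    ≈⟨ prodOver-⊥ n x ⟨
      prodOver ⊥ x          ≡⟨ ≡.cong (λ q → prodOver q x) (∣p∣≡0⇒p≡⊥ p ∣p∣≡0) ⟨
      prodOver p x          ≈⟨ +-identityʳ _ ⟨
      1 · prodOver p x      ∎
    multiSum-enumerations {n} (suc m) p ∣p∣≡1+m x = begin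
      multiSum (suc m) (λ is → when (setOf (Vec.toList is) ≟ˢ p) (monomial x is))
        ≈⟨ multiSum-suc m (λ is → when (setOf (Vec.toList is) ≟ˢ p) (monomial x is)) ⟩
      sum (λ i → multiSum m (λ is → when (setOf (i ∷ Vec.toList is) ≟ˢ p) (monomial x (i ∷ is))))
        ≈⟨ sum-cong-≋ (λ i → multiSum-cong m (λ is → when-cong (setOf (i ∷ Vec.toList is) ≟ˢ p) (λ _ → monomial-∷ x i is))) ⟩
      sum (λ i → multiSum m (λ is → when (setOf (i ∷ Vec.toList is) ≟ˢ p) (x i * monomial x is)))
        ≈⟨ sum-cong-≋ (λ i → first i (i ∈? p)) ⟩
      sum (λ i → when (i ∈? p) ((m !) · prodOver p x))
        ≈⟨ sum-when∈ p _ ⟩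
      ∣ p ∣ · ((m !) · prodOver p x)
        ≈⟨ ×-assocˡ _ ∣ p ∣ (m !) ⟩
      (∣ p ∣ ℕ.* m !) · prodOver p x
        ≡⟨ ≡.cong (λ a → (a ℕ.* m !) · prodOver p x) ∣p∣≡1+m ⟩
      (suc m !) · prodOver p x ∎
      where
      step : ∀ i → i ∈ p → ∀ is →
        when (setOf (i ∷ Vec.toList is) ≟ˢ p) (x i * monomial x is) ≈
        x i * when (setOf (Vec.toList is) ≟ˢ (p - i)) (monomial x is)
      step i i∈p is with setOf (Vec.toList is) ≟ˢ (p - i)
      ... | yes eq = when-yes (setOf (i ∷ Vec.toList is) ≟ˢ p) (setOf≡⇒∷ (Vec.toList is) i∈p eq)
      ... | no ¬eq = trans (when-no (setOf (i ∷ Vec.toList is) ≟ˢ p) (¬eq ∘ setOf-∷≡⇒ (Vec.toList is)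
              (ℕ.≤-reflexive (≡.trans (≡.cong suc (Vec.length-toList is)) (≡.sym ∣p∣≡1+m)))))
            (sym (zeroʳ (x i)))
      first : ∀ i (d : Dec (i ∈ p)) →
        multiSum m (λ is → when (setOf (i ∷ Vec.toList is) ≟ˢ p) (x i * monomial x is)) ≈
        when d ((m !) · prodOver p x)
      first i (no i∉p) = multiSum≈0 m (λ is → when-no (setOf (i ∷ Vec.toList is) ≟ˢ p)
        (λ eq → i∉p (≡.subst (i ∈_) eq (∈-setOf-head i (Vec.toList is)))))
      first i (yes i∈p) = begin
        multiSum m (λ is → when (setOf (i ∷ Vec.toList is) ≟ˢ p) (x i * monomial x is))
          ≈⟨ multiSum-cong m (step i i∈p) ⟩
        multiSum m (λ is → x i * when (setOf (Vec.toList is) ≟ˢ (p - i)) (monomial x is))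
          ≈⟨ *-distribˡ-multiSum m (x i) _ ⟨
        x i * multiSum m (λ is → when (setOf (Vec.toList is) ≟ˢ (p - i)) (monomial x is))
          ≈⟨ *-congˡ (multiSum-enumerations m (p - i) (ℕ.suc-injective (≡.trans (∣p-x∣ i∈p) ∣p∣≡1+m)) x) ⟩
        x i * ((m !) · prodOver (p - i) x)
          ≈⟨ ×-comm-* (m !) (x i) _ ⟩
        (m !) · (x i * prodOver (p - i) x)
          ≈⟨ ×-congʳ (m !) (prodOver-remove x i∈p) ⟩
        (m !) · prodOver p x ∎

    module _ {n k ∣E∣} (S : Fin ∣E∣ → Subset n) (S-injective : ∀ {e e′} → S e ≡ S e′ → e ≡ e′)
      (∣S∣≡1+k : ∀ e → ∣ S e ∣ ≡ suc k) (edge? : ∀ s → Dec (∃[ e ] s ≡ S e))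
      (c : Carrier) (k!c≈1 : (k !) · c ≈ 1#) where

      -- Here `k` is the order of the tensor minus one. The tuples that complete `i` to an edge list
      -- `S e - i` in its `k !` orderings, and the entry `c` cancels that factor.
      apply-formula : ∀ x i →
        multiSum k (λ is → when (edge? (setOf (i ∷ Vec.toList is))) c * monomial x is) ≈
        sum (λ e → when (i ∈? S e) (prodOver (S e - i) x))
      apply-formula x i = begin
        multiSum k (λ is → when (edge? (setOf (i ∷ Vec.toList is))) c * monomial x is)
          ≈⟨ multiSum-cong k (λ is → split is (edge? (setOf (i ∷ Vec.toList is)))) ⟩
        multiSum k (λ is → sum (λ e → when (setOf (i ∷ Vec.toList is) ≟ˢ S e) (c * monomial x is)))
          ≈⟨ multiSum-sum k (λ is e → when (setOf (i ∷ Vec.toList is) ≟ˢ S e) (c * monomial x is)) ⟩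
        sum (λ e → multiSum k (λ is → when (setOf (i ∷ Vec.toList is) ≟ˢ S e) (c * monomial x is)))
          ≈⟨ sum-cong-≋ (λ e → perEdge e (i ∈? S e)) ⟩
        sum (λ e → when (i ∈? S e) (prodOver (S e - i) x)) ∎
        where
        split : ∀ is (d : Dec (∃[ e ] setOf (i ∷ Vec.toList is) ≡ S e)) →
          when d c * monomial x is ≈
          sum (λ e → when (setOf (i ∷ Vec.toList is) ≟ˢ S e) (c * monomial x is))
        -- An edge is determined by its vertex set, so exactly one summand survives.
        split is (yes (e , eq)) = sym (trans
          (sum-single (λ e → when (setOf (i ∷ Vec.toList is) ≟ˢ S e) (c * monomial x is)) e
            (λ e′ e′≢e → when-no (setOf (i ∷ Vec.toList is) ≟ˢ S e′) (λ eq′ → e′≢e (S-injective (≡.trans (≡.sym eq′) eq)))))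
          (when-yes (setOf (i ∷ Vec.toList is) ≟ˢ S e) eq))
        split is (no ¬e) = trans (zeroˡ _) (sym (sum≈0 (λ e → when-no (setOf (i ∷ Vec.toList is) ≟ˢ S e) (λ eq → ¬e (e , eq)))))

        step : ∀ e → i ∈ S e → ∀ is →
          when (setOf (i ∷ Vec.toList is) ≟ˢ S e) (c * monomial x is) ≈
          c * when (setOf (Vec.toList is) ≟ˢ (S e - i)) (monomial x is)
        step e i∈S is with setOf (Vec.toList is) ≟ˢ (S e - i)
        ... | yes eq = when-yes (setOf (i ∷ Vec.toList is) ≟ˢ S e) (setOf≡⇒∷ (Vec.toList is) i∈S eq)
        ... | no ¬eq = trans (when-no (setOf (i ∷ Vec.toList is) ≟ˢ S e) (¬eq ∘ setOf-∷≡⇒ (Vec.toList is)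
                (ℕ.≤-reflexive (≡.trans (≡.cong suc (Vec.length-toList is)) (≡.sym (∣S∣≡1+k e))))))
              (sym (zeroʳ c))

        perEdge : ∀ e (d : Dec (i ∈ S e)) →
          multiSum k (λ is → when (setOf (i ∷ Vec.toList is) ≟ˢ S e) (c * monomial x is)) ≈
          when d (prodOver (S e - i) x)
        perEdge e (no i∉S) = multiSum≈0 k (λ is → when-no (setOf (i ∷ Vec.toList is) ≟ˢ S e)
          (λ eq → i∉S (≡.subst (i ∈_) eq (∈-setOf-head i (Vec.toList is)))))
        perEdge e (yes i∈S) = begin
          multiSum k (λ is → when (setOf (i ∷ Vec.toList is) ≟ˢ S e) (c * monomial x is))
            ≈⟨ multiSum-cong k (step e i∈S) ⟩
          multiSum k (λ is → c * when (setOf (Vec.toList is) ≟ˢ (S e - i)) (monomial x is))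
            ≈⟨ *-distribˡ-multiSum k c _ ⟨
          c * multiSum k (λ is → when (setOf (Vec.toList is) ≟ˢ (S e - i)) (monomial x is))
            ≈⟨ *-congˡ (multiSum-enumerations k (S e - i) (ℕ.suc-injective (≡.trans (∣p-x∣ i∈S) (∣S∣≡1+k e))) x) ⟩
          c * ((k !) · prodOver (S e - i) x)
            ≈⟨ ×-comm-* (k !) c _ ⟩
          (k !) · (c * prodOver (S e - i) x)
            ≈⟨ ×-assoc-* (k !) c _ ⟨
          ((k !) · c) * prodOver (S e - i) x
            ≈⟨ trans (*-congʳ k!c≈1) (*-identityˡ _) ⟩
          prodOver (S e - i) x ∎

  -- The tensor sums and the adjacency matrix are known by their defining equations only:
  -- over ℂ, unfolding them would expand every product into components.
  module Spectrum
    (squareRoot : ∀ z → Σ[ w ∈ Carrier ] w * w ≈ z)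
    (signValue : Sign → Carrier)
    (signValue-+ : signValue Sign.+ ≈ 1#) (signValue-- : signValue Sign.- ≈ - 1#)
    (multiSum : ∀ {n} m → (Vec (Fin n) m → Carrier) → Carrier)
    (multiSum-zero : ∀ {n} (f : Vec (Fin n) 0 → Carrier) → multiSum 0 f ≈ f [])
    (multiSum-suc : ∀ {n} m (f : Vec (Fin n) (suc m) → Carrier) →
      multiSum (suc m) f ≈ sum (λ i → multiSum m (λ is → f (i ∷ is))))
    (monomial : ∀ {m n} → (Fin n → Carrier) → Vec (Fin n) m → Carrier)
    (monomial-[] : ∀ {n} (x : Fin n → Carrier) → monomial x [] ≈ 1#)
    (monomial-∷ : ∀ {m n} (x : Fin n → Carrier) i (is : Vec (Fin n) m) → monomial x (i ∷ is) ≈ x i * monomial x is)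
    (matrixEntry : ∀ {m} → SignedGraph m → Fin m → Fin m → Carrier)
    (matrixEntry-if : ∀ {m} (Γ : SignedGraph m) i j →
      matrixEntry Γ i j ≈ (if does (SignedGraph.adj? Γ i j) then signValue (SignedGraph.sign Γ i j) else 0#))
    where

    open MultiSums multiSum multiSum-zero multiSum-suc monomial monomial-[] monomial-∷

    ≉-resp : ∀ {x y} → x ≈ y → ¬ x ≈ 0# → ¬ y ≈ 0#
    ≉-resp x≈y x≉0 y≈0 = x≉0 (trans x≈y y≈0)

    ^-≉0 : ∀ {x} n → ¬ x ≈ 0# → ¬ x ^ n ≈ 0#
    ^-≉0 zero    x≉0 = 1≉0
    ^-≉0 (suc n) x≉0 = x≉0 ∘ x^n≈0⇒x≈0 n

    prodOver-setOf : ∀ {n} {is : List (Fin n)} → Unique is → ∀ x →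
      prodOver (setOf is) x ≈ foldr (λ i → x i *_) 1# is
    prodOver-setOf {n} [] x = prodOver-⊥ n x
    prodOver-setOf {is = i ∷ is} (i∉is ∷ u) x = trans
      (prodOver-insert x (λ i∈ → All.lookup i∉is (∈-setOf⁻ is i∈) ≡.refl))
      (*-congˡ (prodOver-setOf u x))

    foldr-tabulate : ∀ {m n} (x : Fin n → Carrier) (f : Fin m → Fin n) →
      foldr (λ i → x i *_) 1# (tabulate f) ≈ product (x ∘ f)
    foldr-tabulate {zero}  x f = refl
    foldr-tabulate {suc m} x f = *-congˡ (foldr-tabulate x (f ∘ suc))

    1^ : ∀ k → 1# ^ k ≈ 1#
    1^ zero    = refl
    1^ (suc k) = trans (*-identityˡ _) (1^ k)

    product-^ : ∀ {m} (t : Fin m → Carrier) k → product t ^ k ≈ product (λ j → t j ^ k)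
    product-^ {zero}  t k = 1^ k
    product-^ {suc m} t k = trans (^-distrib-* (t zero) (product (t ∘ suc)) k) (*-congˡ (product-^ (t ∘ suc) k))

    product-constant : ∀ m {t : Fin m → Carrier} {c} → (∀ j → t j ≈ c) → product t ≈ c ^ m
    product-constant m {t} {c} eq = trans (product-cong {m} {t} {λ _ → c} eq) (product-replicate m)

    -- Roots of minus one and the values on a single edge

    -1≉0 : ¬ - 1# ≈ 0#
    -1≉0 -1≈0 = 1≉0 (trans (sym (-‿involutive 1#)) (trans (-‿cong -1≈0) -0#≈0#))

    even⊎odd : ∀ n → ∃[ q ] (n ≡ q ℕ.+ q ⊎ n ≡ suc (q ℕ.+ q))
    even⊎odd zero = 0 , inj₁ ≡.refl
    even⊎odd (suc n) with even⊎odd n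
    ... | q , inj₁ eq = q , inj₂ (≡.cong suc eq)
    ... | q , inj₂ eq = suc q , inj₁ (≡.trans (≡.cong suc eq) (≡.cong suc (≡.sym (ℕ.+-suc q q))))

    ^-double : ∀ x q → x ^ (q ℕ.+ q) ≈ (x * x) ^ q
    ^-double x q = trans (^-homo-* x q q) (sym (^-distrib-* x x q))

    -- For an even exponent, a square root of the root for half the exponent works; the recursion
    -- ends at an odd exponent.
    rootOfMinusOne : ∀ n → Σ[ η ∈ Carrier ] η ^ suc n ≈ - 1#
    rootOfMinusOne = <-rec _ step
      where
      step : ∀ n → (∀ {l} → l ℕ.< n → Σ[ η ∈ Carrier ] η ^ suc l ≈ - 1#) → Σ[ η ∈ Carrier ] η ^ suc n ≈ - 1#
      step n rec with even⊎odd (suc n)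
      ... | q , inj₂ eq = - 1# , (begin
        (- 1#) ^ suc n              ≡⟨ ≡.cong ((- 1#) ^_) eq ⟩
        - 1# * (- 1#) ^ (q ℕ.+ q)   ≈⟨ *-congˡ (^-double (- 1#) q) ⟩
        - 1# * (- 1# * - 1#) ^ q    ≈⟨ *-congˡ (^-congˡ q (trans (-1*x≈-x _) (-‿involutive 1#))) ⟩
        - 1# * 1# ^ q               ≈⟨ *-congˡ (1^ q) ⟩
        - 1# * 1#                   ≈⟨ *-identityʳ _ ⟩
        - 1#                        ∎)
      ... | suc q , inj₁ eq =
        let η , η^≈-1 = rec {q} (≡.subst (q ℕ.<_) (≡.sym (≡.trans (ℕ.suc-injective eq) (ℕ.+-suc q q))) (ℕ.s≤s (ℕ.m≤m+n q q)))
            w , ww≈η = squareRoot η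
        in w , (begin
          w ^ suc n               ≡⟨ ≡.cong (w ^_) eq ⟩
          w ^ (suc q ℕ.+ suc q)   ≈⟨ ^-double w (suc q) ⟩
          (w * w) ^ suc q         ≈⟨ ^-congˡ (suc q) ww≈η ⟩
          η ^ suc q               ≈⟨ η^≈-1 ⟩
          - 1#                    ∎)

    -- η³ · η^(k-3) = η^k = -1 although each factor has k-th power -1.
    rootsOfMinusOne : ∀ l → Σ[ ε ∈ (Fin (suc l) → Carrier) ] ((∀ j → ε j ^ (3 ℕ.+ l) ≈ - 1#) × product ε ≈ - 1#)
    rootsOfMinusOne l = ε , ε^k≈-1 , (begin
        η ^ 3 * product {l} (λ _ → η)  ≈⟨ *-congˡ (product-replicate l) ⟩
        η ^ 3 * η ^ l                  ≈⟨ ^-homo-* η 3 l ⟨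
        η ^ (3 ℕ.+ l)                  ≈⟨ η^k≈-1 ⟩
        - 1#                           ∎)
      where
      η = proj₁ (rootOfMinusOne (2 ℕ.+ l))
      η^k≈-1 = proj₂ (rootOfMinusOne (2 ℕ.+ l))
      ε : Fin (suc l) → Carrier
      ε zero    = η ^ 3
      ε (suc j) = η
      ε^k≈-1 : ∀ j → ε j ^ (3 ℕ.+ l) ≈ - 1#
      ε^k≈-1 (suc j) = η^k≈-1
      ε^k≈-1 zero = begin
        (η ^ 3) ^ (3 ℕ.+ l)         ≈⟨ ^-assocʳ η 3 (3 ℕ.+ l) ⟩
        η ^ (3 ℕ.* (3 ℕ.+ l))       ≡⟨ ≡.cong (η ^_) (ℕ.*-comm 3 (3 ℕ.+ l)) ⟩
        η ^ ((3 ℕ.+ l) ℕ.* 3)       ≈⟨ ^-assocʳ η (3 ℕ.+ l) 3 ⟨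
        (η ^ (3 ℕ.+ l)) ^ 3         ≈⟨ ^-congˡ 3 η^k≈-1 ⟩
        - 1# * (- 1# * (- 1# * 1#)) ≈⟨ trans (-1*x≈-x _) (-‿cong (trans (-1*x≈-x _) (trans (-‿cong (*-identityʳ _)) (-‿involutive 1#)))) ⟩
        - 1#                        ∎

    -- Values `t` on the `m` added vertices of an edge with end values `a` and `b`. The first two
    -- conditions are the multiplied equations at those vertices and the relation of the edge
    -- product with `c`, the wanted signed product of the ends. The last two locate the zeros,
    -- because the equation at a vertex with value zero cannot be recovered from its multiple.
    IsEdgeSolution : ∀ {m} (μ β a b c : Carrier) → (Fin m → Carrier) → Set
    IsEdgeSolution {m} μ β a b c t =
      (∀ j → a * (b * product t) ≈ μ * t j ^ (2 ℕ.+ m)) ×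
      β * (a * (b * product t)) ≈ μ * c ×
      (a * b ≈ 0# → ∀ j → t j ≈ 0#) ×
      (∀ j → t j ≈ 0# → a * b ≈ 0#)

    -- The intended `τ` are `1` and `- 1`. If the `ε j` have product `τ` and `k`-th powers `τ`,
    -- where `k` is `2 + m`, then the edge product and every `μ t_j^k` become `μ τ s^k`. So `τ` can
    -- correct the sign against `c` without disturbing the equations at the added vertices.
    scaledRoots-solve : ∀ {m μ β a b c s τ} {ε : Fin m → Carrier} → ¬ μ ≈ 0# → μ * (s * s) ≈ a * b →
      (∀ j → ε j ^ (2 ℕ.+ m) ≈ τ) → product ε ≈ τ → ¬ τ ≈ 0# → β * (τ * s ^ (2 ℕ.+ m)) ≈ c →
      IsEdgeSolution μ β a b c (λ j → ε j * s)
    scaledRoots-solve {m} {μ} {β} {a} {b} {c} {s} {τ} {ε} μ≉0 μss≈ab ε^k≈τ ∏ε≈τ τ≉0 βτs^k≈c =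
        (λ j → trans q≈μτs^k (*-congˡ (sym (trans (^-distrib-* (ε j) s k) (*-congʳ (ε^k≈τ j)))))) ,
        (begin
          β * q                  ≈⟨ *-congˡ q≈μτs^k ⟩
          β * (μ * (τ * s ^ k))  ≈⟨ solve 3 (λ a b c → a :* (b :* c) := b :* (a :* c)) refl β μ (τ * s ^ k) ⟩
          μ * (β * (τ * s ^ k))  ≈⟨ *-congˡ βτs^k≈c ⟩
          μ * c                  ∎) ,
        (λ ab≈0 j → y≈0⇒xy≈0 _ (xx≈0⇒x≈0 (xy≈0⇒y≈0 μ≉0 (trans μss≈ab ab≈0)))) ,
        (λ j t≈0 → trans (sym μss≈ab) (y≈0⇒xy≈0 μ (x≈0⇒xy≈0 s (xy≈0⇒y≈0 (ε≉0 j) t≈0))))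
      where
      k = 2 ℕ.+ m
      q = a * (b * product (λ j → ε j * s))
      ε≉0 : ∀ j → ¬ ε j ≈ 0#
      ε≉0 j ε≈0 = τ≉0 (trans (sym (ε^k≈τ j)) (x^1+n≈0 (suc m) ε≈0))
      q≈μτs^k : q ≈ μ * (τ * s ^ k)
      q≈μτs^k = begin
        a * (b * product (λ j → ε j * s))
          ≈⟨ *-assoc _ _ _ ⟨
        (a * b) * product (λ j → ε j * s)
          ≈⟨ *-cong (sym μss≈ab) (trans (product-* ε (λ _ → s)) (*-cong ∏ε≈τ (product-replicate m))) ⟩
        (μ * (s * s)) * (τ * s ^ m)
          ≈⟨ solve 4 (λ μ s τ p → (μ :* (s :* s)) :* (τ :* p) := μ :* (τ :* (s :* (s :* p)))) refl μ s τ (s ^ m) ⟩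
        μ * (τ * s ^ k) ∎

    -- Raising `μ s² ≈ a b` to the `k`-th power makes the squares of `β s^k` and `c` equal, so these
    -- agree up to sign, and `τ` is chosen to be that sign.
    edgeSolution : ∀ {l μ β a b c} → ¬ μ ≈ 0# → β * β ≈ μ ^ (3 ℕ.+ l) → a ^ (3 ℕ.+ l) * b ^ (3 ℕ.+ l) ≈ c * c →
      Σ[ t ∈ (Fin (suc l) → Carrier) ] IsEdgeSolution μ β a b c t
    edgeSolution {l} {μ} {β} {a} {b} {c} μ≉0 ββ≈μ^k a^kb^k≈cc = bySign (xx≈yy⇒x≈±y (begin
        (β * s ^ k) * (β * s ^ k)
          ≈⟨ solve 2 (λ b q → (b :* q) :* (b :* q) := (b :* b) :* (q :* q)) refl β (s ^ k) ⟩
        (β * β) * (s ^ k * s ^ k)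
          ≈⟨ *-cong ββ≈μ^k (sym (^-distrib-* s s k)) ⟩
        μ ^ k * (s * s) ^ k
          ≈⟨ ^-distrib-* μ (s * s) k ⟨
        (μ * (s * s)) ^ k
          ≈⟨ ^-congˡ k μss≈ab ⟩
        (a * b) ^ k
          ≈⟨ ^-distrib-* a b k ⟩
        a ^ k * b ^ k
          ≈⟨ a^kb^k≈cc ⟩
        c * c ∎))
      where
      k = 3 ℕ.+ l
      μ⁻¹ = proj₁ (inverse μ μ≉0)
      s = proj₁ (squareRoot (μ⁻¹ * (a * b)))
      μss≈ab : μ * (s * s) ≈ a * b
      μss≈ab = begin
        μ * (s * s)           ≈⟨ *-congˡ (proj₂ (squareRoot (μ⁻¹ * (a * b)))) ⟩
        μ * (μ⁻¹ * (a * b))   ≈⟨ *-assoc _ _ _ ⟨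
        (μ * μ⁻¹) * (a * b)   ≈⟨ *-congʳ (proj₂ (inverse μ μ≉0)) ⟩
        1# * (a * b)          ≈⟨ *-identityˡ _ ⟩
        a * b                 ∎
      bySign : β * s ^ k ≈ c ⊎ β * s ^ k ≈ - c → Σ[ t ∈ (Fin (suc l) → Carrier) ] IsEdgeSolution μ β a b c t
      bySign (inj₁ eq) = (λ j → 1# * s) , scaledRoots-solve {ε = λ _ → 1#} μ≉0 μss≈ab (λ _ → 1^ k)
        (trans (product-replicate (suc l)) (1^ (suc l))) 1≉0 (trans (*-congˡ (*-identityˡ _)) eq)
      bySign (inj₂ eq) = let ε , ε^k≈-1 , ∏ε≈-1 = rootsOfMinusOne l in
        (λ j → ε j * s) , scaledRoots-solve {ε = ε} μ≉0 μss≈ab ε^k≈-1 ∏ε≈-1 -1≉0 (begin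
          β * (- 1# * s ^ k)  ≈⟨ *-congˡ (-1*x≈-x _) ⟩
          β * - (s ^ k)       ≈⟨ -‿distribʳ-* _ _ ⟨
          - (β * s ^ k)       ≈⟨ -‿cong eq ⟩
          - - c               ≈⟨ -‿involutive c ⟩
          c                   ∎)

    product≈0 : ∀ {m} {t : Fin m → Carrier} j → t j ≈ 0# → product t ≈ 0#
    product≈0 zero    eq = x≈0⇒xy≈0 _ eq
    product≈0 (suc j) eq = y≈0⇒xy≈0 _ (product≈0 j eq)

    -- With q = a b ∏ t = μ tⱼ^(m+2) for all j, both sides times q^m are μ^m q^(m+2).
    edgeProduct-square : ∀ {m μ a b q} (t : Fin m → Carrier) → ¬ q ≈ 0# → q ≈ a * (b * product t) →
      (∀ j → q ≈ μ * t j ^ (2 ℕ.+ m)) → μ ^ m * (q * q) ≈ a ^ (2 ℕ.+ m) * b ^ (2 ℕ.+ m)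
    edgeProduct-square {m} {μ} {a} {b} {q} t q≉0 q≈abt q≈μt^k = *-cancelˡ (^-≉0 m q≉0) (begin
      q ^ m * (μ ^ m * (q * q))
        ≈⟨ solve 3 (λ x y q → x :* (y :* (q :* q)) := y :* (q :* (q :* x))) refl (q ^ m) (μ ^ m) q ⟩
      μ ^ m * q ^ k
        ≈⟨ *-congˡ (trans (^-congˡ k q≈abt) (trans (^-distrib-* a (b * product t) k) (*-congˡ (^-distrib-* b (product t) k)))) ⟩
      μ ^ m * (a ^ k * (b ^ k * product t ^ k))
        ≈⟨ *-congˡ (*-congˡ (*-congˡ (product-^ t k))) ⟩
      μ ^ m * (a ^ k * (b ^ k * product (λ j → t j ^ k)))
        ≈⟨ solve 4 (λ x a b c → x :* (a :* (b :* c)) := (x :* c) :* (a :* b)) refl (μ ^ m) (a ^ k) (b ^ k) _ ⟩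
      (μ ^ m * product (λ j → t j ^ k)) * (a ^ k * b ^ k)
        ≈⟨ *-congʳ (*-congʳ (product-constant m {λ _ → μ} (λ _ → refl))) ⟨
      (product {m} (λ _ → μ) * product (λ j → t j ^ k)) * (a ^ k * b ^ k)
        ≈⟨ *-congʳ (product-* (λ _ → μ) (λ j → t j ^ k)) ⟨
      product (λ j → μ * t j ^ k) * (a ^ k * b ^ k)
        ≈⟨ *-congʳ (product-constant m (λ j → sym (q≈μt^k j))) ⟩
      q ^ m * (a ^ k * b ^ k) ∎)
      where k = 2 ℕ.+ m

    -- Signed adjacency matrices, edge sums and the tensor equation

    entry-adjacent : ∀ {s} (Γ : SignedGraph s) {i j} → SignedGraph.Adj Γ i j →
      matrixEntry Γ i j ≈ signValue (SignedGraph.sign Γ i j)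
    entry-adjacent Γ {i} {j} ij = trans (matrixEntry-if Γ i j) (when-yes (SignedGraph.adj? Γ i j) ij)

    entry-nonadjacent : ∀ {s} (Γ : SignedGraph s) {i j} → ¬ SignedGraph.Adj Γ i j → matrixEntry Γ i j ≈ 0#
    entry-nonadjacent Γ {i} {j} ¬ij = trans (matrixEntry-if Γ i j) (when-no (SignedGraph.adj? Γ i j) ¬ij)

    IsEigenpair : ∀ {m} → SignedGraph m → Carrier → (Fin m → Carrier) → Set
    IsEigenpair Γ β z = ¬ (∀ i → z i ≈ 0#) × (∀ i → sum (λ j → matrixEntry Γ i j * z j) ≈ β * z i)

    entry-sym : ∀ {s} (Γ : SignedGraph s) i j → matrixEntry Γ i j ≈ matrixEntry Γ j i
    entry-sym Γ i j with SignedGraph.adj? Γ i j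
    ... | yes ij = trans (entry-adjacent Γ ij) (trans (reflexive (≡.cong signValue (SignedGraph.sign-sym Γ ij)))
                     (sym (entry-adjacent Γ (SignedGraph.symm Γ ij))))
    ... | no ¬ij = trans (entry-nonadjacent Γ ¬ij) (sym (entry-nonadjacent Γ (¬ij ∘ SignedGraph.symm Γ)))

    -- The converse construction puts a `k`-th root of `z_i²` on each vertex. Such roots are
    -- extracted from non-negative reals only, so they become available by passing to a real
    -- eigenvector.
    RootableEigenvector : ℕ → ∀ {s} → SignedGraph s → Carrier → Set
    RootableEigenvector k {s} Γ β =
      Σ[ z ∈ (Fin s → Carrier) ] IsEigenpair Γ β z × (∀ i → Σ[ r ∈ Carrier ] r ^ k ≈ z i * z i)

    module Conjugation
      (conj : Carrier → Carrier)
      (conj-cong : ∀ {x y} → x ≈ y → conj x ≈ conj y)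
      (conj-+ : ∀ x y → conj (x + y) ≈ conj x + conj y)
      (conj-* : ∀ x y → conj (x * y) ≈ conj x * conj y)
      (conj-0 : conj 0# ≈ 0#)
      (conj-signValue : ∀ σ → conj (signValue σ) ≈ signValue σ)
      (conj-involutive : ∀ x → conj (conj x) ≈ x)
      (definite : ∀ {n} (y : Fin n → Carrier) → sum (λ i → conj (y i) * y i) ≈ 0# → ∀ i → y i ≈ 0#)
      (𝕚 : Carrier) (𝕚≉0 : ¬ 𝕚 ≈ 0#) (conj-𝕚 : conj 𝕚 ≈ - 𝕚)
      (x+x≈0⇒x≈0 : ∀ {x} → x + x ≈ 0# → x ≈ 0#)
      (rootOfSquare : ∀ k z → conj z ≈ z → Σ[ r ∈ Carrier ] r ^ suc k ≈ z * z)
      where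

      rootableEigenvector : ∀ k {s} (Γ : SignedGraph s) {β y} → IsEigenpair Γ β y → RootableEigenvector (suc k) Γ β
      rootableEigenvector k Γ {β} {y} (y≉0 , eig) =
        let z , z≉0 , z-eig , z-real = realEigenvector y≉0 eig in
        z , (z≉0 , z-eig) , λ i → rootOfSquare k (z i) (z-real i)
        where
        conj-entry : ∀ i j → conj (matrixEntry Γ i j) ≈ matrixEntry Γ i j
        conj-entry i j with SignedGraph.adj? Γ i j
        ... | yes ij = trans (conj-cong (entry-adjacent Γ ij)) (trans (conj-signValue _) (sym (entry-adjacent Γ ij)))
        ... | no ¬ij = trans (conj-cong (entry-nonadjacent Γ ¬ij)) (trans conj-0 (sym (entry-nonadjacent Γ ¬ij)))
        open Hermitian conj conj-cong conj-+ conj-* conj-0 conj-involutive definite 𝕚 𝕚≉0 conj-𝕚 x+x≈0⇒x≈0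
          (matrixEntry Γ) (entry-sym Γ) conj-entry β

    -- The tensor equation after the sum over index tuples is carried out: the orderings of an edge
    -- collapse to one term.
    IsEdgeSumEigenpair : ∀ {n} (G : Graph n) k → Carrier → (Fin (powerOrder G k) → Carrier) → Set
    IsEdgeSumEigenpair G k μ x = ¬ (∀ i → x i ≈ 0#) ×
      (∀ i → sum (λ e → when (i ∈? hyperedgeSet G k e) (prodOver (hyperedgeSet G k e - i) x)) ≈ μ * x i ^ pred k)

    -- Both cases of the theorem in one statement: the subgraph has to be induced when `k ≡ 3`.
    SubgraphEigenvalue : ∀ {n} → Graph n → ℕ → Carrier → Set₁
    SubgraphEigenvalue G k μ = ∃[ s ] Σ[ Γ ∈ SignedGraph s ] Σ[ sub ∈ IsSubgraph (SignedGraph.graph Γ) G ]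
      (k ≡ 3 → ∀ {i j} → Graph.Adj G (IsSubgraph.ι sub i) (IsSubgraph.ι sub j) → SignedGraph.Adj Γ i j) ×
      Σ[ β ∈ Carrier ] (∃[ z ] IsEigenpair Γ β z) × β ^ 2 ≈ μ ^ k

    module Tensor {n} (G : Graph n) (k : ℕ) (2≤k : 2 ℕ.≤ k) (j : Fin (k ∸ 2))
      (c : Carrier) (k!c≈1 : (pred k !) · c ≈ 1#)
      (T : Fin (powerOrder G k) → Vec (Fin (powerOrder G k)) (pred k) → Carrier)
      (T≈ : ∀ i is → T i is ≈
        when (UniformHypergraph.edge? (powerHypergraph G k 2≤k) (setOf (i ∷ Vec.toList is))) c) where

      open UniformHypergraph (powerHypergraph G k 2≤k) using (edge?; uniform)

      IsTensorEigenpair : Carrier → (Fin (powerOrder G k) → Carrier) → Set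
      IsTensorEigenpair μ x = ¬ (∀ i → x i ≈ 0#) ×
        (∀ i → multiSum (pred k) (λ is → T i is * monomial x is) ≈ μ * x i ^ pred k)

      tensor≈edgeSum : ∀ x i → multiSum (pred k) (λ is → T i is * monomial x is) ≈
        sum (λ e → when (i ∈? hyperedgeSet G k e) (prodOver (hyperedgeSet G k e - i) x))
      tensor≈edgeSum x i = trans (multiSum-cong (pred k) (λ is → *-congʳ (T≈ i is)))
        (apply-formula (hyperedgeSet G k) (hyperedgeSet-injective G k j)
          (λ e → ≡.trans (uniform (e , ≡.refl)) (≡.sym (ℕ.suc-pred k {{ℕ.>-nonZero (ℕ.<-trans (s≤s z≤n) 2≤k)}})))
          edge? c k!c≈1 x i)

      tensor⇒edgeSum : ∀ {μ x} → IsTensorEigenpair μ x → IsEdgeSumEigenpair G k μ x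
      tensor⇒edgeSum {x = x} (x≉0 , eq) = x≉0 , λ i → trans (sym (tensor≈edgeSum x i)) (eq i)

      edgeSum⇒tensor : ∀ {μ x} → IsEdgeSumEigenpair G k μ x → IsTensorEigenpair μ x
      edgeSum⇒tensor {x = x} (x≉0 , eq) = x≉0 , λ i → trans (tensor≈edgeSum x i) (eq i)

    module Power {n} (G : Graph n) (k-3 : ℕ) where

      m k : ℕ
      m = suc k-3
      k = 2 ℕ.+ m

      old : Fin n → Fin (powerOrder G k)
      old = oldVertex G k

      new : Fin (∣E∣ G) → Fin m → Fin (powerOrder G k)
      new = newVertex G k

      E : Fin (∣E∣ G) → Subset (powerOrder G k)
      E = hyperedgeSet G k

      IsPowerEigenpair : Carrier → (Fin (powerOrder G k) → Carrier) → Set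
      IsPowerEigenpair = IsEdgeSumEigenpair G k

      edgeProduct : (Fin (powerOrder G k) → Carrier) → Fin (∣E∣ G) → Carrier
      edgeProduct x e = prodOver (E e) x

      edgeProduct-expand : ∀ x e →
        edgeProduct x e ≈ x (old (end₁ G e)) * (x (old (end₂ G e)) * product (λ j → x (new e j)))
      edgeProduct-expand x e = trans (prodOver-setOf (hyperedge-unique G k e) x)
        (*-congˡ (*-congˡ (foldr-tabulate x (new e))))

      sum-remove≈sum-edgeProduct : ∀ x i →
        x i * sum (λ e → when (i ∈? E e) (prodOver (E e - i) x)) ≈ sum (λ e → when (i ∈? E e) (edgeProduct x e))
      sum-remove≈sum-edgeProduct x i = trans (*-distribˡ-sum {∣E∣ G} (x i) _)
        (sum-cong-≋ (λ e → trans (*-when (i ∈? E e) (x i) _) (when-cong (i ∈? E e) (prodOver-remove x))))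

      -- An added vertex lies on no hyperedge but its own.
      sum-at-new : ∀ {f : Fin (∣E∣ G) → Carrier} e j → sum (λ e′ → when (new e j ∈? E e′) (f e′)) ≈ f e
      sum-at-new {f} e j = trans
        (sum-single (λ e′ → when (new e j ∈? E e′) (f e′)) e
          (λ e′ e′≢e → when-no (new e j ∈? E e′) (e′≢e ∘ ≡.sym ∘ new∈⁻ G k)))
        (when-yes (new e j ∈? E e) (new∈ G k e j))

      incident-term≉0 : ∀ x {c v e} → ¬ c * when (old v ∈? E e) (edgeProduct x e) ≈ 0# →
        old v ∈ E e × ¬ edgeProduct x e ≈ 0#
      incident-term≉0 x {c} {v} {e} ≉0 =
        decidable-stable (old v ∈? E e) (λ ∉ → ≉0 (y≈0⇒xy≈0 c (when-no (old v ∈? E e) ∉))) ,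
        (λ Q≈0 → ≉0 (y≈0⇒xy≈0 c (trans (when-cong (old v ∈? E e) (λ _ → Q≈0)) (when-0 (old v ∈? E e)))))

      -- From an eigenvector of the power hypergraph to a signed subgraph

      module Forward {μ x} (μ≉0 : ¬ μ ≈ 0#) (pair : IsPowerEigenpair μ x)
        {β} (ββ≈μ^k : β * β ≈ μ ^ k)
        (y : Fin n → Carrier) (yy≈x^k : ∀ v → y v * y v ≈ x (old v) ^ k)
        (support : Enumeration (λ v → ¬ x (old v) ≈ 0#)) where

        open Enumeration support
          renaming (index to ι; injective to ι-injective; sound to ι-sound; complete to ι-complete)

        edgeSum : ∀ i → sum (λ e → when (i ∈? E e) (edgeProduct x e)) ≈ μ * x i ^ k
        edgeSum i = begin
          sum (λ e → when (i ∈? E e) (edgeProduct x e))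
            ≈⟨ sum-remove≈sum-edgeProduct x i ⟨
          x i * sum (λ e → when (i ∈? E e) (prodOver (E e - i) x))
            ≈⟨ *-congˡ (proj₂ pair i) ⟩
          x i * (μ * x i ^ suc m)
            ≈⟨ solve 3 (λ a b c → a :* (b :* c) := b :* (a :* c)) refl (x i) μ (x i ^ suc m) ⟩
          μ * x i ^ k ∎

        Q : Fin (∣E∣ G) → Carrier
        Q = edgeProduct x

        edgeProduct-new : ∀ e j → Q e ≈ μ * x (new e j) ^ k
        edgeProduct-new e j = trans (sym (sum-at-new e j)) (edgeSum (new e j))

        -- If all old entries vanish, so does every edge product, and the equations at the added
        -- vertices then force their entries to vanish too.
        old≉0 : ¬ (∀ v → x (old v) ≈ 0#)
        old≉0 old≈0 = proj₁ pair (λ i → all≈0 (vertexView G k i))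
          where
          all≈0 : ∀ {i} → VertexView G k i → x i ≈ 0#
          all≈0 (isOld v)   = old≈0 v
          all≈0 (isNew e j) = x^n≈0⇒x≈0 (suc m) (xy≈0⇒y≈0 μ≉0
            (trans (sym (edgeProduct-new e j)) (prodOver≈0 (end₁∈ G k e) (old≈0 _))))

        y≈0⇒x≈0 : ∀ {v} → y v ≈ 0# → x (old v) ≈ 0#
        y≈0⇒x≈0 {v} y≈0 = x^n≈0⇒x≈0 (suc m) (trans (sym (yy≈x^k v)) (x≈0⇒xy≈0 _ y≈0))

        end₁≉0 : ∀ {e} → ¬ Q e ≈ 0# → ¬ x (old (end₁ G e)) ≈ 0#
        end₁≉0 {e} Q≉0 x≈0 = Q≉0 (prodOver≈0 (end₁∈ G k e) x≈0)

        end₂≉0 : ∀ {e} → ¬ Q e ≈ 0# → ¬ x (old (end₂ G e)) ≈ 0#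
        end₂≉0 {e} Q≉0 x≈0 = Q≉0 (prodOver≈0 (end₂∈ G k e) x≈0)

        βQ-square : ∀ {e u v} → Joins G e u v → ¬ Q e ≈ 0# →
          (β * Q e) * (β * Q e) ≈ (μ * (y u * y v)) * (μ * (y u * y v))
        βQ-square {e} {u} {v} e-joins Q≉0 = begin
          (β * Q e) * (β * Q e)
            ≈⟨ solve 2 (λ b q → (b :* q) :* (b :* q) := (b :* b) :* (q :* q)) refl β (Q e) ⟩
          (β * β) * (Q e * Q e)
            ≈⟨ *-congʳ ββ≈μ^k ⟩
          -- Two of the `k` factors `μ` are split off, since `edgeProduct-square` absorbs the other
          -- `m`.
          μ ^ k * (Q e * Q e)
            ≈⟨ solve 3 (λ x y q → (x :* (x :* y)) :* q := (x :* x) :* (y :* q)) refl μ (μ ^ m) (Q e * Q e) ⟩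
          (μ * μ) * (μ ^ m * (Q e * Q e))
            ≈⟨ *-congˡ (edgeProduct-square (λ j → x (new e j)) Q≉0 (edgeProduct-expand x e) (edgeProduct-new e)) ⟩
          (μ * μ) * (x (old (end₁ G e)) ^ k * x (old (end₂ G e)) ^ k)
            ≈⟨ *-congˡ (oriented e-joins) ⟩
          (μ * μ) * ((y u * y u) * (y v * y v))
            ≈⟨ solve 3 (λ a b c → (a :* a) :* ((b :* b) :* (c :* c)) := (a :* (b :* c)) :* (a :* (b :* c))) refl μ (y u) (y v) ⟩
          (μ * (y u * y v)) * (μ * (y u * y v)) ∎
          where
          oriented : Joins G e u v → x (old (end₁ G e)) ^ k * x (old (end₂ G e)) ^ k ≈ (y u * y u) * (y v * y v)
          oriented (inj₁ (≡.refl , ≡.refl)) = sym (*-cong (yy≈x^k u) (yy≈x^k v))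
          oriented (inj₂ (≡.refl , ≡.refl)) = trans (*-comm _ _) (sym (*-cong (yy≈x^k u) (yy≈x^k v)))

        AdjΓ : Fin size → Fin size → Set
        AdjΓ i j = ∃[ e ] (Joins G e (ι i) (ι j) × ¬ Q e ≈ 0#)

        -- The sign of an edge records which of `β Q_e ≈ ± μ y_u y_v` holds, plus being preferred.
        -- It is relative to the chosen square roots `y`, and symmetric because the product of the
        -- end values is.
        IsPositive : Fin size → Fin size → Set
        IsPositive i j = ∃[ e ] (Joins G e (ι i) (ι j) × β * Q e ≈ μ * (y (ι i) * y (ι j)))

        signOf : ∀ {P : Set} → Dec P → Sign
        signOf (yes _) = Sign.+
        signOf (no _)  = Sign.-

        signOf-cong : ∀ {P P′ : Set} (d : Dec P) (d′ : Dec P′) → (P → P′) → (P′ → P) → signOf d ≡ signOf d′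
        signOf-cong (yes p) (yes p′) f g = ≡.refl
        signOf-cong (no ¬p) (no ¬p′) f g = ≡.refl
        signOf-cong (yes p) (no ¬p′) f g = contradiction (f p) ¬p′
        signOf-cong (no ¬p) (yes p′) f g = contradiction (g p′) ¬p

        positive-sym : ∀ {i j} → IsPositive i j → IsPositive j i
        positive-sym (e , e-joins , eq) = e , joins-sym G e-joins , trans eq (*-congˡ (*-comm _ _))

        Γ : SignedGraph size
        Γ = record
          { graph = record
            { Adj    = AdjΓ
            ; adj?   = λ _ _ → em
            ; symm   = λ (e , e-joins , Q≉0) → e , joins-sym G e-joins , Q≉0
            ; irrefl = λ { ≡.refl (e , e-joins , _) → Graph.irrefl G ≡.refl (joins⇒Adj G e-joins) }
            }
          ; sign     = λ i j → signOf (em {IsPositive i j})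
          ; sign-sym = λ _ → signOf-cong em em positive-sym positive-sym
          }

        Γ-subgraph : IsSubgraph (SignedGraph.graph Γ) G
        Γ-subgraph = record
          { ι           = ι
          ; ι-injective = ι-injective
          ; preserves   = λ (e , e-joins , _) → joins⇒Adj G e-joins
          }

        βQ≈signed : ∀ {e i j} → Joins G e (ι i) (ι j) → ¬ Q e ≈ 0# →
          β * Q e ≈ μ * (y (ι i) * (signValue (SignedGraph.sign Γ i j) * y (ι j)))
        βQ≈signed {e} {i} {j} e-joins Q≉0 = bySign em
          where
          bySign : (d : Dec (IsPositive i j)) → β * Q e ≈ μ * (y (ι i) * (signValue (signOf d) * y (ι j)))
          bySign (yes (e′ , e′-joins , eq)) = begin
            β * Q e                                         ≡⟨ ≡.cong (λ e → β * Q e) (joins-injective G e-joins e′-joins) ⟩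
            β * Q e′                                        ≈⟨ eq ⟩
            μ * (y (ι i) * y (ι j))                         ≈⟨ *-congˡ (*-congˡ (*-identityˡ _)) ⟨
            μ * (y (ι i) * (1# * y (ι j)))                  ≈⟨ *-congˡ (*-congˡ (*-congʳ signValue-+)) ⟨
            μ * (y (ι i) * (signValue Sign.+ * y (ι j)))    ∎
          bySign (no ¬pos) = begin
            β * Q e                                         ≈⟨ negative (xx≈yy⇒x≈±y (βQ-square e-joins Q≉0)) ⟩
            - (μ * (y (ι i) * y (ι j)))                     ≈⟨ trans (-‿distribʳ-* _ _) (*-congˡ (-‿distribʳ-* _ _)) ⟩
            μ * (y (ι i) * - y (ι j))                       ≈⟨ *-congˡ (*-congˡ (-1*x≈-x _)) ⟨
            μ * (y (ι i) * (- 1# * y (ι j)))                ≈⟨ *-congˡ (*-congˡ (*-congʳ signValue--)) ⟨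
            μ * (y (ι i) * (signValue Sign.- * y (ι j)))    ∎
            where
            negative : ∀ {c} → β * Q e ≈ μ * (y (ι i) * y (ι j)) ⊎ c → c
            negative (inj₁ eq) = contradiction (e , e-joins , eq) ¬pos
            negative (inj₂ eq) = eq

        z : Fin size → Carrier
        z i = y (ι i)

        -- After multiplication by `μ z_i` one side is a sum over the vertices of `Γ` and the other
        -- a sum over the edges of `G` at `ι i`; `Joins` matches their nonzero terms. Dividing again
        -- needs `z_i ≠ 0`, which is why `Γ` lives on the support of `x`.
        eigen-equation : ∀ i → sum (λ j → matrixEntry Γ i j * z j) ≈ β * z i
        eigen-equation i = *-cancelˡ (*-≉0 μ≉0 (ι-sound i ∘ y≈0⇒x≈0)) (begin
          (μ * z i) * sum (λ j → matrixEntry Γ i j * z j)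
            ≈⟨ *-distribˡ-sum {size} (μ * z i) _ ⟩
          sum g
            ≈⟨ sum-matching f g (λ e j → Joins G e (ι i) (ι j)) f-total g-total
                 (λ p q → ι-injective (joins-functional G p q)) (joins-injective G) (λ {e} {j} → f≈g {e} {j}) ⟨
          sum f
            ≈⟨ *-distribˡ-sum {∣E∣ G} β _ ⟨
          β * sum (λ e → when (old (ι i) ∈? E e) (Q e))
            ≈⟨ *-congˡ (edgeSum (old (ι i))) ⟩
          β * (μ * x (old (ι i)) ^ k)
            ≈⟨ *-congˡ (*-congˡ (yy≈x^k (ι i))) ⟨
          β * (μ * (z i * z i))
            ≈⟨ solve 3 (λ b μ z → b :* (μ :* (z :* z)) := (μ :* z) :* (b :* z)) refl β μ (z i) ⟩
          (μ * z i) * (β * z i) ∎)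
          where
          f : Fin (∣E∣ G) → Carrier
          f e = β * when (old (ι i) ∈? E e) (Q e)
          g : Fin size → Carrier
          g j = (μ * z i) * (matrixEntry Γ i j * z j)
          f-total : ∀ e → ¬ f e ≈ 0# → ∃[ j ] Joins G e (ι i) (ι j)
          f-total e f≉0 with v∈ , Q≉0 ← incident-term≉0 x f≉0 with old∈⁻ G k v∈
          -- A nonzero edge product puts the far end of the edge into the support, hence among the
          -- vertices of `Γ`.
          ... | u , inj₁ (p , ≡.refl) = let j , ιj≡u = ι-complete (end₂≉0 Q≉0) in j , inj₁ (p , ≡.sym ιj≡u)
          ... | u , inj₂ (≡.refl , p) = let j , ιj≡u = ι-complete (end₁≉0 Q≉0) in j , inj₂ (≡.sym ιj≡u , p)
          g-total : ∀ j → ¬ g j ≈ 0# → ∃[ e ] Joins G e (ι i) (ι j)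
          g-total j g≉0 = let e , e-joins , _ = decidable-stable em
                                (λ ¬adj → g≉0 (y≈0⇒xy≈0 _ (x≈0⇒xy≈0 _ (entry-nonadjacent Γ ¬adj)))) in e , e-joins
          f≈g : ∀ {e j} → Joins G e (ι i) (ι j) → f e ≈ g j
          f≈g {e} {j} e-joins = trans (*-congˡ (when-yes (old (ι i) ∈? E e) (joins⇒∈ G k e-joins))) (byQ em)
            where
            byQ : Dec (Q e ≈ 0#) → β * Q e ≈ g j
            -- Two vertices of the support may be joined in `G` by an edge with vanishing product.
            -- It is no edge of `Γ`, so the matrix entry vanishes as well.
            byQ (yes Q≈0) = trans (y≈0⇒xy≈0 β Q≈0) (sym (y≈0⇒xy≈0 _ (x≈0⇒xy≈0 _ (entry-nonadjacent Γ
              (λ (e′ , e′-joins , Q′≉0) → Q′≉0 (trans (reflexive (≡.cong Q (joins-injective G e′-joins e-joins))) Q≈0))))))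
            byQ (no Q≉0) = begin
              β * Q e
                ≈⟨ βQ≈signed e-joins Q≉0 ⟩
              μ * (z i * (signValue (SignedGraph.sign Γ i j) * z j))
                ≈⟨ *-congˡ (*-congˡ (*-congʳ (entry-adjacent Γ (e , e-joins , Q≉0)))) ⟨
              μ * (z i * (matrixEntry Γ i j * z j))
                ≈⟨ *-assoc _ _ _ ⟨
              g j ∎

        z≉0 : ¬ (∀ i → z i ≈ 0#)
        z≉0 z≈0 = old≉0 (λ v → decidable-stable em (λ x≉0 →
          let i , ιi≡v = ι-complete x≉0 in x≉0 (y≈0⇒x≈0 (trans (reflexive (≡.cong y (≡.sym ιi≡v))) (z≈0 i)))))

        Γ-eigenpair : IsEigenpair Γ β z
        Γ-eigenpair = z≉0 , eigen-equation

        Γ-reflects : k-3 ≡ 0 → ∀ {i j} → Graph.Adj G (ι i) (ι j) → AdjΓ i j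
        Γ-reflects ≡.refl {i} {j} ij = let e , e-joins = Adj⇒joins G ij in
          e , e-joins , Q≉0 e (ι-sound i) (ι-sound j) e-joins
          where
          -- The vertex w added to e satisfies x_u x_v = μ x_w².
          Q≉0 : ∀ e {u v} → ¬ x (old u) ≈ 0# → ¬ x (old v) ≈ 0# → Joins G e u v → ¬ Q e ≈ 0#
          Q≉0 e {u} {v} u≉0 v≉0 e-joins Q≈0 =
            let w = new e zero
                w≈0 = x^n≈0⇒x≈0 (suc m) (xy≈0⇒y≈0 μ≉0 (trans (sym (edgeProduct-new e zero)) Q≈0))
                removed≈0 = trans (sym (sum-at-new e zero)) (trans (proj₂ pair w)
                  (y≈0⇒xy≈0 μ (x^1+n≈0 m w≈0)))
                i , i∈ , x≈0 = prodOver≈0⁻ (E e - w) removed≈0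
            in other (vertexView G k i) (p─q⊆p (E e) _ i∈) (λ eq → x∉p-x (E e) (≡.subst (_∈ (E e - w)) eq i∈)) x≈0
            where
            other : ∀ {i} → VertexView G k i → i ∈ E e → i ≢ new e zero → ¬ x i ≈ 0#
            other (isOld v′) v′∈ _ with joins-either G e-joins (proj₂ (old∈⁻ G k v′∈))
            ... | inj₁ ≡.refl = u≉0
            ... | inj₂ ≡.refl = v≉0
            -- For `k = 3` the removed vertex was the only added one.
            other (isNew e′ zero) w∈ ≢w _ = ≢w (≡.cong (λ e → new e zero) (new∈⁻ G k w∈))

      -- From a signed subgraph to an eigenvector of the power hypergraph

      module Backward {μ} (μ≉0 : ¬ μ ≈ 0#) {size} (Γ : SignedGraph size)
        (subgraph : IsSubgraph (SignedGraph.graph Γ) G)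
        {β z} (pair : IsEigenpair Γ β z) (ββ≈μ^k : β * β ≈ μ ^ k)
        (r : Fin size → Carrier) (r^k≈zz : ∀ i → r i ^ k ≈ z i * z i)
        (induced : k-3 ≡ 0 → ∀ {i j} →
          Graph.Adj G (IsSubgraph.ι subgraph i) (IsSubgraph.ι subgraph j) → SignedGraph.Adj Γ i j)
        where

        open SignedGraph Γ using (Adj; adj?; sign; sign-sym; symm)
        open IsSubgraph subgraph using (ι; ι-injective; preserves)

        valueAt : ∀ {v} → Dec (∃[ i ] ι i ≡ v) → Carrier
        valueAt (yes (i , _)) = r i
        valueAt (no _)        = 0#

        xOld : Fin n → Carrier
        xOld v = valueAt (em {∃[ i ] ι i ≡ v})

        xOld-ι : ∀ i → xOld (ι i) ≈ r i
        xOld-ι i = valueAt-ι em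
          where
          valueAt-ι : (d : Dec (∃[ j ] ι j ≡ ι i)) → valueAt d ≈ r i
          valueAt-ι (yes (j , ιj≡ιi)) = reflexive (≡.cong r (ι-injective ιj≡ιi))
          valueAt-ι (no ∄)            = contradiction (i , ≡.refl) ∄

        xOld≉0⇒ι : ∀ {v} → ¬ xOld v ≈ 0# → ∃[ i ] ι i ≡ v
        xOld≉0⇒ι {v} x≉0 = decidable-stable em (λ ∄ → x≉0 (valueAt-∄ em ∄))
          where
          valueAt-∄ : (d : Dec (∃[ i ] ι i ≡ v)) → ¬ (∃[ i ] ι i ≡ v) → valueAt d ≈ 0#
          valueAt-∄ (yes i) ∄ = contradiction i ∄
          valueAt-∄ (no _)  ∄ = refl

        signedProduct : Fin size → Fin size → Carrier
        signedProduct i j = matrixEntry Γ i j * (z i * z j)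

        entry-square : ∀ {i j} → Adj i j → matrixEntry Γ i j * matrixEntry Γ i j ≈ 1#
        entry-square {i} {j} ij = trans (*-cong (entry-adjacent Γ ij) (entry-adjacent Γ ij)) (signValue-square (sign i j))
          where
          signValue-square : ∀ σ → signValue σ * signValue σ ≈ 1#
          signValue-square Sign.+ = trans (*-cong signValue-+ signValue-+) (*-identityˡ 1#)
          signValue-square Sign.- = trans (*-cong signValue-- signValue--) (trans (-1*x≈-x _) (-‿involutive 1#))

        InSubgraph : Fin (∣E∣ G) → Set
        InSubgraph e = ∃[ i ] ∃[ j ] (ι i ≡ end₁ G e × ι j ≡ end₂ G e × Adj i j)

        endProduct : Fin (∣E∣ G) → Carrier
        endProduct e = xOld (end₁ G e) * xOld (end₂ G e)

        edgeProductOf : ∀ e → (Fin m → Carrier) → Carrier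
        edgeProductOf e t = xOld (end₁ G e) * (xOld (end₂ G e) * product t)

        -- What the equations of the whole hypergraph require of one edge. At an added vertex with
        -- value zero the product over the other vertices must vanish, hence the second zero in
        -- `vanishing⁻`. At an end with value zero, `vanishing` plays the same part.
        record EdgeValues (e : Fin (∣E∣ G)) : Set where
          field
            t            : Fin m → Carrier
            new-equation : ∀ j → edgeProductOf e t ≈ μ * t j ^ k
            signed       : ∀ {i j} → ι i ≡ end₁ G e → ι j ≡ end₂ G e → Adj i j → β * edgeProductOf e t ≈ μ * signedProduct i j
            outside      : ¬ InSubgraph e → edgeProductOf e t ≈ 0#
            vanishing    : endProduct e ≈ 0# → ∀ j → t j ≈ 0#
            vanishing⁻   : ∀ j → t j ≈ 0# → endProduct e ≈ 0# ⊎ ∃[ j′ ] (j′ ≢ j × t j′ ≈ 0#)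

        insideValues : ∀ {e} → InSubgraph e → EdgeValues e
        insideValues {e} (i , j , ιi≡ , ιj≡ , ij) = let
            t , new-eq , signed , vanishing , vanishing⁻ = edgeSolution
              {a = xOld (end₁ G e)} {b = xOld (end₂ G e)} {c = signedProduct i j} μ≉0 ββ≈μ^k powers
          in record
            { t            = t
            ; new-equation = new-eq
            ; signed       = λ {i′} {j′} ιi′≡ ιj′≡ _ → trans signed (*-congˡ (reflexive (≡.cong₂ signedProduct
                (ι-injective (≡.trans ιi≡ (≡.sym ιi′≡))) (ι-injective (≡.trans ιj≡ (≡.sym ιj′≡))))))
            ; outside      = λ ∉ → contradiction (i , j , ιi≡ , ιj≡ , ij) ∉
            ; vanishing    = vanishing
            ; vanishing⁻   = λ j t≈0 → inj₁ (vanishing⁻ j t≈0)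
            }
          where
          at-end : ∀ {i v} → ι i ≡ v → xOld v ^ k ≈ z i * z i
          at-end {i} ≡.refl = trans (^-congˡ k (xOld-ι i)) (r^k≈zz i)
          powers : xOld (end₁ G e) ^ k * xOld (end₂ G e) ^ k ≈ signedProduct i j * signedProduct i j
          powers = begin
            xOld (end₁ G e) ^ k * xOld (end₂ G e) ^ k
              ≈⟨ *-cong (at-end ιi≡) (at-end ιj≡) ⟩
            (z i * z i) * (z j * z j)
              ≈⟨ *-identityˡ _ ⟨
            1# * ((z i * z i) * (z j * z j))
              ≈⟨ *-congʳ (entry-square ij) ⟨
            (matrixEntry Γ i j * matrixEntry Γ i j) * ((z i * z i) * (z j * z j))
              ≈⟨ solve 3 (λ a b c → (a :* a) :* ((b :* b) :* (c :* c)) := (a :* (b :* c)) :* (a :* (b :* c)))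
                   refl (matrixEntry Γ i j) (z i) (z j) ⟩
            signedProduct i j * signedProduct i j ∎

        -- An edge outside `Γ` must not contribute to the equations at its ends, so its added
        -- vertices get the value zero.
        outsideValues : ∀ {e} → ¬ InSubgraph e → EdgeValues e
        outsideValues {e} ∉ = record
          { t            = λ _ → 0#
          ; new-equation = λ j → trans product≈0′ (sym (y≈0⇒xy≈0 μ (x^1+n≈0 (suc m) refl)))
          ; signed       = λ ιi≡ ιj≡ ij → contradiction (_ , _ , ιi≡ , ιj≡ , ij) ∉
          ; outside      = λ _ → product≈0′
          ; vanishing    = λ _ _ → refl
          ; vanishing⁻   = λ j _ → secondZero k-3 ≡.refl j
          }
          where
          product≈0′ : edgeProductOf e (λ _ → 0#) ≈ 0#
          product≈0′ = y≈0⇒xy≈0 _ (y≈0⇒xy≈0 _ (product≈0 {m} {λ _ → 0#} zero refl))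
          secondZero : ∀ l → k-3 ≡ l → (j : Fin (suc l)) → endProduct e ≈ 0# ⊎ ∃[ j′ ] (j′ ≢ j × 0# ≈ 0#)
          -- With at least two added vertices, another one of them is the second zero.
          secondZero (suc l) _ zero    = inj₂ (suc zero , (λ ()) , refl)
          secondZero (suc l) _ (suc j) = inj₂ (zero , (λ ()) , refl)
          -- With one added vertex the second zero has to be an end. Were both end values nonzero,
          -- both ends would be vertices of `Γ`, and the edge would belong to `Γ` because it is
          -- induced.
          secondZero zero k≡3 _ = inj₁ (decidable-stable em (λ ab≉0 →
            let i , ιi≡ = xOld≉0⇒ι (λ a≈0 → ab≉0 (x≈0⇒xy≈0 _ a≈0))
                j , ιj≡ = xOld≉0⇒ι (λ b≈0 → ab≉0 (y≈0⇒xy≈0 _ b≈0))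
            in ∉ (i , j , ιi≡ , ιj≡ , induced k≡3 (≡.subst₂ (Graph.Adj G) (≡.sym ιi≡) (≡.sym ιj≡) (joins⇒Adj G (joins-ends G e))))))

        edgeValues : ∀ e → Dec (InSubgraph e) → EdgeValues e
        edgeValues e (yes ∈) = insideValues ∈
        edgeValues e (no ∉)  = outsideValues ∉

        -- The edge values enter as a parameter, so that no equation depends on the case distinction
        -- that produced them.
        module Assembled (values : ∀ e → EdgeValues e) where
          module V e = EdgeValues (values e)

          x : Fin (powerOrder G k) → Carrier
          x = extend G k xOld V.t

          x-old : ∀ v → x (old v) ≈ xOld v
          x-old v = reflexive (extend-old G k xOld V.t v)

          x-new : ∀ e j → x (new e j) ≈ V.t e j
          x-new e j = reflexive (extend-new G k xOld V.t e j)

          Q : Fin (∣E∣ G) → Carrier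
          Q = edgeProduct x

          Q-expand : ∀ e → Q e ≈ edgeProductOf e (V.t e)
          Q-expand e = trans (edgeProduct-expand x e)
            (*-cong (x-old _) (*-cong (x-old _) (product-cong (x-new e))))

          ends≈0⇒new≈0 : ∀ {e u v} → Joins G e u v → x (old u) ≈ 0# → ∀ j → x (new e j) ≈ 0#
          ends≈0⇒new≈0 {e} {u} {v} e-joins x≈0 j = trans (x-new e j) (V.vanishing e (end≈0 e-joins) j)
            where
            end≈0 : Joins G e u v → endProduct e ≈ 0#
            end≈0 (inj₁ (≡.refl , _)) = x≈0⇒xy≈0 _ (trans (sym (x-old _)) x≈0)
            end≈0 (inj₂ (_ , ≡.refl)) = y≈0⇒xy≈0 _ (trans (sym (x-old _)) x≈0)

          x≉0 : ¬ (∀ i → x i ≈ 0#)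
          x≉0 x≈0 = proj₁ pair (λ i → xx≈0⇒x≈0 (trans (sym (r^k≈zz i))
            (x^1+n≈0 (suc m) (trans (sym (trans (x-old (ι i)) (xOld-ι i))) (x≈0 (old (ι i)))))))

          β≉0 : ¬ β ≈ 0#
          β≉0 β≈0 = ^-≉0 k μ≉0 (trans (sym ββ≈μ^k) (x≈0⇒xy≈0 β β≈0))

          Equation : Fin (powerOrder G k) → Set
          Equation i = sum (λ e → when (i ∈? E e) (prodOver (E e - i) x)) ≈ μ * x i ^ suc m

          -- Undoes the multiplication by `x i`; vertices with value zero are treated on their own.
          multiplied⇒Equation : ∀ i → ¬ x i ≈ 0# →
            sum (λ e → when (i ∈? E e) (Q e)) ≈ μ * x i ^ k → Equation i
          multiplied⇒Equation i x≉0 eq = *-cancelˡ x≉0 (begin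
            x i * sum (λ e → when (i ∈? E e) (prodOver (E e - i) x))
              ≈⟨ sum-remove≈sum-edgeProduct x i ⟩
            sum (λ e → when (i ∈? E e) (Q e))
              ≈⟨ eq ⟩
            μ * x i ^ k
              ≈⟨ solve 3 (λ a b c → b :* (a :* c) := a :* (b :* c)) refl (x i) μ (x i ^ suc m) ⟩
            x i * (μ * x i ^ suc m) ∎)

          equation-new : ∀ e j → Dec (x (new e j) ≈ 0#) → Equation (new e j)
          equation-new e j (no x≉0) = multiplied⇒Equation (new e j) x≉0 (begin
            sum (λ e′ → when (new e j ∈? E e′) (Q e′))  ≈⟨ sum-at-new e j ⟩
            Q e                                         ≈⟨ Q-expand e ⟩
            edgeProductOf e (V.t e)                     ≈⟨ V.new-equation e j ⟩
            μ * V.t e j ^ k                             ≈⟨ *-congˡ (^-congˡ k (x-new e j)) ⟨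
            μ * x (new e j) ^ k                         ∎)
          equation-new e j (yes x≈0) = trans (sum-at-new e j)
            (trans (removed≈0 (V.vanishing⁻ e j (trans (sym (x-new e j)) x≈0))) (sym (y≈0⇒xy≈0 μ (x^1+n≈0 m x≈0))))
            where
            removed≈0 : endProduct e ≈ 0# ⊎ ∃[ j′ ] (j′ ≢ j × V.t e j′ ≈ 0#) → prodOver (E e - new e j) x ≈ 0#
            removed≈0 (inj₂ (j′ , j′≢j , t≈0)) = prodOver≈0
              (x∈p∧x≢y⇒x∈p-y (new∈ G k e j′) (j′≢j ∘ proj₂ ∘ newVertex-injective G k))
              (trans (x-new e j′) t≈0)
            removed≈0 (inj₁ ab≈0) = oneEnd (xy≈0⇒x≈0∨y≈0 ab≈0)
              where
              oneEnd : xOld (end₁ G e) ≈ 0# ⊎ xOld (end₂ G e) ≈ 0# → prodOver (E e - new e j) x ≈ 0#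
              oneEnd (inj₁ a≈0) = prodOver≈0 (x∈p∧x≢y⇒x∈p-y (end₁∈ G k e) (old≢new G k _ e j)) (trans (x-old _) a≈0)
              oneEnd (inj₂ b≈0) = prodOver≈0 (x∈p∧x≢y⇒x∈p-y (end₂∈ G k e) (old≢new G k _ e j)) (trans (x-old _) b≈0)

          -- The computation of the forward direction read backwards, with `β` as the factor to
          -- cancel. Edges outside `Γ` drop out because their product is zero.
          edgeSum-ι : ∀ i → ¬ z i ≈ 0# → sum (λ e → when (old (ι i) ∈? E e) (Q e)) ≈ μ * x (old (ι i)) ^ k
          edgeSum-ι i z≉0 = *-cancelˡ β≉0 (begin
            β * sum (λ e → when (old (ι i) ∈? E e) (Q e))
              ≈⟨ *-distribˡ-sum {∣E∣ G} β _ ⟩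
            sum f
              ≈⟨ sum-matching f g (λ e j → Joins G e (ι i) (ι j)) f-total g-total
                   (λ p q → ι-injective (joins-functional G p q)) (joins-injective G) (λ {e} {j} → f≈g {e} {j}) ⟩
            sum g
              ≈⟨ *-distribˡ-sum {size} (μ * z i) _ ⟨
            (μ * z i) * sum (λ j → matrixEntry Γ i j * z j)
              ≈⟨ *-congˡ (proj₂ pair i) ⟩
            (μ * z i) * (β * z i)
              ≈⟨ solve 3 (λ b μ z → (μ :* z) :* (b :* z) := b :* (μ :* (z :* z))) refl β μ (z i) ⟩
            β * (μ * (z i * z i))
              ≈⟨ *-congˡ (*-congˡ (trans (^-congˡ k (trans (x-old (ι i)) (xOld-ι i))) (r^k≈zz i))) ⟨
            β * (μ * x (old (ι i)) ^ k) ∎)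
            where
            f : Fin (∣E∣ G) → Carrier
            f e = β * when (old (ι i) ∈? E e) (Q e)
            g : Fin size → Carrier
            g j = (μ * z i) * (matrixEntry Γ i j * z j)
            Q≉0⇒InSubgraph : ∀ {e} → ¬ Q e ≈ 0# → InSubgraph e
            Q≉0⇒InSubgraph {e} Q≉0 = decidable-stable em (λ ∉ → Q≉0 (trans (Q-expand e) (V.outside e ∉)))
            f-total : ∀ e → ¬ f e ≈ 0# → ∃[ j ] Joins G e (ι i) (ι j)
            f-total e f≉0 = let ∈E , Q≉0 = incident-term≉0 x f≉0 in
              otherEnd (proj₂ (old∈⁻ G k ∈E)) (Q≉0⇒InSubgraph Q≉0)
              where
              otherEnd : ∀ {u} → Joins G e (ι i) u → InSubgraph e → ∃[ j ] Joins G e (ι i) (ι j)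
              otherEnd (inj₁ (p , _)) (_ , j , _ , ιj≡ , _) = j , inj₁ (p , ≡.sym ιj≡)
              otherEnd (inj₂ (_ , p)) (j , _ , ιj≡ , _ , _) = j , inj₂ (≡.sym ιj≡ , p)
            g-total : ∀ j → ¬ g j ≈ 0# → ∃[ e ] Joins G e (ι i) (ι j)
            g-total j g≉0 = Adj⇒joins G (preserves (decidable-stable (adj? i j)
              (λ ¬ij → g≉0 (y≈0⇒xy≈0 _ (x≈0⇒xy≈0 _ (entry-nonadjacent Γ ¬ij))))))
            f≈g : ∀ {e j} → Joins G e (ι i) (ι j) → f e ≈ g j
            f≈g {e} {j} e-joins = trans
              (*-congˡ (trans (when-yes (old (ι i) ∈? E e) (joins⇒∈ G k e-joins)) (Q-expand e)))
              (trans (signedEdge (adj? i j) e-joins)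
                (solve 4 (λ μ a b c → μ :* (a :* (b :* c)) := (μ :* b) :* (a :* c)) refl μ (matrixEntry Γ i j) (z i) (z j)))
              where
              signedEdge : Dec (Adj i j) → Joins G e (ι i) (ι j) → β * edgeProductOf e (V.t e) ≈ μ * signedProduct i j
              signedEdge (yes ij) (inj₁ (p , q)) = V.signed e (≡.sym p) (≡.sym q) ij
              signedEdge (yes ij) (inj₂ (p , q)) = trans (V.signed e (≡.sym p) (≡.sym q) (symm ij))
                (*-congˡ (*-cong (entry-sym Γ j i) (*-comm (z j) (z i))))
              signedEdge (no ¬ij) e-joins = trans (y≈0⇒xy≈0 β (V.outside e (¬inside e-joins)))
                (sym (y≈0⇒xy≈0 μ (x≈0⇒xy≈0 _ (entry-nonadjacent Γ ¬ij))))
                where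
                ¬inside : Joins G e (ι i) (ι j) → ¬ InSubgraph e
                ¬inside (inj₁ (p , q)) (i′ , j′ , p′ , q′ , i′j′) = ¬ij (≡.subst₂ Adj
                  (ι-injective (≡.trans p′ p)) (ι-injective (≡.trans q′ q)) i′j′)
                ¬inside (inj₂ (p , q)) (i′ , j′ , p′ , q′ , i′j′) = ¬ij (symm (≡.subst₂ Adj
                  (ι-injective (≡.trans p′ p)) (ι-injective (≡.trans q′ q)) i′j′))

          equation-old : ∀ v → Dec (x (old v) ≈ 0#) → Equation (old v)
          -- Every hyperedge through a zero old vertex has zeros on its added vertices, and these
          -- survive the removal of the old one.
          equation-old v (yes x≈0) = trans
            (sum≈0 (λ e → trans (when-cong (old v ∈? E e) (removed≈0 e)) (when-0 (old v ∈? E e))))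
            (sym (y≈0⇒xy≈0 μ (x^1+n≈0 m x≈0)))
            where
            removed≈0 : ∀ e → old v ∈ E e → prodOver (E e - old v) x ≈ 0#
            removed≈0 e v∈ = prodOver≈0
              (x∈p∧x≢y⇒x∈p-y (new∈ G k e zero) (old≢new G k v e zero ∘ ≡.sym))
              (ends≈0⇒new≈0 (proj₂ (old∈⁻ G k v∈)) x≈0 zero)
          equation-old v (no x≉0) = multiplied⇒Equation (old v) x≉0
            (fromι (xOld≉0⇒ι (≉-resp (x-old v) x≉0)))
            where
            fromι : ∃[ i ] ι i ≡ v → sum (λ e → when (old v ∈? E e) (Q e)) ≈ μ * x (old v) ^ k
            fromι (i , ≡.refl) = edgeSum-ι i (λ z≈0 → x≉0 (trans (x-old (ι i)) (trans (xOld-ι i)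
              (x^n≈0⇒x≈0 (suc m) (trans (r^k≈zz i) (x≈0⇒xy≈0 _ z≈0))))))

          power-eigenpair : IsPowerEigenpair μ x
          power-eigenpair = x≉0 , λ i → byView (vertexView G k i)
            where
            byView : ∀ {i} → VertexView G k i → Equation i
            byView (isOld v)   = equation-old v em
            byView (isNew e j) = equation-new e j em

        powerEigenpair : Σ[ x ∈ (Fin (powerOrder G k) → Carrier) ] IsPowerEigenpair μ x
        powerEigenpair = x , power-eigenpair
          where open Assembled (λ e → edgeValues e em)

      -- For μ = 0 the indicator of a vertex of G works: each hyperedge has two zeros.
      module ZeroEigenvalue (v : Fin n) where

        x : Fin (powerOrder G k) → Carrier
        x = extend G k (λ u → when (u Fin.≟ v) 1#) (λ _ _ → 0#)

        x-old : ∀ {u} → u ≢ v → x (old u) ≈ 0#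
        x-old {u} u≢v = trans (reflexive (extend-old G k _ _ u)) (when-no (u Fin.≟ v) u≢v)

        x-new : ∀ e j → x (new e j) ≈ 0#
        x-new e j = reflexive (extend-new G k _ _ e j)

        removed≈0 : ∀ i e → prodOver (E e - i) x ≈ 0#
        removed≈0 i e with i Fin.≟ new e zero
        ... | no i≢new = prodOver≈0 (x∈p∧x≢y⇒x∈p-y (new∈ G k e zero) (i≢new ∘ ≡.sym)) (x-new e zero)
        ... | yes ≡.refl with end₁ G e Fin.≟ v
        ...   | no end₁≢v = prodOver≈0 (x∈p∧x≢y⇒x∈p-y (end₁∈ G k e) (old≢new G k _ e zero)) (x-old end₁≢v)
        ...   | yes end₁≡v = prodOver≈0 (x∈p∧x≢y⇒x∈p-y (end₂∈ G k e) (old≢new G k _ e zero))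
                  (x-old (λ end₂≡v → ends-distinct G e (≡.trans end₁≡v (≡.sym end₂≡v))))

        power-eigenpair : ∀ {μ} → μ ≈ 0# → IsPowerEigenpair μ x
        power-eigenpair μ≈0 =
          (λ x≈0 → 1≉0 (trans (sym (trans (reflexive (extend-old G k _ _ v)) (when-yes (v Fin.≟ v) ≡.refl))) (x≈0 (old v)))) ,
          (λ i → trans (sum≈0 (λ e → trans (when-cong (i ∈? E e) (λ _ → removed≈0 i e)) (when-0 (i ∈? E e))))
            (sym (x≈0⇒xy≈0 _ μ≈0)))

      -- Both directions, with the eigenvalue zero included

      power⇒subgraph : ∀ {μ x} → Fin n → IsPowerEigenpair μ x → SubgraphEigenvalue G k μ
      power⇒subgraph {μ} {x} v pair = byCase em
        where
        byCase : Dec (μ ≈ 0#) → SubgraphEigenvalue G k μ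
        byCase (no μ≉0) = _ , Γ , Γ-subgraph , Γ-reflects ∘ ℕ.+-cancelˡ-≡ 3 k-3 0 ,
          β , (z , Γ-eigenpair) , trans (x^2≈x*x β) ββ≈μ^k
          where
          β = proj₁ (squareRoot (μ ^ k))
          ββ≈μ^k = proj₂ (squareRoot (μ ^ k))
          -- Any square roots `y_v` will do: the signs of `Γ` absorb the choice.
          open Forward {μ} {x} μ≉0 pair {β} ββ≈μ^k
            (λ v → proj₁ (squareRoot (x (old v) ^ k))) (λ v → proj₂ (squareRoot (x (old v) ^ k)))
            (enumerate (λ _ → em))
        -- A single vertex without edges has the eigenvalue `0#`, and it is an induced subgraph
        -- because `G` has no loops.
        byCase (yes μ≈0) = 1 , point , point-subgraph ,
          (λ _ vv → contradiction vv (Graph.irrefl G ≡.refl)) ,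
          0# , ((λ _ → 1#) , (λ 1≈0 → 1≉0 (1≈0 zero)) ,
            λ { zero → trans (+-identityʳ _) (trans (x≈0⇒xy≈0 1# (entry-nonadjacent point {zero} {zero} id)) (sym (zeroˡ 1#))) }) ,
          trans (zeroˡ _) (sym (x^1+n≈0 (suc m) μ≈0))
          where
          point : SignedGraph 1
          point = record
            { graph    = record { Adj = λ _ _ → Empty ; adj? = λ _ _ → no id ; symm = id ; irrefl = λ _ → id }
            ; sign     = λ _ _ → Sign.+
            ; sign-sym = λ ()
            }
          point-subgraph : IsSubgraph (SignedGraph.graph point) G
          point-subgraph = record
            { ι = λ _ → v ; ι-injective = λ { {zero} {zero} _ → ≡.refl } ; preserves = λ () }

      subgraph⇒power : ∀ {μ} →
        (∀ {s} (Γ : SignedGraph s) {β y} → IsEigenpair Γ β y → RootableEigenvector k Γ β) →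
        SubgraphEigenvalue G k μ → Σ[ x ∈ (Fin (powerOrder G k) → Carrier) ] IsPowerEigenpair μ x
      subgraph⇒power {μ} rootable (s , Γ , sub , induced , β , (y , pair) , β²≈μ^k) = byCase em
        where
        -- For `μ ≈ 0#` only some vertex of `G` is wanted; a nonzero vector on the subgraph supplies
        -- one.
        vertex : ∀ {s} (f : Fin s → Fin n) {y : Fin s → Carrier} → ¬ (∀ i → y i ≈ 0#) → Fin n
        vertex {zero}  f y≉0 = contradiction (λ ()) y≉0
        vertex {suc s} f _   = f zero
        byCase : Dec (μ ≈ 0#) → Σ[ x ∈ (Fin (powerOrder G k) → Carrier) ] IsPowerEigenpair μ x
        byCase (yes μ≈0) = x , power-eigenpair μ≈0
          where open ZeroEigenvalue (vertex (IsSubgraph.ι sub) (proj₁ pair))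
        byCase (no μ≉0) = let z , z-pair , roots = rootable Γ pair in
          Backward.powerEigenpair μ≉0 Γ sub z-pair (trans (sym (x^2≈x*x β)) β²≈μ^k)
            (λ i → proj₁ (roots i)) (λ i → proj₂ (roots i)) (induced ∘ ≡.cong (3 ℕ.+_))

    module _ {n} (G : Graph n) {k} (3≤k : 3 ℕ.≤ k) {μ : Carrier} where

      edgeSum⇒subgraph : ∃[ x ] IsEdgeSumEigenpair G k μ x → SubgraphEigenvalue G k μ
      edgeSum⇒subgraph (x , pair) = byForm 3≤k pair
        where
        vertex : ∀ {n} (G : Graph n) {k x} → IsEdgeSumEigenpair G k μ x → Fin n
        -- A graph without vertices has no edges, so its power has no vertices either and carries no
        -- nonzero vector.
        vertex {zero}  G pair = contradiction (λ ()) (proj₁ pair)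
        vertex {suc n} G _    = zero
        byForm : ∀ {k x} → 3 ℕ.≤ k → IsEdgeSumEigenpair G k μ x → SubgraphEigenvalue G k μ
        byForm {suc (suc (suc l))} {x} (s≤s (s≤s (s≤s z≤n))) pair =
          Power.power⇒subgraph G l {μ} {x} (vertex G {3 ℕ.+ l} {x} pair) pair

      subgraph⇒edgeSum : (∀ k {s} (Γ : SignedGraph s) {β y} → IsEigenpair Γ β y → RootableEigenvector (suc k) Γ β) →
        SubgraphEigenvalue G k μ → ∃[ x ] IsEdgeSumEigenpair G k μ x
      subgraph⇒edgeSum rootable = byForm 3≤k
        where
        byForm : ∀ {k} → 3 ℕ.≤ k → SubgraphEigenvalue G k μ → ∃[ x ] IsEdgeSumEigenpair G k μ x
        byForm {suc (suc (suc l))} (s≤s (s≤s (s≤s z≤n))) = Power.subgraph⇒power G l (rootable (2 ℕ.+ l))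

open import Defs
open ≡ using (refl; sym; trans; cong; cong₂; subst; subst₂; module ≡-Reasoning)
open ℚ-Solver.+-*-Solver using (solve; _:+_; _:*_; _:-_; :-_; _:=_; con)

-- Real numbers

∣p-q∣≡∣q-p∣ : ∀ p q → ℚ.∣ p ℚ.- q ∣ ≡ ℚ.∣ q ℚ.- p ∣
∣p-q∣≡∣q-p∣ p q = trans (sym (ℚ.∣-p∣≡∣p∣ (p ℚ.- q)))
  (cong ℚ.∣_∣ (solve 2 (λ a b → :- (a :- b) := b :- a) refl p q))

∣p-r∣≤∣p-q∣+∣q-r∣ : ∀ p q r → ℚ.∣ p ℚ.- r ∣ ℚ.≤ ℚ.∣ p ℚ.- q ∣ ℚ.+ ℚ.∣ q ℚ.- r ∣
∣p-r∣≤∣p-q∣+∣q-r∣ p q r = subst (λ s → ℚ.∣ s ∣ ℚ.≤ ℚ.∣ p ℚ.- q ∣ ℚ.+ ℚ.∣ q ℚ.- r ∣)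
  (solve 3 (λ a b c → (a :- b) :+ (b :- c) := a :- c) refl p q r)
  (ℚ.∣p+q∣≤∣p∣+∣q∣ (p ℚ.- q) (q ℚ.- r))

triangle-< : ∀ p q r ε → ℚ.∣ p ℚ.- q ∣ ℚ.< ½ ℚ.* ε → ℚ.∣ q ℚ.- r ∣ ℚ.< ½ ℚ.* ε →
  ℚ.∣ p ℚ.- r ∣ ℚ.< ε
triangle-< p q r ε a b = ℚ.≤-<-trans (∣p-r∣≤∣p-q∣+∣q-r∣ p q r)
  (subst (ℚ.∣ p ℚ.- q ∣ ℚ.+ ℚ.∣ q ℚ.- r ∣ ℚ.<_) (half+half ε) (ℚ.+-mono-< a b))

p≤∣p∣ : ∀ p → p ℚ.≤ ℚ.∣ p ∣
p≤∣p∣ p with ℚ.≤-total 0ℚ p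
... | inj₁ 0≤p = ℚ.≤-reflexive (sym (ℚ.0≤p⇒∣p∣≡p 0≤p))
... | inj₂ p≤0 = ℚ.≤-trans p≤0 (ℚ.0≤∣p∣ p)

0≤q-p : ∀ {p q} → p ℚ.≤ q → 0ℚ ℚ.≤ q ℚ.- p
0≤q-p {p} {q} p≤q = subst (ℚ._≤ q ℚ.- p) (ℚ.+-inverseʳ p) (ℚ.+-monoˡ-≤ (ℚ.- p) p≤q)

seq≡⇒≈ℝ : ∀ {x y} → (∀ n → seq x n ≡ seq y n) → x ≈ℝ y
seq≡⇒≈ℝ {x} {y} eq ε 0<ε = 0 , λ n _ →
  subst (λ q → ℚ.∣ q ∣ ℚ.< ε)
    (sym (trans (cong (ℚ._- seq y n) (eq n)) (ℚ.+-inverseʳ (seq y n)))) 0<ε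

≈ℝ-refl : ∀ {x} → x ≈ℝ x
≈ℝ-refl {x} = seq≡⇒≈ℝ {x} {x} (λ _ → refl)

≈ℝ-sym : ∀ {x y} → x ≈ℝ y → y ≈ℝ x
≈ℝ-sym {x} {y} x≈y ε 0<ε with N , h ← x≈y ε 0<ε = N , λ n N≤n →
  subst (ℚ._< ε) (∣p-q∣≡∣q-p∣ (seq x n) (seq y n)) (h n N≤n)

≈ℝ-trans : ∀ {x y z} → x ≈ℝ y → y ≈ℝ z → x ≈ℝ z
≈ℝ-trans {x} {y} {z} x≈y y≈z ε 0<ε
  with M , f ← x≈y (½ ℚ.* ε) (half>0 0<ε)
  with N , g ← y≈z (½ ℚ.* ε) (half>0 0<ε) = M ℕ.+ N , λ n p →
    triangle-< (seq x n) (seq y n) (seq z n) ε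
      (f n (ℕ.m+n≤o⇒m≤o M p)) (g n (ℕ.m+n≤o⇒n≤o M p))

+ℝ-cong : ∀ {x y u v} → x ≈ℝ y → u ≈ℝ v → x +ℝ u ≈ℝ y +ℝ v
+ℝ-cong {x} {y} {u} {v} x≈y u≈v ε 0<ε
  with M , f ← x≈y (½ ℚ.* ε) (half>0 0<ε)
  with N , g ← u≈v (½ ℚ.* ε) (half>0 0<ε) = M ℕ.+ N , λ n p → begin-strict
    ℚ.∣ (seq x n ℚ.+ seq u n) ℚ.- (seq y n ℚ.+ seq v n) ∣
      ≡⟨ cong ℚ.∣_∣ (solve 4 (λ a b c d → (a :+ b) :- (c :+ d) := (a :- c) :+ (b :- d))
           refl (seq x n) (seq u n) (seq y n) (seq v n)) ⟩
    ℚ.∣ (seq x n ℚ.- seq y n) ℚ.+ (seq u n ℚ.- seq v n) ∣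
      ≤⟨ ℚ.∣p+q∣≤∣p∣+∣q∣ (seq x n ℚ.- seq y n) (seq u n ℚ.- seq v n) ⟩
    ℚ.∣ seq x n ℚ.- seq y n ∣ ℚ.+ ℚ.∣ seq u n ℚ.- seq v n ∣
      <⟨ ℚ.+-mono-< (f n (ℕ.m+n≤o⇒m≤o M p)) (g n (ℕ.m+n≤o⇒n≤o M p)) ⟩
    ½ ℚ.* ε ℚ.+ ½ ℚ.* ε
      ≡⟨ half+half ε ⟩
    ε ∎
  where open ℚ.≤-Reasoning

-ℝ-cong : ∀ {x y} → x ≈ℝ y → -ℝ x ≈ℝ -ℝ y
-ℝ-cong {x} {y} x≈y ε 0<ε with N , h ← x≈y ε 0<ε = N , λ n N≤n →
  subst (ℚ._< ε)
    (trans (sym (ℚ.∣-p∣≡∣p∣ (seq x n ℚ.- seq y n)))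
      (cong ℚ.∣_∣ (solve 2 (λ a b → :- (a :- b) := (:- a) :- (:- b)) refl (seq x n) (seq y n))))
    (h n N≤n)

reciprocal-*-positive : ∀ B (B>0 : Positive B) {ε} → 0ℚ ℚ.< ε → 0ℚ ℚ.< reciprocal B B>0 ℚ.* ε
reciprocal-*-positive B B>0 {ε} 0<ε = ℚ.positive⁻¹ (reciprocal B B>0 ℚ.* ε)
  {{ℚ.pos*pos⇒pos (reciprocal B B>0) {{ℚ.1/pos⇒pos B {{B>0}}}} ε {{ℚ.positive 0<ε}}}}

*ℝ-cong : ∀ {x y u v} → x ≈ℝ y → u ≈ℝ v → x *ℝ u ≈ℝ y *ℝ v
*ℝ-cong {x} {y} {u} {v} x≈y u≈v ε 0<ε =
  let B , B>0 , M₁ , bx = eventually-bounded {seq x} (cauchy x)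
      C , C>0 , M₂ , bv = eventually-bounded {seq v} (cauchy v)
      N₁ , f = u≈v (reciprocal B B>0 ℚ.* (½ ℚ.* ε)) (reciprocal-*-positive B B>0 (half>0 0<ε))
      N₂ , g = x≈y (reciprocal C C>0 ℚ.* (½ ℚ.* ε)) (reciprocal-*-positive C C>0 (half>0 0<ε))
  in (M₁ ℕ.+ M₂) ℕ.+ (N₁ ℕ.+ N₂) , λ n p →
    let p₁ = ℕ.m+n≤o⇒m≤o (M₁ ℕ.+ M₂) p
        p₂ = ℕ.m+n≤o⇒n≤o (M₁ ℕ.+ M₂) p
    in *-close (seq x n) (seq u n) (seq y n) (seq v n) B B>0 C C>0 ε
         (bx n (ℕ.m+n≤o⇒m≤o M₁ p₁)) (bv n (ℕ.m+n≤o⇒n≤o M₁ p₁))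
         (f n (ℕ.m+n≤o⇒m≤o N₁ p₂)) (g n (ℕ.m+n≤o⇒n≤o N₁ p₂))

0ℝ 1ℝ : ℝ
0ℝ = fromℚ 0ℚ
1ℝ = fromℚ 1ℚ

ℝ-commutativeRing : CommutativeRing 0ℓ 0ℓ
ℝ-commutativeRing = record
  { Carrier = ℝ
  ; _≈_ = _≈ℝ_
  ; _+_ = _+ℝ_
  ; _*_ = _*ℝ_
  ; -_ = -ℝ_
  ; 0# = 0ℝ
  ; 1# = 1ℝ
  ; isCommutativeRing = record
    { isRing = record
      { +-isAbelianGroup = record
        { isGroup = record
          { isMonoid = record
            { isSemigroup = record
              { isMagma = record
                { isEquivalence = record
                  { refl = λ {x} → ≈ℝ-refl {x}
                  ; sym = λ {x} {y} → ≈ℝ-sym {x} {y}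
                  ; trans = λ {x} {y} {z} → ≈ℝ-trans {x} {y} {z}
                  }
                ; ∙-cong = λ {x} {y} {u} {v} → +ℝ-cong {x} {y} {u} {v}
                }
              ; assoc = λ x y z → seq≡⇒≈ℝ {(x +ℝ y) +ℝ z} {x +ℝ (y +ℝ z)}
                  (λ n → ℚ.+-assoc (seq x n) (seq y n) (seq z n))
              }
            ; identity = (λ x → seq≡⇒≈ℝ {0ℝ +ℝ x} {x} (ℚ.+-identityˡ ∘ seq x))
                       , (λ x → seq≡⇒≈ℝ {x +ℝ 0ℝ} {x} (ℚ.+-identityʳ ∘ seq x))
            }
          ; inverse = (λ x → seq≡⇒≈ℝ {(-ℝ x) +ℝ x} {0ℝ} (ℚ.+-inverseˡ ∘ seq x))
                    , (λ x → seq≡⇒≈ℝ {x +ℝ (-ℝ x)} {0ℝ} (ℚ.+-inverseʳ ∘ seq x))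
          ; ⁻¹-cong = λ {x} {y} → -ℝ-cong {x} {y}
          }
        ; comm = λ x y → seq≡⇒≈ℝ {x +ℝ y} {y +ℝ x} (λ n → ℚ.+-comm (seq x n) (seq y n))
        }
      ; *-cong = λ {x} {y} {u} {v} → *ℝ-cong {x} {y} {u} {v}
      ; *-assoc = λ x y z → seq≡⇒≈ℝ {(x *ℝ y) *ℝ z} {x *ℝ (y *ℝ z)}
          (λ n → ℚ.*-assoc (seq x n) (seq y n) (seq z n))
      ; *-identity = (λ x → seq≡⇒≈ℝ {1ℝ *ℝ x} {x} (ℚ.*-identityˡ ∘ seq x))
                   , (λ x → seq≡⇒≈ℝ {x *ℝ 1ℝ} {x} (ℚ.*-identityʳ ∘ seq x))
      ; distrib = (λ x y z → seq≡⇒≈ℝ {x *ℝ (y +ℝ z)} {x *ℝ y +ℝ x *ℝ z}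
                     (λ n → ℚ.*-distribˡ-+ (seq x n) (seq y n) (seq z n)))
                , (λ x y z → seq≡⇒≈ℝ {(y +ℝ z) *ℝ x} {y *ℝ x +ℝ z *ℝ x}
                     (λ n → ℚ.*-distribʳ-+ (seq x n) (seq y n) (seq z n)))
      }
    ; *-comm = λ x y → seq≡⇒≈ℝ {x *ℝ y} {y *ℝ x} (λ n → ℚ.*-comm (seq x n) (seq y n))
    }
  }

-- A property of the representative: it is not invariant under _≈ℝ_.
NonNegℝ : ℝ → Set
NonNegℝ x = ∀ n → 0ℚ ℚ.≤ seq x n

nonNeg-sum≈0 : ∀ {x y} → NonNegℝ x → NonNegℝ y → x +ℝ y ≈ℝ 0ℝ → x ≈ℝ 0ℝ
nonNeg-sum≈0 {x} {y} 0≤x 0≤y x+y≈0 ε 0<ε with N , h ← x+y≈0 ε 0<ε = N , λ n N≤n → begin-strict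
  ℚ.∣ seq x n ℚ.- 0ℚ ∣               ≡⟨ ∣a-0∣≡a (0≤x n) ⟩
  seq x n                            ≡⟨ ℚ.+-identityʳ (seq x n) ⟨
  seq x n ℚ.+ 0ℚ                     ≤⟨ ℚ.+-monoʳ-≤ (seq x n) (0≤y n) ⟩
  seq x n ℚ.+ seq y n                ≡⟨ ∣a-0∣≡a (ℚ.+-mono-≤ (0≤x n) (0≤y n)) ⟨
  ℚ.∣ (seq x n ℚ.+ seq y n) ℚ.- 0ℚ ∣ <⟨ h n N≤n ⟩
  ε                                  ∎
  where
  open ℚ.≤-Reasoning
  ∣a-0∣≡a : ∀ {a} → 0ℚ ℚ.≤ a → ℚ.∣ a ℚ.- 0ℚ ∣ ≡ a
  ∣a-0∣≡a {a} 0≤a = trans (cong ℚ.∣_∣ (ℚ.+-identityʳ a)) (ℚ.0≤p⇒∣p∣≡p 0≤a)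

∣p∣-∣q∣≤∣p-q∣ : ∀ p q → ℚ.∣ p ∣ ℚ.- ℚ.∣ q ∣ ℚ.≤ ℚ.∣ p ℚ.- q ∣
∣p∣-∣q∣≤∣p-q∣ p q = begin
  ℚ.∣ p ∣ ℚ.- ℚ.∣ q ∣
    ≡⟨ cong (λ r → ℚ.∣ r ∣ ℚ.- ℚ.∣ q ∣) (solve 2 (λ a b → a := (a :- b) :+ b) refl p q) ⟩
  ℚ.∣ (p ℚ.- q) ℚ.+ q ∣ ℚ.- ℚ.∣ q ∣
    ≤⟨ ℚ.+-monoˡ-≤ (ℚ.- ℚ.∣ q ∣) (ℚ.∣p+q∣≤∣p∣+∣q∣ (p ℚ.- q) q) ⟩
  (ℚ.∣ p ℚ.- q ∣ ℚ.+ ℚ.∣ q ∣) ℚ.- ℚ.∣ q ∣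
    ≡⟨ solve 2 (λ a b → (a :+ b) :- b := a) refl ℚ.∣ p ℚ.- q ∣ ℚ.∣ q ∣ ⟩
  ℚ.∣ p ℚ.- q ∣ ∎
  where open ℚ.≤-Reasoning

∣∣p∣-∣q∣∣≤∣p-q∣ : ∀ p q → ℚ.∣ ℚ.∣ p ∣ ℚ.- ℚ.∣ q ∣ ∣ ℚ.≤ ℚ.∣ p ℚ.- q ∣
∣∣p∣-∣q∣∣≤∣p-q∣ p q with ℚ.∣p∣≡p∨∣p∣≡-p (ℚ.∣ p ∣ ℚ.- ℚ.∣ q ∣)
... | inj₁ eq = subst (ℚ._≤ ℚ.∣ p ℚ.- q ∣) (sym eq) (∣p∣-∣q∣≤∣p-q∣ p q)
... | inj₂ eq = subst₂ ℚ._≤_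
    (trans (solve 2 (λ a b → b :- a := :- (a :- b)) refl ℚ.∣ p ∣ ℚ.∣ q ∣) (sym eq))
    (∣p-q∣≡∣q-p∣ q p) (∣p∣-∣q∣≤∣p-q∣ q p)

0≤p*p : ∀ p → 0ℚ ℚ.≤ p ℚ.* p
0≤p*p p = subst (0ℚ ℚ.≤_) (∣p∣*∣p∣≡p*p (ℚ.∣p∣≡p∨∣p∣≡-p p))
  (ℚ.nonNegative⁻¹ (ℚ.∣ p ∣ ℚ.* ℚ.∣ p ∣)
    {{ℚ.nonNeg*nonNeg⇒nonNeg ℚ.∣ p ∣ {{ℚ.∣-∣-nonNeg p}} ℚ.∣ p ∣ {{ℚ.∣-∣-nonNeg p}}}})
  where
  ∣p∣*∣p∣≡p*p : ℚ.∣ p ∣ ≡ p ⊎ ℚ.∣ p ∣ ≡ ℚ.- p → ℚ.∣ p ∣ ℚ.* ℚ.∣ p ∣ ≡ p ℚ.* p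
  ∣p∣*∣p∣≡p*p (inj₁ eq) = cong₂ ℚ._*_ eq eq
  ∣p∣*∣p∣≡p*p (inj₂ eq) = trans (cong₂ ℚ._*_ eq eq) (solve 1 (λ a → :- a :* :- a := a :* a) refl p)

∣_∣ℝ : ℝ → ℝ
∣ x ∣ℝ = mkℝ (λ n → ℚ.∣ seq x n ∣) λ ε 0<ε → let N , h = cauchy x ε 0<ε in
  N , λ m n p q → ℚ.≤-<-trans (∣∣p∣-∣q∣∣≤∣p-q∣ (seq x m) (seq x n)) (h m n p q)

∣x∣*∣x∣≈x*x : ∀ x → ∣ x ∣ℝ *ℝ ∣ x ∣ℝ ≈ℝ x *ℝ x
∣x∣*∣x∣≈x*x x = seq≡⇒≈ℝ {∣ x ∣ℝ *ℝ ∣ x ∣ℝ} {x *ℝ x} λ n →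
  trans (sym (ℚ.∣p*q∣≡∣p∣*∣q∣ (seq x n) (seq x n))) (ℚ.0≤p⇒∣p∣≡p (0≤p*p (seq x n)))

-- A Cauchy sequence with nonzero limit may still have zero terms early on; they get the filler
-- `0ℚ`.
inverseOr0 : ℚ → ℚ
inverseOr0 p with p ℚ.≟ 0ℚ
... | yes _  = 0ℚ
... | no p≢0 = (ℚ.1/ p) {{ℚ.≢-nonZero p≢0}}

inverseOr0-inverseʳ : ∀ p → p ≢ 0ℚ → p ℚ.* inverseOr0 p ≡ 1ℚ
inverseOr0-inverseʳ p p≢0 with p ℚ.≟ 0ℚ
... | yes p≡0 = contradiction p≡0 p≢0
... | no p≢0′ = ℚ.*-inverseʳ p {{ℚ.≢-nonZero p≢0′}}

0<δ≤∣p∣⇒p≢0 : ∀ {δ p} → 0ℚ ℚ.< δ → δ ℚ.≤ ℚ.∣ p ∣ → p ≢ 0ℚ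
0<δ≤∣p∣⇒p≢0 0<δ δ≤∣p∣ refl = ℚ.<-irrefl refl (ℚ.<-≤-trans 0<δ δ≤∣p∣)

∣inverseOr0∣≤ : ∀ δ (δ>0 : Positive δ) p → δ ℚ.≤ ℚ.∣ p ∣ → ℚ.∣ inverseOr0 p ∣ ℚ.≤ reciprocal δ δ>0
∣inverseOr0∣≤ δ δ>0 p δ≤∣p∣ = ℚ.*-cancelˡ-≤-pos δ {{δ>0}} (begin
  δ ℚ.* ℚ.∣ q ∣          ≤⟨ ℚ.*-monoʳ-≤-nonNeg ℚ.∣ q ∣ {{ℚ.∣-∣-nonNeg q}} δ≤∣p∣ ⟩
  ℚ.∣ p ∣ ℚ.* ℚ.∣ q ∣    ≡⟨ ℚ.∣p*q∣≡∣p∣*∣q∣ p q ⟨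
  ℚ.∣ p ℚ.* q ∣          ≡⟨ cong ℚ.∣_∣ (inverseOr0-inverseʳ p (0<δ≤∣p∣⇒p≢0 (ℚ.positive⁻¹ δ {{δ>0}}) δ≤∣p∣)) ⟩
  1ℚ                     ≡⟨ ℚ.*-inverseʳ δ {{ℚ.pos⇒nonZero δ {{δ>0}}}} ⟨
  δ ℚ.* reciprocal δ δ>0 ∎)
  where
  open ℚ.≤-Reasoning
  q = inverseOr0 p

inverse-difference : ∀ p q → p ≢ 0ℚ → q ≢ 0ℚ →
  inverseOr0 p ℚ.- inverseOr0 q ≡ inverseOr0 p ℚ.* (inverseOr0 q ℚ.* (q ℚ.- p))
inverse-difference p q p≢0 q≢0 = begin
  p′ ℚ.- q′
    ≡⟨ solve 2 (λ a b → a :- b := con 1ℚ :* a :- con 1ℚ :* b) refl p′ q′ ⟩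
  1ℚ ℚ.* p′ ℚ.- 1ℚ ℚ.* q′
    ≡⟨ cong₂ (λ a b → a ℚ.* p′ ℚ.- b ℚ.* q′) (inverseOr0-inverseʳ q q≢0) (inverseOr0-inverseʳ p p≢0) ⟨
  (q ℚ.* q′) ℚ.* p′ ℚ.- (p ℚ.* p′) ℚ.* q′
    ≡⟨ solve 4 (λ a a′ b b′ → (b :* b′) :* a′ :- (a :* a′) :* b′ := a′ :* (b′ :* (b :- a))) refl p p′ q q′ ⟩
  p′ ℚ.* (q′ ℚ.* (q ℚ.- p)) ∎
  where
  open ≡-Reasoning
  p′ = inverseOr0 p
  q′ = inverseOr0 q

-- Past `N` both inverses are bounded by `R`, the reciprocal of `δ`. By `inverse-difference` it is
-- enough that the terms themselves differ by less than `ε` divided twice by `R`.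
inverse-cauchy : ∀ {x} → IsCauchy x → ∀ δ (δ>0 : Positive δ) N →
  (∀ n → N ℕ.≤ n → δ ℚ.≤ ℚ.∣ x n ∣) → IsCauchy (inverseOr0 ∘ x)
inverse-cauchy {x} cx δ δ>0 N δ≤ ε 0<ε =
  let R = reciprocal δ δ>0
      R>0 = ℚ.1/pos⇒pos δ {{δ>0}}
      M , h = cx (reciprocal R R>0 ℚ.* (reciprocal R R>0 ℚ.* ε))
        (reciprocal-*-positive R R>0 (reciprocal-*-positive R R>0 0<ε))
  in M ℕ.+ N , λ m n p q →
    let N≤m = ℕ.m+n≤o⇒n≤o M p
        N≤n = ℕ.m+n≤o⇒n≤o M q
        ≢0 : ∀ {i} → N ℕ.≤ i → x i ≢ 0ℚ
        ≢0 N≤i = 0<δ≤∣p∣⇒p≢0 (ℚ.positive⁻¹ δ {{δ>0}}) (δ≤ _ N≤i)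
    in subst (λ a → ℚ.∣ a ∣ ℚ.< ε) (sym (inverse-difference (x m) (x n) (≢0 N≤m) (≢0 N≤n)))
      (bounded-*-small (inverseOr0 (x m)) (inverseOr0 (x n) ℚ.* (x n ℚ.- x m)) R R>0 ε
        (∣inverseOr0∣≤ δ δ>0 (x m) (δ≤ m N≤m))
        (bounded-*-small (inverseOr0 (x n)) (x n ℚ.- x m) R R>0 (reciprocal R R>0 ℚ.* ε)
          (∣inverseOr0∣≤ δ δ>0 (x n) (δ≤ n N≤n))
          (h n m (ℕ.m+n≤o⇒m≤o M q) (ℕ.m+n≤o⇒m≤o M p))))

BoundedAwayFrom0 : ℝ → Set
BoundedAwayFrom0 x = ∃[ δ ] Positive δ × ∃[ N ] (∀ n → N ℕ.≤ n → δ ℚ.≤ ℚ.∣ seq x n ∣)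

-- If ε ≤ ∣xₙ∣ for a single n beyond the Cauchy modulus of ½ε, then ½ε ≤ ∣xₘ∣ for all such m.
¬bounded⇒≈0 : ∀ x → ¬ BoundedAwayFrom0 x → x ≈ℝ 0ℝ
¬bounded⇒≈0 x ¬b ε 0<ε with N , h ← cauchy x (½ ℚ.* ε) (half>0 0<ε) = N , λ n N≤n →
  subst (λ a → ℚ.∣ a ∣ ℚ.< ε) (sym (ℚ.+-identityʳ (seq x n))) (small n N≤n)
  where
  small : ∀ n → N ℕ.≤ n → ℚ.∣ seq x n ∣ ℚ.< ε
  small n N≤n with ℚ.∣ seq x n ∣ ℚ.<? ε
  ... | yes <ε = <ε
  ... | no ≮ε = contradiction (½ ℚ.* ε , ℚ.positive (half>0 0<ε) , N , large) ¬b
    where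
    open ℚ.≤-Reasoning
    large : ∀ m → N ℕ.≤ m → ½ ℚ.* ε ℚ.≤ ℚ.∣ seq x m ∣
    large m N≤m = begin
      ½ ℚ.* ε
        ≡⟨ solve 1 (λ a → a := (a :+ a) :- a) refl (½ ℚ.* ε) ⟩
      (½ ℚ.* ε ℚ.+ ½ ℚ.* ε) ℚ.- ½ ℚ.* ε
        ≡⟨ cong (ℚ._- ½ ℚ.* ε) (half+half ε) ⟩
      ε ℚ.- ½ ℚ.* ε
        ≤⟨ ℚ.+-mono-≤ (ℚ.≮⇒≥ ≮ε) (ℚ.neg-antimono-≤ (ℚ.<⇒≤ (h n m N≤n N≤m))) ⟩
      ℚ.∣ seq x n ∣ ℚ.- ℚ.∣ seq x n ℚ.- seq x m ∣
        ≤⟨ ℚ.+-monoʳ-≤ ℚ.∣ seq x n ∣ (ℚ.neg-antimono-≤ (∣p∣-∣q∣≤∣p-q∣ (seq x n) (seq x m))) ⟩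
      ℚ.∣ seq x n ∣ ℚ.- (ℚ.∣ seq x n ∣ ℚ.- ℚ.∣ seq x m ∣)
        ≡⟨ solve 2 (λ a b → a :- (a :- b) := b) refl ℚ.∣ seq x n ∣ ℚ.∣ seq x m ∣ ⟩
      ℚ.∣ seq x m ∣ ∎

-- The modulus of the inverse needs a lower bound `δ`, which the bare negation does not exhibit.
-- Excluded middle produces it through `¬bounded⇒≈0`.
ℝ-inverse : ExcludedMiddle 0ℓ → ∀ x → ¬ x ≈ℝ 0ℝ → Σ[ y ∈ ℝ ] x *ℝ y ≈ℝ 1ℝ
ℝ-inverse em x x≉0 with em {BoundedAwayFrom0 x}
... | no ¬b = contradiction (¬bounded⇒≈0 x ¬b) x≉0
... | yes (δ , δ>0 , N , δ≤) = mkℝ (inverseOr0 ∘ seq x) (inverse-cauchy (cauchy x) δ δ>0 N δ≤) ,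
  λ ε 0<ε → N , λ n N≤n → subst (λ a → ℚ.∣ a ℚ.- 1ℚ ∣ ℚ.< ε)
    (sym (inverseOr0-inverseʳ (seq x n) (0<δ≤∣p∣⇒p≢0 (ℚ.positive⁻¹ δ {{δ>0}}) (δ≤ n N≤n)))) 0<ε

open Exp (CommutativeRing.commutativeSemiring ℚ.+-*-commutativeRing) using () renaming (_^_ to _^ℚ_)
open Exp (CommutativeRing.commutativeSemiring ℝ-commutativeRing) using () renaming (_^_ to _^ℝ_; ^-congˡ to ^ℝ-congˡ)

-- Roots of nonnegative real numbers

fromℕ : ℕ → ℚ
fromℕ n = mkℚ (+ n) 0 (Coprime.sym (Coprime.1-coprimeTo n))

fromℕ-suc : ∀ n → fromℕ (suc n) ≡ fromℕ n ℚ.+ 1ℚ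
fromℕ-suc n = ℚ.toℚᵘ-injective (ℚᵘ.≃-trans
  (ℚᵘ.*≡* (ℤ-solve 1 (λ a → (con′ (+ 1) :+′ a) :*′ (con′ (+ 1))
     :=′ (a :*′ con′ (+ 1) :+′ con′ (+ 1)) :*′ con′ (+ 1)) refl (+ n)))
  (ℚᵘ.≃-sym (ℚ.toℚᵘ-homo-+ (fromℕ n) 1ℚ)))
  where open ℤ-Solver.+-*-Solver using ()
          renaming (solve to ℤ-solve; con to con′; _:+_ to _:+′_; _:*_ to _:*′_; _:=_ to _:=′_)

fromℕ-mono : ∀ {m n} → m ℕ.≤ n → fromℕ m ℚ.≤ fromℕ n
fromℕ-mono {m} {n} m≤n = ℚ.*≤* (ℤ.*-monoʳ-≤-nonNeg (+ 1) (ℤ.+≤+ m≤n))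

archimedean : ∀ q → ∃[ n ] (q ℚ.< fromℕ n)
archimedean (mkℚ (+ m) d _) = suc m , ℚ.*<* (subst₂ ℤ._<_ (sym (ℤ.*-identityʳ (+ m))) (ℤ.pos-* (suc m) (suc d))
  (ℤ.+<+ (ℕ.m≤m*n (suc m) (suc d))))
archimedean q@(mkℚ -[1+ m ] d _) = 1 , ℚ.negative⁻¹ q <1
  where
  _<1 : ∀ {p} → p ℚ.< 0ℚ → p ℚ.< fromℕ 1
  p<0 <1 = ℚ.<-trans p<0 (ℚ.positive⁻¹ 1ℚ)

gridStep : ℕ → ℚ
gridStep n = reciprocal (fromℕ (suc n)) _

gridStep>0 : ∀ n → 0ℚ ℚ.< gridStep n
gridStep>0 n = ℚ.positive⁻¹ (gridStep n) {{ℚ.1/pos⇒pos (fromℕ (suc n))}}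

gridStep→0 : ∀ ε → 0ℚ ℚ.< ε → ∃[ N ] (∀ n → N ℕ.≤ n → gridStep n ℚ.< ε)
gridStep→0 ε 0<ε with N , h ← archimedean ((ℚ.1/ ε) {{ℚ.pos⇒nonZero ε {{ℚ.positive 0<ε}}}}) =
  N , λ n N≤n → ℚ.*-cancelˡ-<-nonNeg (fromℕ (suc n)) (begin-strict
    fromℕ (suc n) ℚ.* gridStep n ≡⟨ ℚ.*-inverseʳ (fromℕ (suc n)) ⟩
    1ℚ                          ≡⟨ ℚ.*-inverseˡ ε ⟨
    ℚ.1/ ε ℚ.* ε                <⟨ ℚ.*-monoˡ-<-pos ε {{ε>0}} h ⟩
    fromℕ N ℚ.* ε               ≤⟨ ℚ.*-monoʳ-≤-nonNeg ε {{ℚ.pos⇒nonNeg ε {{ε>0}}}} (fromℕ-mono (ℕ.m≤n⇒m≤1+n N≤n)) ⟩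
    fromℕ (suc n) ℚ.* ε         ∎)
  where
  open ℚ.≤-Reasoning
  instance
    ε>0 : Positive ε
    ε>0 = ℚ.positive 0<ε
    ε≢0 : ℚ.NonZero ε
    ε≢0 = ℚ.pos⇒nonZero ε

0≤*0≤ : ∀ {p q} → 0ℚ ℚ.≤ p → 0ℚ ℚ.≤ q → 0ℚ ℚ.≤ p ℚ.* q
0≤*0≤ {p} {q} 0≤p 0≤q = ℚ.nonNegative⁻¹ (p ℚ.* q)
  {{ℚ.nonNeg*nonNeg⇒nonNeg p {{ℚ.nonNegative 0≤p}} q {{ℚ.nonNegative 0≤q}}}}

*-mono-0≤ : ∀ {p q r s} → 0ℚ ℚ.≤ p → p ℚ.≤ q → 0ℚ ℚ.≤ r → r ℚ.≤ s → p ℚ.* r ℚ.≤ q ℚ.* s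
*-mono-0≤ {p} {q} {r} {s} 0≤p p≤q 0≤r r≤s = ℚ.≤-trans
  (ℚ.*-monoʳ-≤-nonNeg r {{ℚ.nonNegative 0≤r}} p≤q)
  (ℚ.*-monoˡ-≤-nonNeg q {{ℚ.nonNegative (ℚ.≤-trans 0≤p p≤q)}} r≤s)

^ℚ-nonNeg : ∀ {p} k → 0ℚ ℚ.≤ p → 0ℚ ℚ.≤ p ^ℚ k
^ℚ-nonNeg zero    0≤p = ℚ.nonNegative⁻¹ 1ℚ
^ℚ-nonNeg (suc k) 0≤p = 0≤*0≤ 0≤p (^ℚ-nonNeg k 0≤p)

^ℚ-pos : ∀ {p} k → 0ℚ ℚ.< p → 0ℚ ℚ.< p ^ℚ k
^ℚ-pos     zero    0<p = ℚ.positive⁻¹ 1ℚ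
^ℚ-pos {p} (suc k) 0<p = ℚ.positive⁻¹ (p ℚ.* p ^ℚ k)
  {{ℚ.pos*pos⇒pos p {{ℚ.positive 0<p}} (p ^ℚ k) {{ℚ.positive (^ℚ-pos k 0<p)}}}}

^ℚ-mono : ∀ {p q} k → 0ℚ ℚ.≤ p → p ℚ.≤ q → p ^ℚ k ℚ.≤ q ^ℚ k
^ℚ-mono zero    0≤p p≤q = ℚ.≤-refl
^ℚ-mono (suc k) 0≤p p≤q = *-mono-0≤ 0≤p p≤q (^ℚ-nonNeg k 0≤p) (^ℚ-mono k 0≤p p≤q)

-- The cross terms of the power are non-negative. It turns a gap between two roots into a gap
-- between their powers, and so controls how much roots can vary.
^ℚ-superadditive : ∀ {p q} k → 0ℚ ℚ.≤ p → 0ℚ ℚ.≤ q →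
  p ^ℚ suc k ℚ.+ q ^ℚ suc k ℚ.≤ (p ℚ.+ q) ^ℚ suc k
^ℚ-superadditive {p} {q} zero    0≤p 0≤q = ℚ.≤-reflexive (sym (ℚ.*-distribʳ-+ 1ℚ p q))
^ℚ-superadditive {p} {q} (suc k) 0≤p 0≤q = begin
  p ℚ.* p ^ℚ suc k ℚ.+ q ℚ.* q ^ℚ suc k
    ≤⟨ ℚ.+-mono-≤
         (*-mono-0≤ 0≤p (p≤p+q p 0≤q) (^ℚ-nonNeg (suc k) 0≤p) ℚ.≤-refl)
         (*-mono-0≤ 0≤q (q≤p+q q 0≤p) (^ℚ-nonNeg (suc k) 0≤q) ℚ.≤-refl) ⟩
  (p ℚ.+ q) ℚ.* p ^ℚ suc k ℚ.+ (p ℚ.+ q) ℚ.* q ^ℚ suc k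
    ≡⟨ ℚ.*-distribˡ-+ (p ℚ.+ q) (p ^ℚ suc k) (q ^ℚ suc k) ⟨
  (p ℚ.+ q) ℚ.* (p ^ℚ suc k ℚ.+ q ^ℚ suc k)
    ≤⟨ *-mono-0≤ 0≤p+q ℚ.≤-refl
         (ℚ.+-mono-≤ (^ℚ-nonNeg (suc k) 0≤p) (^ℚ-nonNeg (suc k) 0≤q)) (^ℚ-superadditive k 0≤p 0≤q) ⟩
  (p ℚ.+ q) ℚ.* (p ℚ.+ q) ^ℚ suc k ∎
  where
  open ℚ.≤-Reasoning
  p≤p+q : ∀ p {q} → 0ℚ ℚ.≤ q → p ℚ.≤ p ℚ.+ q
  p≤p+q p {q} 0≤q = subst (ℚ._≤ p ℚ.+ q) (ℚ.+-identityʳ p) (ℚ.+-monoʳ-≤ p 0≤q)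
  q≤p+q : ∀ q {p} → 0ℚ ℚ.≤ p → q ℚ.≤ p ℚ.+ q
  q≤p+q q {p} 0≤p = subst (ℚ._≤ p ℚ.+ q) (ℚ.+-identityˡ q) (ℚ.+-monoˡ-≤ q 0≤p)
  0≤p+q = ℚ.+-mono-≤ 0≤p 0≤q

1≤⇒≤^ℚsuc : ∀ {p} k → 1ℚ ℚ.≤ p → p ℚ.≤ p ^ℚ suc k
1≤⇒≤^ℚsuc {p} k 1≤p = subst (ℚ._≤ p ^ℚ suc k) (ℚ.*-identityʳ p)
  (*-mono-0≤ 0≤p ℚ.≤-refl (ℚ.nonNegative⁻¹ 1ℚ) (1≤^ k))
  where
  0≤p = ℚ.≤-trans (ℚ.nonNegative⁻¹ 1ℚ) 1≤p
  1≤^ : ∀ k → 1ℚ ℚ.≤ p ^ℚ k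
  1≤^ zero    = ℚ.≤-refl
  1≤^ (suc k) = subst (ℚ._≤ p ^ℚ suc k) (ℚ.*-identityʳ 1ℚ)
    (*-mono-0≤ (ℚ.nonNegative⁻¹ 1ℚ) 1≤p (ℚ.nonNegative⁻¹ 1ℚ) (1≤^ k))

≤ℚ⇒≯ : ∀ {p q} → p ℚ.≤ q → ¬ q ℚ.< p
≤ℚ⇒≯ p≤q q<p = ℚ.<-irrefl refl (ℚ.≤-<-trans p≤q q<p)

IsGridRoot : ℕ → ℚ → ℚ → ℚ → Set
IsGridRoot k δ a r = 0ℚ ℚ.≤ r × r ^ℚ k ℚ.≤ a × a ℚ.< (r ℚ.+ δ) ^ℚ k

-- Walks down the multiples of `δ` to the first one whose power is at most `a`. As the exponent is
-- positive, the power at zero is zero, and the walk stops there at the latest.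
gridSearch : ∀ k {δ a} → 0ℚ ℚ.≤ δ → 0ℚ ℚ.≤ a → ∀ j → a ℚ.< (fromℕ j ℚ.* δ) ^ℚ suc k →
  ∃[ r ] IsGridRoot (suc k) δ a r
gridSearch k {δ} {a} 0≤δ 0≤a zero a<0 = contradiction
  (subst (a ℚ.<_) (trans (cong (λ p → p ℚ.* p ^ℚ k) (ℚ.*-zeroˡ δ)) (ℚ.*-zeroˡ (0ℚ ^ℚ k))) a<0)
  (≤ℚ⇒≯ 0≤a)
gridSearch k {δ} {a} 0≤δ 0≤a (suc j) a< with (fromℕ j ℚ.* δ) ^ℚ suc k ℚ.≤? a
... | yes ≤a = fromℕ j ℚ.* δ , 0≤*0≤ (ℚ.nonNegative⁻¹ (fromℕ j)) 0≤δ , ≤a ,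
  subst (λ p → a ℚ.< p ^ℚ suc k)
    (trans (cong (ℚ._* δ) (fromℕ-suc j))
      (solve 2 (λ b d → (b :+ con 1ℚ) :* d := b :* d :+ d) refl (fromℕ j) δ)) a<
... | no ≰a = gridSearch k 0≤δ 0≤a j (ℚ.≰⇒> ≰a)

-- The search starts beyond `1 + a` rather than `a`: a number that is at least one does not exceed
-- its positive powers.
gridRoot : ∀ k n {a} → 0ℚ ℚ.≤ a → ∃[ r ] IsGridRoot (suc k) (gridStep n) a r
gridRoot k n {a} 0≤a with j , h ← archimedean ((1ℚ ℚ.+ a) ℚ.* fromℕ (suc n)) =
  gridSearch k (ℚ.<⇒≤ (gridStep>0 n)) 0≤a j (begin-strict
    a                                ≡⟨ ℚ.+-identityˡ a ⟨
    0ℚ ℚ.+ a                         <⟨ ℚ.+-monoˡ-< a (ℚ.positive⁻¹ 1ℚ) ⟩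
    1ℚ ℚ.+ a                         ≤⟨ ℚ.<⇒≤ 1+a< ⟩
    fromℕ j ℚ.* gridStep n           ≤⟨ 1≤⇒≤^ℚsuc k (ℚ.≤-trans 1≤1+a (ℚ.<⇒≤ 1+a<)) ⟩
    (fromℕ j ℚ.* gridStep n) ^ℚ suc k ∎)
  where
  open ℚ.≤-Reasoning
  1≤1+a : 1ℚ ℚ.≤ 1ℚ ℚ.+ a
  1≤1+a = subst (ℚ._≤ 1ℚ ℚ.+ a) (ℚ.+-identityʳ 1ℚ) (ℚ.+-monoʳ-≤ 1ℚ 0≤a)
  1+a< : 1ℚ ℚ.+ a ℚ.< fromℕ j ℚ.* gridStep n
  1+a< = begin-strict
    1ℚ ℚ.+ a
      ≡⟨ ℚ.*-identityʳ (1ℚ ℚ.+ a) ⟨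
    (1ℚ ℚ.+ a) ℚ.* 1ℚ
      ≡⟨ cong ((1ℚ ℚ.+ a) ℚ.*_) (ℚ.*-inverseʳ (fromℕ (suc n))) ⟨
    (1ℚ ℚ.+ a) ℚ.* (fromℕ (suc n) ℚ.* gridStep n)
      ≡⟨ ℚ.*-assoc (1ℚ ℚ.+ a) (fromℕ (suc n)) (gridStep n) ⟨
    ((1ℚ ℚ.+ a) ℚ.* fromℕ (suc n)) ℚ.* gridStep n
      <⟨ ℚ.*-monoˡ-<-pos (gridStep n) {{ℚ.positive (gridStep>0 n)}} h ⟩
    fromℕ j ℚ.* gridStep n ∎

-- If `r` exceeded `s` by `ε` or more, a further `½ ε` would fit between `s + δ` and `r`, and
-- superadditivity would put `a` above `b` by at least the power of `½ ε`.
gridRoots-close : ∀ k {δ a b r s} ε → 0ℚ ℚ.< ε → 0ℚ ℚ.≤ δ → δ ℚ.< ½ ℚ.* ε →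
  ℚ.∣ a ℚ.- b ∣ ℚ.< (½ ℚ.* ε) ^ℚ suc k →
  0ℚ ℚ.≤ r → r ^ℚ suc k ℚ.≤ a → 0ℚ ℚ.≤ s → b ℚ.< (s ℚ.+ δ) ^ℚ suc k → r ℚ.- s ℚ.< ε
gridRoots-close k {δ} {a} {b} {r} {s} ε 0<ε 0≤δ δ< a-b< 0≤r r^k≤a 0≤s b< with r ℚ.- s ℚ.<? ε
... | yes r-s<ε = r-s<ε
... | no r-s≮ε = contradiction a-b< (≤ℚ⇒≯ (begin
  h ^ℚ suc k
    ≡⟨ solve 2 (λ b h → h := (b :+ h) :- b) refl b (h ^ℚ suc k) ⟩
  (b ℚ.+ h ^ℚ suc k) ℚ.- b
    ≤⟨ ℚ.+-monoˡ-≤ (ℚ.- b) (begin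
         b ℚ.+ h ^ℚ suc k
           ≤⟨ ℚ.+-monoˡ-≤ (h ^ℚ suc k) (ℚ.<⇒≤ b<) ⟩
         (s ℚ.+ δ) ^ℚ suc k ℚ.+ h ^ℚ suc k
           ≤⟨ ^ℚ-superadditive k (ℚ.+-mono-≤ 0≤s 0≤δ) (ℚ.<⇒≤ 0<h) ⟩
         (s ℚ.+ δ ℚ.+ h) ^ℚ suc k
           ≤⟨ ^ℚ-mono (suc k) (ℚ.+-mono-≤ (ℚ.+-mono-≤ 0≤s 0≤δ) (ℚ.<⇒≤ 0<h)) s+δ+h≤r ⟩
         r ^ℚ suc k
           ≤⟨ r^k≤a ⟩
         a ∎) ⟩
  a ℚ.- b
    ≤⟨ p≤∣p∣ (a ℚ.- b) ⟩
  ℚ.∣ a ℚ.- b ∣ ∎))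
  where
  open ℚ.≤-Reasoning
  h = ½ ℚ.* ε
  0<h = half>0 0<ε
  s+δ+h≤r : s ℚ.+ δ ℚ.+ h ℚ.≤ r
  s+δ+h≤r = begin
    s ℚ.+ δ ℚ.+ h     ≤⟨ ℚ.+-monoˡ-≤ h (ℚ.+-monoʳ-≤ s (ℚ.<⇒≤ δ<)) ⟩
    s ℚ.+ h ℚ.+ h     ≡⟨ ℚ.+-assoc s h h ⟩
    s ℚ.+ (h ℚ.+ h)   ≡⟨ cong (s ℚ.+_) (half+half ε) ⟩
    s ℚ.+ ε           ≤⟨ ℚ.+-monoʳ-≤ s (ℚ.≮⇒≥ r-s≮ε) ⟩
    s ℚ.+ (r ℚ.- s)   ≡⟨ solve 2 (λ s r → s :+ (r :- s) := r) refl s r ⟩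
    r                 ∎

∣p∣<-intro : ∀ {p q} → p ℚ.< q → ℚ.- p ℚ.< q → ℚ.∣ p ∣ ℚ.< q
∣p∣<-intro {p} {q} p<q -p<q with ℚ.∣p∣≡p∨∣p∣≡-p p
... | inj₁ eq = subst (ℚ._< q) (sym eq) p<q
... | inj₂ eq = subst (ℚ._< q) (sym eq) -p<q

seq-^ℝ : ∀ x k n → seq (x ^ℝ k) n ≡ seq x n ^ℚ k
seq-^ℝ x zero    n = refl
seq-^ℝ x (suc k) n = cong (seq x n ℚ.*_) (seq-^ℝ x k n)

squeeze : ∀ x y z → (∀ n → seq x n ℚ.≤ seq y n) → (∀ n → seq y n ℚ.≤ seq z n) → x ≈ℝ z → x ≈ℝ y
squeeze x y z x≤y y≤z x≈z ε 0<ε with N , h ← x≈z ε 0<ε = N , λ n N≤n → begin-strict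
  ℚ.∣ seq x n ℚ.- seq y n ∣ ≡⟨ ∣p-q∣≡∣q-p∣ (seq x n) (seq y n) ⟩
  ℚ.∣ seq y n ℚ.- seq x n ∣ ≡⟨ ℚ.0≤p⇒∣p∣≡p (0≤q-p (x≤y n)) ⟩
  seq y n ℚ.- seq x n       ≤⟨ ℚ.+-monoˡ-≤ (ℚ.- seq x n) (y≤z n) ⟩
  seq z n ℚ.- seq x n       ≤⟨ p≤∣p∣ (seq z n ℚ.- seq x n) ⟩
  ℚ.∣ seq z n ℚ.- seq x n ∣ ≡⟨ ∣p-q∣≡∣q-p∣ (seq z n) (seq x n) ⟩
  ℚ.∣ seq x n ℚ.- seq z n ∣ <⟨ h n N≤n ⟩
  ε                         ∎
  where open ℚ.≤-Reasoning

∣gridStep-0∣ : ∀ n → ℚ.∣ gridStep n ℚ.- 0ℚ ∣ ≡ gridStep n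
∣gridStep-0∣ n = trans (cong ℚ.∣_∣ (ℚ.+-identityʳ (gridStep n))) (ℚ.0≤p⇒∣p∣≡p (ℚ.<⇒≤ (gridStep>0 n)))

gridStepℝ : ℝ
gridStepℝ = mkℝ gridStep λ ε 0<ε → let N , h = gridStep→0 (½ ℚ.* ε) (half>0 0<ε) in
  N , λ m n p q → triangle-< (gridStep m) 0ℚ (gridStep n) ε
    (subst (ℚ._< ½ ℚ.* ε) (sym (∣gridStep-0∣ m)) (h m p))
    (subst (ℚ._< ½ ℚ.* ε) (trans (sym (∣gridStep-0∣ n)) (∣p-q∣≡∣q-p∣ (gridStep n) 0ℚ)) (h n q))

gridStepℝ≈0 : gridStepℝ ≈ℝ 0ℝ
gridStepℝ≈0 ε 0<ε with N , h ← gridStep→0 ε 0<ε = N , λ n N≤n →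
  subst (ℚ._< ε) (sym (∣gridStep-0∣ n)) (h n N≤n)

module _ (x : ℝ) (0≤x : NonNegℝ x) (k : ℕ) where
  private
    approx : ℕ → ℚ
    approx n = proj₁ (gridRoot k n (0≤x n))

    approx-isGridRoot : ∀ n → IsGridRoot (suc k) (gridStep n) (seq x n) (approx n)
    approx-isGridRoot n = proj₂ (gridRoot k n (0≤x n))

    approx-cauchy : IsCauchy approx
    approx-cauchy ε 0<ε =
      let M , f = cauchy x ((½ ℚ.* ε) ^ℚ suc k) (^ℚ-pos (suc k) (half>0 0<ε))
          N , g = gridStep→0 (½ ℚ.* ε) (half>0 0<ε)
          diff : ∀ m n → M ℕ.+ N ℕ.≤ m → M ℕ.+ N ℕ.≤ n → approx m ℚ.- approx n ℚ.< ε
          diff m n p q =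
            let 0≤r , r≤ , _ = approx-isGridRoot m
                0≤s , _ , <s = approx-isGridRoot n
            in gridRoots-close k ε 0<ε (ℚ.<⇒≤ (gridStep>0 n)) (g n (ℕ.m+n≤o⇒n≤o M q))
                 (f m n (ℕ.m+n≤o⇒m≤o M p) (ℕ.m+n≤o⇒m≤o M q)) 0≤r r≤ 0≤s <s
      in M ℕ.+ N , λ m n p q → ∣p∣<-intro (diff m n p q)
           (subst (ℚ._< ε) (solve 2 (λ a b → b :- a := :- (a :- b)) refl (approx m) (approx n))
             (diff n m q p))

  rootℝ : ℝ
  rootℝ = mkℝ approx approx-cauchy

  rootℝ-nonNeg : NonNegℝ rootℝ
  rootℝ-nonNeg n = proj₁ (approx-isGridRoot n)

  -- Termwise, `x` lies between the powers of the root and of the root plus the grid step. These two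
  -- are equal as reals because the step tends to zero.
  rootℝ-^ : rootℝ ^ℝ suc k ≈ℝ x
  rootℝ-^ = squeeze (rootℝ ^ℝ suc k) x ((rootℝ +ℝ gridStepℝ) ^ℝ suc k)
    (λ n → subst (ℚ._≤ seq x n) (sym (seq-^ℝ rootℝ (suc k) n)) (proj₁ (proj₂ (approx-isGridRoot n))))
    (λ n → ℚ.<⇒≤ (subst (seq x n ℚ.<_) (sym (seq-^ℝ (rootℝ +ℝ gridStepℝ) (suc k) n)) (proj₂ (proj₂ (approx-isGridRoot n)))))
    (^ℝ-congˡ (suc k) {rootℝ} {rootℝ +ℝ gridStepℝ}
      (≈ℝ-trans {rootℝ} {rootℝ +ℝ 0ℝ} {rootℝ +ℝ gridStepℝ}
        (≈ℝ-sym {rootℝ +ℝ 0ℝ} {rootℝ} (seq≡⇒≈ℝ {rootℝ +ℝ 0ℝ} {rootℝ} (ℚ.+-identityʳ ∘ approx)))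
        (+ℝ-cong {rootℝ} {rootℝ} {0ℝ} {gridStepℝ} (≈ℝ-refl {rootℝ}) (≈ℝ-sym {gridStepℝ} {0ℝ} gridStepℝ≈0))))

-- Complex numbers

seq≡⇒≈ : ∀ {z w} → (∀ n → seq (re z) n ≡ seq (re w) n) → (∀ n → seq (im z) n ≡ seq (im w) n) → z ≈ w
seq≡⇒≈ {z} {w} p q = seq≡⇒≈ℝ {re z} {re w} p , seq≡⇒≈ℝ {im z} {im w} q

ℂ-commutativeRing : CommutativeRing 0ℓ 0ℓ
ℂ-commutativeRing = record
  { Carrier = ℂ
  ; _≈_ = _≈_
  ; _+_ = _+_
  ; _*_ = _*_
  ; -_ = -_
  ; 0# = 0#
  ; 1# = 1#
  ; isCommutativeRing = record
    { isRing = record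
      { +-isAbelianGroup = record
        { isGroup = record
          { isMonoid = record
            { isSemigroup = record
              { isMagma = record
                { isEquivalence = record
                  { refl = λ {x} → ≈ℝ-refl {re x} , ≈ℝ-refl {im x}
                  ; sym = λ {x} {y} (p , q) → ≈ℝ-sym {re x} {re y} p , ≈ℝ-sym {im x} {im y} q
                  ; trans = λ {x} {y} {z} (p , q) (r , s) →
                      ≈ℝ-trans {re x} {re y} {re z} p r , ≈ℝ-trans {im x} {im y} {im z} q s
                  }
                ; ∙-cong = λ {x} {y} {u} {v} → +-cong x y u v
                }
              ; assoc = λ x y z → seq≡⇒≈ {(x + y) + z} {x + (y + z)}
                  (λ n → ℚ.+-assoc (seq (re x) n) (seq (re y) n) (seq (re z) n))
                  (λ n → ℚ.+-assoc (seq (im x) n) (seq (im y) n) (seq (im z) n))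
              }
            ; identity = (λ x → seq≡⇒≈ {0# + x} {x} (ℚ.+-identityˡ ∘ seq (re x)) (ℚ.+-identityˡ ∘ seq (im x)))
                       , (λ x → seq≡⇒≈ {x + 0#} {x} (ℚ.+-identityʳ ∘ seq (re x)) (ℚ.+-identityʳ ∘ seq (im x)))
            }
          ; inverse = (λ x → seq≡⇒≈ {(- x) + x} {0#} (ℚ.+-inverseˡ ∘ seq (re x)) (ℚ.+-inverseˡ ∘ seq (im x)))
                    , (λ x → seq≡⇒≈ {x + (- x)} {0#} (ℚ.+-inverseʳ ∘ seq (re x)) (ℚ.+-inverseʳ ∘ seq (im x)))
          ; ⁻¹-cong = λ {x} {y} (p , q) → -ℝ-cong {re x} {re y} p , -ℝ-cong {im x} {im y} q
          }
        ; comm = λ x y → seq≡⇒≈ {x + y} {y + x}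
            (λ n → ℚ.+-comm (seq (re x) n) (seq (re y) n))
            (λ n → ℚ.+-comm (seq (im x) n) (seq (im y) n))
        }
      ; *-cong = λ {x} {y} {u} {v} → *-cong x y u v
      ; *-assoc = λ x y z → seq≡⇒≈ {(x * y) * z} {x * (y * z)}
          (λ n → solve 6 (λ a a′ b b′ c c′ →
              (a :* b :- a′ :* b′) :* c :- (a :* b′ :+ a′ :* b) :* c′
              := a :* (b :* c :- b′ :* c′) :- a′ :* (b :* c′ :+ b′ :* c)) refl
            (seq (re x) n) (seq (im x) n) (seq (re y) n) (seq (im y) n) (seq (re z) n) (seq (im z) n))
          (λ n → solve 6 (λ a a′ b b′ c c′ →
              (a :* b :- a′ :* b′) :* c′ :+ (a :* b′ :+ a′ :* b) :* c
              := a :* (b :* c′ :+ b′ :* c) :+ a′ :* (b :* c :- b′ :* c′)) refl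
            (seq (re x) n) (seq (im x) n) (seq (re y) n) (seq (im y) n) (seq (re z) n) (seq (im z) n))
      ; *-identity = *-identityˡ
                   , (λ x → seq≡⇒≈ {x * 1#} {x}
                      (λ n → solve 2 (λ a a′ → a :* con 1ℚ :- a′ :* con 0ℚ := a) refl (seq (re x) n) (seq (im x) n))
                      (λ n → solve 2 (λ a a′ → a :* con 0ℚ :+ a′ :* con 1ℚ := a′) refl (seq (re x) n) (seq (im x) n)))
      ; distrib = (λ x y z → seq≡⇒≈ {x * (y + z)} {x * y + x * z}
                    (λ n → solve 6 (λ a a′ b b′ c c′ →
                        a :* (b :+ c) :- a′ :* (b′ :+ c′)
                        := (a :* b :- a′ :* b′) :+ (a :* c :- a′ :* c′)) refl
                      (seq (re x) n) (seq (im x) n) (seq (re y) n) (seq (im y) n) (seq (re z) n) (seq (im z) n))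
                    (λ n → solve 6 (λ a a′ b b′ c c′ →
                        a :* (b′ :+ c′) :+ a′ :* (b :+ c)
                        := (a :* b′ :+ a′ :* b) :+ (a :* c′ :+ a′ :* c)) refl
                      (seq (re x) n) (seq (im x) n) (seq (re y) n) (seq (im y) n) (seq (re z) n) (seq (im z) n)))
                , (λ x y z → seq≡⇒≈ {(y + z) * x} {y * x + z * x}
                    (λ n → solve 6 (λ a a′ b b′ c c′ →
                        (b :+ c) :* a :- (b′ :+ c′) :* a′
                        := (b :* a :- b′ :* a′) :+ (c :* a :- c′ :* a′)) refl
                      (seq (re x) n) (seq (im x) n) (seq (re y) n) (seq (im y) n) (seq (re z) n) (seq (im z) n))
                    (λ n → solve 6 (λ a a′ b b′ c c′ →
                        (b :+ c) :* a′ :+ (b′ :+ c′) :* a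
                        := (b :* a′ :+ b′ :* a) :+ (c :* a′ :+ c′ :* a)) refl
                      (seq (re x) n) (seq (im x) n) (seq (re y) n) (seq (im y) n) (seq (re z) n) (seq (im z) n)))
      }
    ; *-comm = *-comm
    }
  }
  where
  *-identityˡ : ∀ x → 1# * x ≈ x
  *-identityˡ x = seq≡⇒≈ {1# * x} {x}
    (λ n → solve 2 (λ a a′ → con 1ℚ :* a :- con 0ℚ :* a′ := a) refl (seq (re x) n) (seq (im x) n))
    (λ n → solve 2 (λ a a′ → con 1ℚ :* a′ :+ con 0ℚ :* a := a′) refl (seq (re x) n) (seq (im x) n))
  *-comm : ∀ x y → x * y ≈ y * x
  *-comm x y = seq≡⇒≈ {x * y} {y * x}
    (λ n → solve 4 (λ a a′ b b′ → a :* b :- a′ :* b′ := b :* a :- b′ :* a′) refl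
      (seq (re x) n) (seq (im x) n) (seq (re y) n) (seq (im y) n))
    (λ n → solve 4 (λ a a′ b b′ → a :* b′ :+ a′ :* b := b :* a′ :+ b′ :* a) refl
      (seq (re x) n) (seq (im x) n) (seq (re y) n) (seq (im y) n))
  +-cong : ∀ x y u v → x ≈ y → u ≈ v → x + u ≈ y + v
  +-cong x y u v (p , q) (r , s) =
    +ℝ-cong {re x} {re y} {re u} {re v} p r , +ℝ-cong {im x} {im y} {im u} {im v} q s
  *-cong : ∀ x y u v → x ≈ y → u ≈ v → x * u ≈ y * v
  *-cong x y u v (p , q) (r , s) =
    +ℝ-cong {re x *ℝ re u} {re y *ℝ re v} { -ℝ (im x *ℝ im u)} { -ℝ (im y *ℝ im v)}
      (*ℝ-cong {re x} {re y} {re u} {re v} p r)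
      (-ℝ-cong {im x *ℝ im u} {im y *ℝ im v} (*ℝ-cong {im x} {im y} {im u} {im v} q s)) ,
    +ℝ-cong {re x *ℝ im u} {re y *ℝ im v} {im x *ℝ re u} {im y *ℝ re v}
      (*ℝ-cong {re x} {re y} {im u} {im v} p s)
      (*ℝ-cong {im x} {im y} {re u} {re v} q r)


ι : ℝ → ℂ
ι x = x +i 0ℝ

𝕚 : ℂ
𝕚 = 0ℝ +i 1ℝ

conj : ℂ → ℂ
conj z = re z +i (-ℝ im z)

normSq : ℂ → ℝ
normSq z = re z *ℝ re z +ℝ im z *ℝ im z

*-conj : ∀ z → z * conj z ≈ ι (normSq z)
*-conj z = seq≡⇒≈ {z * conj z} {ι (normSq z)}
  (λ n → solve 2 (λ a b → a :* a :- b :* :- b := a :* a :+ b :* b) refl (seq (re z) n) (seq (im z) n))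
  (λ n → solve 2 (λ a b → a :* :- b :+ b :* a := con 0ℚ) refl (seq (re z) n) (seq (im z) n))

ι-* : ∀ x y → ι x * ι y ≈ ι (x *ℝ y)
ι-* x y = seq≡⇒≈ {ι x * ι y} {ι (x *ℝ y)}
  (λ n → solve 2 (λ a b → a :* b :- con 0ℚ :* con 0ℚ := a :* b) refl (seq x n) (seq y n))
  (λ n → solve 2 (λ a b → a :* con 0ℚ :+ con 0ℚ :* b := con 0ℚ) refl (seq x n) (seq y n))

ι-cong : ∀ {x y} → x ≈ℝ y → ι x ≈ ι y
ι-cong x≈y = x≈y , ≈ℝ-refl {0ℝ}

nonNeg-square : ∀ x → NonNegℝ (x *ℝ x)
nonNeg-square x n = 0≤p*p (seq x n)

nonNeg-+ : ∀ {x y} → NonNegℝ x → NonNegℝ y → NonNegℝ (x +ℝ y)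
nonNeg-+ 0≤x 0≤y n = ℚ.+-mono-≤ (0≤x n) (0≤y n)

nonNeg-sum≈0ʳ : ∀ {x y} → NonNegℝ x → NonNegℝ y → x +ℝ y ≈ℝ 0ℝ → y ≈ℝ 0ℝ
nonNeg-sum≈0ʳ {x} {y} 0≤x 0≤y x+y≈0 = nonNeg-sum≈0 {y} {x} 0≤y 0≤x
  (≈ℝ-trans {y +ℝ x} {x +ℝ y} {0ℝ} (seq≡⇒≈ℝ {y +ℝ x} {x +ℝ y} (λ n → ℚ.+-comm (seq y n) (seq x n))) x+y≈0)

1ℝ≉0 : ¬ 1ℝ ≈ℝ 0ℝ
1ℝ≉0 1≈0 with N , h ← 1≈0 1ℚ (ℚ.positive⁻¹ 1ℚ) = ℚ.<-irrefl refl (h N ℕ.≤-refl)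

module ℂ-Ring = CommutativeRing ℂ-commutativeRing

module Complex (em : ExcludedMiddle 0ℓ) where

  ℝ-field : Field
  ℝ-field = record { commutativeRing = ℝ-commutativeRing ; inverse = ℝ-inverse em ; 1≉0 = 1ℝ≉0 }

  module ℝ-Field = OverField em ℝ-field

  normSq≈0⇒≈0 : ∀ z → normSq z ≈ℝ 0ℝ → z ≈ 0#
  normSq≈0⇒≈0 z eq =
    ℝ-Field.xx≈0⇒x≈0 {re z} (nonNeg-sum≈0 {re z *ℝ re z} {im z *ℝ im z} (nonNeg-square (re z)) (nonNeg-square (im z)) eq) ,
    ℝ-Field.xx≈0⇒x≈0 {im z} (nonNeg-sum≈0ʳ {re z *ℝ re z} {im z *ℝ im z} (nonNeg-square (re z)) (nonNeg-square (im z)) eq)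

  ℂ-inverse : ∀ z → ¬ z ≈ 0# → Σ[ w ∈ ℂ ] z * w ≈ 1#
  ℂ-inverse z z≉0 = let r , eq = ℝ-inverse em (normSq z) (z≉0 ∘ normSq≈0⇒≈0 z) in
    conj z * ι r ,
    ℂ-Ring.trans {z * (conj z * ι r)} {(z * conj z) * ι r} {1#}
      (ℂ-Ring.sym {(z * conj z) * ι r} {z * (conj z * ι r)} (ℂ-Ring.*-assoc z (conj z) (ι r)))
      (ℂ-Ring.trans {(z * conj z) * ι r} {ι (normSq z) * ι r} {1#}
        (ℂ-Ring.*-congʳ {ι r} {z * conj z} {ι (normSq z)} (*-conj z))
        (ℂ-Ring.trans {ι (normSq z) * ι r} {ι (normSq z *ℝ r)} {1#}
          (ι-* (normSq z) r) (ι-cong {normSq z *ℝ r} {1ℝ} eq)))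

  1≉0 : ¬ 1# ≈ 0#
  1≉0 (1≈0 , _) = 1ℝ≉0 1≈0

  ℂ-field : Field
  ℂ-field = record { commutativeRing = ℂ-commutativeRing ; inverse = ℂ-inverse ; 1≉0 = 1≉0 }

  module ℂ-Field = OverField em ℂ-field

  -- The last argument `1` stands for the exponent `2`, since `rootℝ` extracts roots of order
  -- `suc k`.
  modulus : ℂ → ℝ
  modulus z = rootℝ (normSq z) (nonNeg-+ {re z *ℝ re z} {im z *ℝ im z} (nonNeg-square (re z)) (nonNeg-square (im z))) 1

  rootℝ-square : ∀ x (0≤x : NonNegℝ x) → rootℝ x 0≤x 1 *ℝ rootℝ x 0≤x 1 ≈ℝ x
  rootℝ-square x 0≤x = ≈ℝ-trans {rootℝ x 0≤x 1 *ℝ rootℝ x 0≤x 1} {rootℝ x 0≤x 1 ^ℝ 2} {x}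
    (≈ℝ-sym {rootℝ x 0≤x 1 ^ℝ 2} {rootℝ x 0≤x 1 *ℝ rootℝ x 0≤x 1} (ℝ-Field.x^2≈x*x (rootℝ x 0≤x 1))) (rootℝ-^ x 0≤x 1)

  modulus-square : ∀ z → modulus z *ℝ modulus z ≈ℝ normSq z
  modulus-square z = rootℝ-square (normSq z) _

  nonNeg-modulus : ∀ z → NonNegℝ (modulus z)
  nonNeg-modulus z = rootℝ-nonNeg (normSq z) _ 1

  -- The formula divides by a square root `d` of twice the sum of the modulus and `re z`. For
  -- non-negative `re z` this vanishes only at `z ≈ 0#`, whereas it vanishes on the whole negative
  -- axis. The hypothesis states non-negativity in a form that respects `_≈ℝ_`.
  squareRoot-of-nonNegRe : ∀ z → re z ≈ℝ ∣ re z ∣ℝ → Σ[ w ∈ ℂ ] w * w ≈ z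
  squareRoot-of-nonNegRe z re≈∣re∣ = root (em {d ≈ 0#})
    where
    m = modulus z
    -- `rootℝ` asks for non-negative terms, so `re z` is replaced by its absolute value, which is an
    -- equal real here.
    a = ∣ re z ∣ℝ
    s = m +ℝ a

    0≤m : NonNegℝ m
    0≤m = nonNeg-modulus z
    0≤a : NonNegℝ a
    0≤a n = ℚ.0≤∣p∣ (seq (re z) n)
    0≤s : NonNegℝ s
    0≤s = nonNeg-+ {m} {a} 0≤m 0≤a
    0≤s+s : NonNegℝ (s +ℝ s)
    0≤s+s = nonNeg-+ {s} {s} 0≤s 0≤s

    r = rootℝ (s +ℝ s) 0≤s+s 1
    d = ι r

    mm : ι m * ι m ≈ z * conj z
    mm = ℂ-Ring.trans {ι m * ι m} {ι (m *ℝ m)} {z * conj z} (ι-* m m)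
      (ℂ-Ring.trans {ι (m *ℝ m)} {ι (normSq z)} {z * conj z} (ι-cong {m *ℝ m} {normSq z} (modulus-square z))
        (ℂ-Ring.sym {z * conj z} {ι (normSq z)} (*-conj z)))

    s+s≈ : ι (s +ℝ s) ≈ (ι m + ι m) + (z + conj z)
    s+s≈ = ≈ℝ-trans {s +ℝ s} {(m +ℝ m) +ℝ (a +ℝ a)} {(m +ℝ m) +ℝ (re z +ℝ re z)}
        (seq≡⇒≈ℝ {s +ℝ s} {(m +ℝ m) +ℝ (a +ℝ a)}
          (λ n → solve 2 (λ m a → (m :+ a) :+ (m :+ a) := (m :+ m) :+ (a :+ a)) refl (seq m n) (seq a n)))
        (+ℝ-cong {m +ℝ m} {m +ℝ m} {a +ℝ a} {re z +ℝ re z} (≈ℝ-refl {m +ℝ m})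
          (+ℝ-cong {a} {re z} {a} {re z} (≈ℝ-sym {re z} {a} re≈∣re∣) (≈ℝ-sym {re z} {a} re≈∣re∣))) ,
      seq≡⇒≈ℝ {0ℝ} {im ((ι m + ι m) + (z + conj z))}
        (λ n → solve 1 (λ b → con 0ℚ := (con 0ℚ :+ con 0ℚ) :+ (b :- b)) refl (seq (im z) n))

    dd : d * d ≈ (ι m + ι m) + (z + conj z)
    dd = ℂ-Ring.trans {d * d} {ι (r *ℝ r)} {(ι m + ι m) + (z + conj z)} (ι-* r r)
      (ℂ-Ring.trans {ι (r *ℝ r)} {ι (s +ℝ s)} {(ι m + ι m) + (z + conj z)}
        (ι-cong {r *ℝ r} {s +ℝ s} (rootℝ-square (s +ℝ s) 0≤s+s)) s+s≈)

    d≈0⇒z≈0 : d ≈ 0# → z ≈ 0#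
    d≈0⇒z≈0 (r≈0 , _) = normSq≈0⇒≈0 z (≈ℝ-trans {normSq z} {m *ℝ m} {0ℝ}
      (≈ℝ-sym {m *ℝ m} {normSq z} (modulus-square z))
      (ℝ-Field.x≈0⇒xy≈0 {m} m (nonNeg-sum≈0 {m} {a} 0≤m 0≤a (nonNeg-sum≈0 {s} {s} 0≤s 0≤s
        (≈ℝ-trans {s +ℝ s} {r *ℝ r} {0ℝ} (≈ℝ-sym {r *ℝ r} {s +ℝ s} (rootℝ-square (s +ℝ s) 0≤s+s))
          (ℝ-Field.x≈0⇒xy≈0 {r} r r≈0))))))

    root : Dec (d ≈ 0#) → Σ[ w ∈ ℂ ] w * w ≈ z
    root (yes d≈0) = 0# , ℂ-Field.square-root-of-0 {z} (d≈0⇒z≈0 d≈0)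
    root (no d≉0) = let d⁻¹ , eq = ℂ-inverse d d≉0 in
      (z + ι m) * d⁻¹ , ℂ-Field.squareRoot-formula {z} {conj z} {ι m} {d} {d⁻¹} mm dd eq

  𝕚*𝕚≈-1 : 𝕚 * 𝕚 ≈ - 1#
  𝕚*𝕚≈-1 = seq≡⇒≈ {𝕚 * 𝕚} { - 1#} (λ _ → refl) (λ _ → refl)

  -- `re z` and its absolute value have the same square, so they agree up to sign. With the minus
  -- sign, `- z` has a root by the previous case, and `𝕚` times it is a root of `z`.
  squareRoot : ∀ z → Σ[ w ∈ ℂ ] w * w ≈ z
  squareRoot z = [ squareRoot-of-nonNegRe z , squareRoot-of-nonPosRe ]
    (ℝ-Field.xx≈yy⇒x≈±y {re z} {∣ re z ∣ℝ}
      (≈ℝ-sym {∣ re z ∣ℝ *ℝ ∣ re z ∣ℝ} {re z *ℝ re z} (∣x∣*∣x∣≈x*x (re z))))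
    where
    squareRoot-of-nonPosRe : re z ≈ℝ -ℝ ∣ re z ∣ℝ → Σ[ w ∈ ℂ ] w * w ≈ z
    squareRoot-of-nonPosRe re≈-∣re∣ =
      let w , eq = squareRoot-of-nonNegRe (- z) (≈ℝ-trans { -ℝ re z} { -ℝ -ℝ ∣ re z ∣ℝ} {∣ -ℝ re z ∣ℝ}
                   (-ℝ-cong {re z} { -ℝ ∣ re z ∣ℝ} re≈-∣re∣)
                   (seq≡⇒≈ℝ { -ℝ -ℝ ∣ re z ∣ℝ} {∣ -ℝ re z ∣ℝ} (λ n →
                     trans (solve 1 (λ a → :- (:- a) := a) refl ℚ.∣ seq (re z) n ∣) (sym (ℚ.∣-p∣≡∣p∣ (seq (re z) n))))))
      in 𝕚 * w , ℂ-Field.squareRoot-neg {𝕚} {z} {w} 𝕚*𝕚≈-1 eq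

  -- Complex conjugation, roots of real squares and definiteness

  x+x≈0⇒x≈0ℝ : ∀ x → x +ℝ x ≈ℝ 0ℝ → x ≈ℝ 0ℝ
  x+x≈0⇒x≈0ℝ x eq ε 0<ε with N , h ← eq ε 0<ε = N , λ n N≤n →
    ℚ.≤-<-trans (ℚ.≤-trans (p≤p+p (ℚ.0≤∣p∣ (seq x n ℚ.- 0ℚ)))
      (ℚ.≤-reflexive (double (seq x n)))) (h n N≤n)
    where
    p≤p+p : ∀ {p} → 0ℚ ℚ.≤ p → p ℚ.≤ p ℚ.+ p
    p≤p+p {p} 0≤p = subst (ℚ._≤ p ℚ.+ p) (ℚ.+-identityʳ p) (ℚ.+-monoʳ-≤ p 0≤p)
    double : ∀ p → ℚ.∣ p ℚ.- 0ℚ ∣ ℚ.+ ℚ.∣ p ℚ.- 0ℚ ∣ ≡ ℚ.∣ (p ℚ.+ p) ℚ.- 0ℚ ∣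
    double p = trans (solve 1 (λ a → a :+ a := con (1ℚ ℚ.+ 1ℚ) :* a) refl ℚ.∣ p ℚ.- 0ℚ ∣)
      (trans (sym (ℚ.∣p*q∣≡∣p∣*∣q∣ (1ℚ ℚ.+ 1ℚ) (p ℚ.- 0ℚ)))
        (cong ℚ.∣_∣ (solve 1 (λ a → con (1ℚ ℚ.+ 1ℚ) :* (a :- con 0ℚ) := (a :+ a) :- con 0ℚ) refl p)))

  conj-real⇒im≈0 : ∀ z → conj z ≈ z → im z ≈ℝ 0ℝ
  conj-real⇒im≈0 z (_ , -im≈im) = x+x≈0⇒x≈0ℝ (im z)
    (≈ℝ-trans {im z +ℝ im z} {(-ℝ im z) +ℝ im z} {0ℝ}
      (+ℝ-cong {im z} { -ℝ im z} {im z} {im z} (≈ℝ-sym { -ℝ im z} {im z} -im≈im) (≈ℝ-refl {im z}))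
      (seq≡⇒≈ℝ {(-ℝ im z) +ℝ im z} {0ℝ} (ℚ.+-inverseˡ ∘ seq (im z))))

  ι-^ : ∀ x k → ι x ^ k ≈ ι (x ^ℝ k)
  ι-^ x zero = ℂ-Ring.refl {1#}
  ι-^ x (suc k) = ℂ-Ring.trans {ι x * ι x ^ k} {ι x * ι (x ^ℝ k)} {ι (x ^ℝ suc k)}
    (ℂ-Ring.*-congˡ {ι x} {ι x ^ k} {ι (x ^ℝ k)} (ι-^ x k)) (ι-* x (x ^ℝ k))

  -- For `z` fixed by conjugation, `z * z` is the real `re z *ℝ re z`, whose terms are squares of
  -- rationals, so `rootℝ` applies.
  root-of-real-square : ∀ k z → conj z ≈ z → Σ[ r ∈ ℂ ] r ^ suc k ≈ z * z
  root-of-real-square k z real = ι r ,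
    ℂ-Ring.trans {ι r ^ suc k} {ι (r ^ℝ suc k)} {z * z} (ι-^ r (suc k))
      (ℂ-Ring.trans {ι (r ^ℝ suc k)} {ι (re z *ℝ re z)} {z * z}
        (ι-cong {r ^ℝ suc k} {re z *ℝ re z} (rootℝ-^ (re z *ℝ re z) (nonNeg-square (re z)) k))
        (ℂ-Ring.trans {ι (re z *ℝ re z)} {ι (re z) * ι (re z)} {z * z}
          (ℂ-Ring.sym {ι (re z) * ι (re z)} {ι (re z *ℝ re z)} (ι-* (re z) (re z)))
          (ℂ-Ring.*-cong {ι (re z)} {z} {ι (re z)} {z} ιre≈z ιre≈z)))
    where
    r = rootℝ (re z *ℝ re z) (nonNeg-square (re z)) k
    ιre≈z : ι (re z) ≈ z
    ιre≈z = ≈ℝ-refl {re z} , ≈ℝ-sym {im z} {0ℝ} (conj-real⇒im≈0 z real)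

  conj-*-self : ∀ z → conj z * z ≈ ι (normSq z)
  conj-*-self z = ℂ-Ring.trans {conj z * z} {z * conj z} {ι (normSq z)} (ℂ-Ring.*-comm (conj z) z) (*-conj z)

  normSq-sum≈0 : ∀ {n} (y : Fin n → ℂ) → sum (λ i → ι (normSq (y i))) ≈ 0# → ∀ i → y i ≈ 0#
  normSq-sum≈0 {suc n} y (eq , _) = λ where
      zero    → normSq≈0⇒≈0 (y zero) (nonNeg-sum≈0 {normSq (y zero)} {re rest} (0≤normSq (y zero)) (0≤sum (y ∘ suc)) eq)
      (suc i) → normSq-sum≈0 (y ∘ suc)
        (nonNeg-sum≈0ʳ {normSq (y zero)} {re rest} (0≤normSq (y zero)) (0≤sum (y ∘ suc)) eq , im≈0 (y ∘ suc)) i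
    where
    rest = sum (λ i → ι (normSq (y (suc i))))
    0≤normSq : ∀ z → NonNegℝ (normSq z)
    0≤normSq z = nonNeg-+ {re z *ℝ re z} {im z *ℝ im z} (nonNeg-square (re z)) (nonNeg-square (im z))
    0≤sum : ∀ {m} (y : Fin m → ℂ) → NonNegℝ (re (sum (λ i → ι (normSq (y i)))))
    0≤sum {zero}  y n = ℚ.≤-refl
    0≤sum {suc m} y n = ℚ.+-mono-≤ (0≤normSq (y zero) n) (0≤sum (y ∘ suc) n)
    im≈0 : ∀ {m} (y : Fin m → ℂ) → im (sum (λ i → ι (normSq (y i)))) ≈ℝ 0ℝ
    im≈0 {zero}  y = ≈ℝ-refl {0ℝ}
    im≈0 {suc m} y = ≈ℝ-trans {0ℝ +ℝ im s} {im s} {0ℝ} (seq≡⇒≈ℝ {0ℝ +ℝ im s} {im s} (ℚ.+-identityˡ ∘ seq (im s))) (im≈0 (y ∘ suc))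
      where s = sum (λ i → ι (normSq (y (suc i))))

  conj-definite : ∀ {n} (y : Fin n → ℂ) → sum (λ i → conj (y i) * y i) ≈ 0# → ∀ i → y i ≈ 0#
  conj-definite y eq = normSq-sum≈0 y
    (ℂ-Ring.trans {sum (λ i → ι (normSq (y i)))} {sum (λ i → conj (y i) * y i)} {0#}
      (ℂ-Field.sum-cong-≋ {_} {λ i → ι (normSq (y i))} {λ i → conj (y i) * y i}
        (λ i → ℂ-Ring.sym {conj (y i) * y i} {ι (normSq (y i))} (conj-*-self (y i)))) eq)

  conj-cong : ∀ {z w} → z ≈ w → conj z ≈ conj w
  conj-cong {z} {w} (p , q) = p , -ℝ-cong {im z} {im w} q

  conj-+ : ∀ z w → conj (z + w) ≈ conj z + conj w
  conj-+ z w = seq≡⇒≈ {conj (z + w)} {conj z + conj w} (λ _ → refl) (λ n → ℚ.neg-distrib-+ (seq (im z) n) (seq (im w) n))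

  conj-* : ∀ z w → conj (z * w) ≈ conj z * conj w
  conj-* z w = seq≡⇒≈ {conj (z * w)} {conj z * conj w}
    (λ n → solve 4 (λ a a′ b b′ → a :* b :- a′ :* b′ := a :* b :- (:- a′) :* (:- b′)) refl
      (seq (re z) n) (seq (im z) n) (seq (re w) n) (seq (im w) n))
    (λ n → solve 4 (λ a a′ b b′ → :- (a :* b′ :+ a′ :* b) := a :* (:- b′) :+ (:- a′) :* b) refl
      (seq (re z) n) (seq (im z) n) (seq (re w) n) (seq (im w) n))

  conj-0 : conj 0# ≈ 0#
  conj-0 = seq≡⇒≈ {conj 0#} {0#} (λ _ → refl) (λ _ → refl)

  conj-signValue : ∀ σ → conj (signValue σ) ≈ signValue σ
  conj-signValue Sign.+ = seq≡⇒≈ {conj 1#} {1#} (λ _ → refl) (λ _ → refl)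
  conj-signValue Sign.- = seq≡⇒≈ {conj (- 1#)} { - 1#} (λ _ → refl) (λ _ → refl)

  conj-involutive : ∀ z → conj (conj z) ≈ z
  conj-involutive z = seq≡⇒≈ {conj (conj z)} {z} (λ _ → refl) (λ n → solve 1 (λ a → :- (:- a) := a) refl (seq (im z) n))

  𝕚≉0 : ¬ 𝕚 ≈ 0#
  𝕚≉0 (_ , 1≈0) = 1ℝ≉0 1≈0

  conj-𝕚 : conj 𝕚 ≈ - 𝕚
  conj-𝕚 = seq≡⇒≈ {conj 𝕚} { - 𝕚} (λ _ → refl) (λ _ → refl)

  x+x≈0⇒x≈0 : ∀ z → z + z ≈ 0# → z ≈ 0#
  x+x≈0⇒x≈0 z (p , q) = x+x≈0⇒x≈0ℝ (re z) p , x+x≈0⇒x≈0ℝ (im z) q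

fromℕ*1/n : ∀ n .{{_ : ℕ.NonZero n}} → fromℕ n ℚ.* ((+ 1) ℚ./ n) ≡ 1ℚ
fromℕ*1/n (suc n) = trans
  (cong (fromℕ (suc n) ℚ.*_) (ℚ.↥p/↧p≡p (mkℚ (+ 1) n (Coprime.1-coprimeTo (suc n)))))
  (ℚ.*-inverseʳ (fromℕ (suc n)))

-- Specialization to complex tensors and matrices

module Theorem (em : ExcludedMiddle 0ℓ) where

  open Complex em

  multiSum-suc : ∀ {n} m (f : Vec (Fin n) (suc m) → ℂ) →
    multiSum (suc m) f ≈ sum (λ i → multiSum m (λ is → f (i ∷ is)))
  multiSum-suc m f = ℂ-Ring.refl {multiSum (suc m) f}

  monomial-∷ : ∀ {m n} (x : Fin n → ℂ) i (is : Vec (Fin n) m) → monomial x (i ∷ is) ≈ x i * monomial x is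
  monomial-∷ x i is = ℂ-Ring.refl {monomial x (i ∷ is)}

  module Sp = ℂ-Field.Spectrum squareRoot signValue
    (ℂ-Ring.refl {1#}) (ℂ-Ring.refl { - 1#})
    multiSum (λ f → ℂ-Ring.refl {f []}) multiSum-suc monomial (λ _ → ℂ-Ring.refl {1#}) monomial-∷
    adjacencyMatrix (λ Γ i j → ℂ-Ring.refl {adjacencyMatrix Γ i j})

  open import Algebra.Definitions.RawSemiring rawSemiring using () renaming (_×_ to _·_)

  re-· : ∀ n q j → seq (re (n · ℚ→ℂ q)) j ≡ fromℕ n ℚ.* q
  re-· zero    q j = sym (ℚ.*-zeroˡ q)
  re-· (suc n) q j = trans (cong (q ℚ.+_) (re-· n q j)) (trans (ℚ.+-comm q (fromℕ n ℚ.* q))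
    (trans (cong (fromℕ n ℚ.* q ℚ.+_) (sym (ℚ.*-identityˡ q)))
      (trans (sym (ℚ.*-distribʳ-+ q (fromℕ n) 1ℚ)) (cong (ℚ._* q) (sym (fromℕ-suc n))))))

  im-· : ∀ n q j → seq (im (n · ℚ→ℂ q)) j ≡ 0ℚ
  im-· zero    q j = refl
  im-· (suc n) q j = trans (ℚ.+-identityˡ _) (im-· n q j)

  -- For `n` the factorial of `k - 1`, the nonzero entry of the adjacency tensor cancels the number
  -- of orderings of the remaining indices.
  n·1/n≈1 : ∀ n .{{_ : ℕ.NonZero n}} → n · ℚ→ℂ ((+ 1) ℚ./ n) ≈ 1#
  n·1/n≈1 n = seq≡⇒≈ {n · ℚ→ℂ ((+ 1) ℚ./ n)} {1#}
    (λ j → trans (re-· n ((+ 1) ℚ./ n) j) (fromℕ*1/n n)) (im-· n ((+ 1) ℚ./ n))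

  module _ {n} (G : Graph n) (k : ℕ) (2≤k : 2 ≤ k) (j : Fin (k ℕ.∸ 2)) where

    module Te = Sp.Tensor G k 2≤k j (ℚ→ℂ (((+ 1) ℚ./ (pred k !)) {{pred k !≢0}})) (n·1/n≈1 (pred k !) {{pred k !≢0}})
      (adjacencyTensor (powerHypergraph G k 2≤k))
      (λ i is → ℂ-Ring.refl {adjacencyTensor (powerHypergraph G k 2≤k) i is})

    hypergraph⇒edgeSum : ∀ {μ} → IsHypergraphEigenvalue (powerHypergraph G k 2≤k) μ → ∃[ x ] Sp.IsEdgeSumEigenpair G k μ x
    hypergraph⇒edgeSum {μ} (x , pair) = x , Te.tensor⇒edgeSum {μ} {x} pair

    edgeSum⇒hypergraph : ∀ {μ} → ∃[ x ] Sp.IsEdgeSumEigenpair G k μ x → IsHypergraphEigenvalue (powerHypergraph G k 2≤k) μ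
    edgeSum⇒hypergraph {μ} (x , pair) = x , Te.edgeSum⇒tensor {μ} {x} pair

  module Co = Sp.Conjugation conj (λ {z} {w} → conj-cong {z} {w}) conj-+ conj-* conj-0 conj-signValue conj-involutive conj-definite
    𝕚 𝕚≉0 conj-𝕚 (λ {x} → x+x≈0⇒x≈0 x) root-of-real-square

  newIndex : ∀ {k} → 3 ≤ k → Fin (k ℕ.∸ 2)
  newIndex (s≤s (s≤s (s≤s z≤n))) = zero

  module _ {n} (G : Graph n) (k : ℕ) (3≤k : 3 ≤ k) (μ : ℂ) where

    hypergraph⇒subgraph : IsHypergraphEigenvalue (powerHypergraph G k (<⇒≤ 3≤k)) μ → Sp.SubgraphEigenvalue G k μ
    hypergraph⇒subgraph eigenvalue = Sp.edgeSum⇒subgraph G {k} 3≤k {μ}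
      (hypergraph⇒edgeSum G k (<⇒≤ 3≤k) (newIndex 3≤k) {μ} eigenvalue)

    subgraph⇒hypergraph : Sp.SubgraphEigenvalue G k μ → IsHypergraphEigenvalue (powerHypergraph G k (<⇒≤ 3≤k)) μ
    subgraph⇒hypergraph eigenvalue = edgeSum⇒hypergraph G k (<⇒≤ 3≤k) (newIndex 3≤k) {μ}
      (Sp.subgraph⇒edgeSum G {k} 3≤k {μ} Co.rootableEigenvector eigenvalue)

    SignedEigenvalue : ∀ {s} → SignedGraph s → Set
    SignedEigenvalue Γ = ∃[ β ] (IsSignedGraphEigenvalue Γ β × β ^ 2 ≈ μ ^ k)

    forget-induced : Sp.SubgraphEigenvalue G k μ →
      ∃[ m ] Σ[ Γ ∈ SignedGraph m ] IsSubgraph (SignedGraph.graph Γ) G × SignedEigenvalue Γ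
    forget-induced (s , Γ , sub , _ , β , pair , β²≈μ^k) = s , Γ , sub , β , pair , β²≈μ^k

    to-induced : k ≡ 3 → Sp.SubgraphEigenvalue G k μ →
      ∃[ m ] Σ[ Γ ∈ SignedGraph m ] IsInducedSubgraph (SignedGraph.graph Γ) G × SignedEigenvalue Γ
    to-induced k≡3 (s , Γ , sub , reflects , β , pair , β²≈μ^k) =
      s , Γ , record { isSubgraph = sub ; reflects = reflects k≡3 } , β , pair , β²≈μ^k

    from-induced : ∃[ m ] Σ[ Γ ∈ SignedGraph m ] IsInducedSubgraph (SignedGraph.graph Γ) G × SignedEigenvalue Γ →
      Sp.SubgraphEigenvalue G k μ
    from-induced (s , Γ , sub , β , pair , β²≈μ^k) =
      s , Γ , IsInducedSubgraph.isSubgraph sub , (λ _ → IsInducedSubgraph.reflects sub) , β , pair , β²≈μ^k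

    from-subgraph : k ≢ 3 → ∃[ m ] Σ[ Γ ∈ SignedGraph m ] IsSubgraph (SignedGraph.graph Γ) G × SignedEigenvalue Γ →
      Sp.SubgraphEigenvalue G k μ
    from-subgraph k≢3 (s , Γ , sub , β , pair , β²≈μ^k) =
      s , Γ , sub , (λ k≡3 → contradiction k≡3 k≢3) , β , pair , β²≈μ^k

theorem1 : ExcludedMiddle 0ℓ →
    ∀ {n} (G : Graph n) (k : ℕ) (3≤k : 3 ≤ k) (μ : ℂ) →
    (k ≡ 3 →
    IsHypergraphEigenvalue (powerHypergraph G k (<⇒≤ 3≤k)) μ ⇔
    (∃[ m ] Σ[ Γ ∈ SignedGraph m ]
    IsInducedSubgraph (SignedGraph.graph Γ) G ×
    (∃[ β ] (IsSignedGraphEigenvalue Γ β × β ^ 2 ≈ μ ^ k)))) ×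
    (4 ≤ k →
    IsHypergraphEigenvalue (powerHypergraph G k (<⇒≤ 3≤k)) μ ⇔
    (∃[ m ] Σ[ Γ ∈ SignedGraph m ]
    IsSubgraph (SignedGraph.graph Γ) G ×
    (∃[ β ] (IsSignedGraphEigenvalue Γ β × β ^ 2 ≈ μ ^ k))))
theorem1 em G k 3≤k μ =
  (λ k≡3 → mk⇔ (to-induced G k 3≤k μ k≡3 ∘ hypergraph⇒subgraph G k 3≤k μ)
               (subgraph⇒hypergraph G k 3≤k μ ∘ from-induced G k 3≤k μ)) ,
  (λ 4≤k → mk⇔ (forget-induced G k 3≤k μ ∘ hypergraph⇒subgraph G k 3≤k μ)
               (subgraph⇒hypergraph G k 3≤k μ ∘ from-subgraph G k 3≤k μ (ℕ.<⇒≢ 4≤k ∘ sym)))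
  where open Theorem em
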